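{- For every integer $n \geq 0$, the following congruences hold: (1) $\overline{p}(11(8n+5)) \equiv 0 \pmod{11}$; (2) $\overline{p}(13\cdot 2^6(8n+7)) \equiv 0 \pmod{13}$.
   Context: An overpartition of a positive integer $n$ is a nonincreasing sequence of positive integers summing to $n$ in which the first occurrence of each distinct part may be overlined. $\overline{p}(n)$ denotes the number of overpartitions of $n$ (with $\overline{p}(0)=1$); equivalently, $\sum_{n\geq 0}\overline{p}(n)q^n = \prod_{k\geq 1}\frac{1+q^k}{1-q^k}$. -}

module Defs where

open import Data.Nat using (ℕ; zero; suc; _+_; _*_; _∸_; _%_)
open import Data.Nat.Divisibility using (_∣_; _∣?_)
open import Relation.Nullary.Decidable using (does)
open import Data.Bool using (if_then_else_)

Series : Set
Series = ℕ → ℕ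

sumTo : ℕ → (ℕ → ℕ) → ℕ
sumTo zero    f = f 0
sumTo (suc m) f = sumTo m f + f (suc m)

_⊛_ : Series → Series → Series
(f ⊛ g) m = sumTo m (λ i → f i * g (m ∸ i))

-- Coefficients of the factor (1+q^k)/(1-q^k) = 1 + 2 Σ_{j≥1} q^{jk}, for k ≥ 1.
-- The argument k here stands for the part size (suc k).
factor : ℕ → Series
factor k zero    = 1
factor k (suc m) = if does (suc k ∣? suc m) then 2 else 0

prodTo : ℕ → Series
prodTo zero    = λ { zero → 1 ; (suc _) → 0 }
prodTo (suc K) = prodTo K ⊛ factor K

-- Overpartition function: coefficient of q^n in Π_{k≥1} (1+q^k)/(1-q^k).
-- Factors with k > n do not affect the coefficient of q^n, so truncating at K = n is exact.
overpartition : ℕ → ℕ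
overpartition n = prodTo n n

{-# OPTIONS --safe #-}
module Submission where

-- By Gauss, the generating function P of overpartitions is 1/y, where x = φ(q) = ∑ q^(j²) and y = φ(−q).
-- Put a = y² and b = x². Passing from q to q² replaces (b, a) by its arithmetic and geometric means
-- ((a + b)/2, √(ab)). This determines everything modulo a prime p = 2n + 1:
-- a comparison of functional equations gives q d/dq (b/a) = (b/a)(b² − a²)/2, and the Hasse polynomial h,
-- being invariant under the mean iteration, satisfies a^(2n) h(b²/a²) = 1 modulo p.
-- Hence q d/dq acts on polynomials in a and s = b²/a², and for p = 11, 13 one finds u, e and cⱼ with
-- a^n = ∑ cⱼ (a^n s^j)^p + q d/dq (a^e u(s)) modulo p. The derivative has no coefficients at exponents
-- divisible by p, and P = P^p a^n, so ∑ p̄(pn) qⁿ = P ∑ cⱼ a^n s^j, a homogeneous polynomial in x and y.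
-- Writing x = E + O, y = E − O with E = φ(q⁴) and O in q ℤ[[q⁸]], where E⁴ − O⁴ = φ(−q⁴)⁴, the coefficients
-- in the classes modulo 4 are again polynomials in x and y times powers of O. For the exponents in
-- question the polynomial finally obtained is symmetric in x⁴ and y⁴, hence a series in q².

open import Defs
open import Algebra.Bundles using (CommutativeRing; RawRing)
import Algebra.Properties.Semiring.Exp
open import Algebra.Solver.Ring.AlmostCommutativeRing using (fromCommutativeRing; _-Raw-AlmostCommutative⟶_; Induced-equivalence)
open import Data.Bool using (if_then_else_)
open import Data.Empty using (⊥-elim)
open import Data.Fin as Fin using (inject₁)
import Data.Fin.Properties as Finₚ
open import Data.Integer as ℤ using (ℤ; +_; -[1+_]; ∣_∣; _⊖_)
import Data.Integer.Divisibility.Signed as ℤ∣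
import Data.Integer.Properties as ℤₚ
import Data.Integer.Solver
open import Data.List using (List; []; _∷_; length)
open import Data.Maybe using (just; nothing)
open import Data.Nat as ℕ using (ℕ; zero; suc; _<_; _≤_; _∸_; _!; _%_; _/_)
open import Data.Nat.Combinatorics using (_C_; nCn≡1; nCk≡n!/k![n-k]!)
open import Data.Nat.Combinatorics.Specification using ([n∸k]!k!∣n!)
open import Data.Nat.Divisibility using (_∣_; _∣?_; divides; m∣m*n; ∣⇒≤; ∣1⇒≡1; ∣m+n∣m⇒∣n; ∣m∣n⇒∣m+n; ∣-refl)
open import Data.Nat.DivMod using (m/n*n≡m; m≡m%n+[m/n]*n)
open import Data.Nat.ListAction using () renaming (sum to sumℕ)
open import Data.Nat.Primality using (Prime; prime?; euclidsLemma; prime⇒nonTrivial; prime⇒nonZero)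
import Data.Nat.Properties as ℕₚ
import Data.Nat.Solver
open import Data.Product using (_,_)
open import Data.Sum using (_⊎_; inj₁; inj₂; [_,_]′)
open import Relation.Binary.Definitions using (WeaklyDecidable)
open import Relation.Binary.PropositionalEquality as ≡ using (_≡_)
open import Relation.Binary.Structures using (IsEquivalence)
open import Relation.Nullary using (¬_; yes; no; contradiction)
open import Relation.Nullary.Decidable using (dec-true; dec-false; from-yes)

-- No theory of modular forms is developed, but weights explain the shape of the argument. Give a
-- weight 1 and s weight 0. The derivation q d/dq raises the weight by 2, and by a further 2n once
-- a^(2n) h(s) = 1 is used to make its value homogeneous. To compare a^n with a p-th power, of
-- weight np, one multiplies it by (a^(2n) h)^n; a primitive of weight e then needs e + 2 + 2n = np,
-- which gives e = 43 for p = 11 and e = 64 for p = 13. Since h^n has degree n² < 3p in both cases,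
-- three constants cⱼ are enough. The symmetry in x⁴ and y⁴ that ends the proof is not automatic.
-- For p = 11 it is present at once in the class 1 modulo 4. For p = 13 it appears in the class 3
-- modulo 4 only after three passages to the exponents divisible by 4: this is the origin of the
-- factor 2^6.

module ℕS = Data.Nat.Solver.+-*-Solver
module ℤS = Data.Integer.Solver.+-*-Solver

-- Integer constants in a commutative ring

module IntegerCoefficients {c ℓ} (R : CommutativeRing c ℓ) where
  open CommutativeRing R
  open import Algebra.Properties.Ring ring using (-‿distribˡ-*; -‿distribʳ-*; -‿+-comm; -0#≈0#; -‿involutive)
  open import Algebra.Properties.Semiring.Mult.TCOptimised semiring using (_×_; ×-homo-+; ×1-homo-*; 1+×)
  open import Relation.Binary.Reasoning.Setoid setoid

  -- With this multiplication `1 × x` is `x` by definition, so `fromℕ 0` and `fromℕ 1` compute to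
  -- `0#` and `1#`, and the homomorphism laws for 0 and 1 become `refl`.
  fromℕ : ℕ → Carrier
  fromℕ n = n × 1#

  fromℤ : ℤ → Carrier
  fromℤ (+ n)    = fromℕ n
  fromℤ -[1+ n ] = - fromℕ (suc n)

  private
    cancel : ∀ u v w → (u + v) - (u + w) ≈ v - w
    cancel u v w = begin
      (u + v) - (u + w)       ≈⟨ +-congˡ (-‿+-comm u w) ⟨
      (u + v) + (- u - w)     ≈⟨ +-congʳ (+-comm u v) ⟩
      (v + u) + (- u - w)     ≈⟨ +-assoc v u _ ⟩
      v + (u + (- u - w))     ≈⟨ +-congˡ (+-assoc u (- u) (- w)) ⟨
      v + ((u - u) - w)       ≈⟨ +-congˡ (+-congʳ (-‿inverseʳ u)) ⟩
      v + (0# - w)            ≈⟨ +-congˡ (+-identityˡ _) ⟩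
      v - w                   ∎

    ⊖-homo : ∀ m n → fromℤ (m ⊖ n) ≈ fromℕ m - fromℕ n
    ⊖-homo m zero = begin
      fromℕ m       ≈⟨ +-identityʳ _ ⟨
      fromℕ m + 0#  ≈⟨ +-congˡ -0#≈0# ⟨
      fromℕ m - 0#  ∎
    ⊖-homo zero (suc n) = sym (+-identityˡ _)
    ⊖-homo (suc m) (suc n) = begin
      fromℤ (suc m ⊖ suc n)                 ≡⟨ ≡.cong fromℤ (ℤₚ.[1+m]⊖[1+n]≡m⊖n m n) ⟩
      fromℤ (m ⊖ n)                         ≈⟨ ⊖-homo m n ⟩
      fromℕ m - fromℕ n                     ≈⟨ cancel 1# _ _ ⟨
      (1# + fromℕ m) - (1# + fromℕ n)       ≈⟨ +-cong (1+× m 1#) (-‿cong (1+× n 1#)) ⟨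
      fromℕ (suc m) - fromℕ (suc n)         ∎

    neg-homo : ∀ i → fromℤ (ℤ.- i) ≈ - fromℤ i
    neg-homo (+ zero)  = sym -0#≈0#
    neg-homo (+ suc n) = refl
    neg-homo -[1+ n ]  = sym (-‿involutive _)

    +-homo : ∀ i j → fromℤ (i ℤ.+ j) ≈ fromℤ i + fromℤ j
    +-homo (+ m)    (+ n)    = ×-homo-+ 1# m n
    +-homo (+ m)    -[1+ n ] = ⊖-homo m (suc n)
    +-homo -[1+ m ] (+ n)    = trans (⊖-homo n (suc m)) (+-comm _ _)
    +-homo -[1+ m ] -[1+ n ] = begin
      - fromℕ (suc (suc (m ℕ.+ n)))          ≡⟨ ≡.cong (λ k → - fromℕ (suc k)) (ℕₚ.+-suc m n) ⟨
      - fromℕ (suc m ℕ.+ suc n)              ≈⟨ -‿cong (×-homo-+ 1# (suc m) (suc n)) ⟩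
      - (fromℕ (suc m) + fromℕ (suc n))      ≈⟨ -‿+-comm _ _ ⟨
      - fromℕ (suc m) - fromℕ (suc n)        ∎

    *-pos : ∀ m j → fromℤ (+ m ℤ.* j) ≈ fromℕ m * fromℤ j
    *-pos m (+ n) = begin
      fromℤ (+ m ℤ.* + n)  ≡⟨ ≡.cong fromℤ (ℤₚ.pos-* m n) ⟨
      fromℕ (m ℕ.* n)      ≈⟨ ×1-homo-* m n ⟩
      fromℕ m * fromℕ n    ∎
    *-pos m -[1+ n ] = begin
      fromℤ (+ m ℤ.* -[1+ n ])       ≡⟨ ≡.cong fromℤ (ℤₚ.neg-distribʳ-* (+ m) (+ suc n)) ⟨
      fromℤ (ℤ.- (+ m ℤ.* + suc n))  ≈⟨ neg-homo (+ m ℤ.* + suc n) ⟩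
      - fromℤ (+ m ℤ.* + suc n)      ≈⟨ -‿cong (*-pos m (+ suc n)) ⟩
      - (fromℕ m * fromℕ (suc n))    ≈⟨ -‿distribʳ-* _ _ ⟩
      fromℕ m * - fromℕ (suc n)      ∎

    *-homo : ∀ i j → fromℤ (i ℤ.* j) ≈ fromℤ i * fromℤ j
    *-homo (+ m) j = *-pos m j
    *-homo -[1+ m ] j = begin
      fromℤ (-[1+ m ] ℤ.* j)         ≡⟨ ≡.cong fromℤ (ℤₚ.neg-distribˡ-* (+ suc m) j) ⟨
      fromℤ (ℤ.- (+ suc m ℤ.* j))    ≈⟨ neg-homo (+ suc m ℤ.* j) ⟩
      - fromℤ (+ suc m ℤ.* j)        ≈⟨ -‿cong (*-pos (suc m) j) ⟩
      - (fromℕ (suc m) * fromℤ j)    ≈⟨ -‿distribˡ-* _ _ ⟩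
      - fromℕ (suc m) * fromℤ j      ∎

    ℤ-rawRing : RawRing _ _
    ℤ-rawRing = CommutativeRing.rawRing ℤₚ.+-*-commutativeRing

  fromℤ-homomorphism : ℤ-rawRing -Raw-AlmostCommutative⟶ fromCommutativeRing R
  fromℤ-homomorphism = record
    { ⟦_⟧    = fromℤ
    ; +-homo = +-homo
    ; *-homo = *-homo
    ; -‿homo = neg-homo
    ; 0-homo = refl
    ; 1-homo = refl
    }

  private
    fromℤ-≟ : WeaklyDecidable (Induced-equivalence fromℤ-homomorphism)
    fromℤ-≟ i j with i ℤ.≟ j
    ... | yes ≡.refl = just refl
    ... | no _       = nothing

  open import Algebra.Solver.Ring ℤ-rawRing (fromCommutativeRing R) fromℤ-homomorphism fromℤ-≟ public
    using (Polynomial; con; _:+_; _:*_; _:-_; :-_; _:^_; _:=_; solve)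

-- Formal power series

module PowerSeries {c ℓ} (R : CommutativeRing c ℓ) where
  open CommutativeRing R
  open import Relation.Binary.Reasoning.Setoid setoid
  open IntegerCoefficients R

  Pow : Set c
  Pow = ℕ → Carrier

  infix 4 _≋_
  record _≋_ (f g : Pow) : Set ℓ where
    constructor pointwise
    field at : ∀ n → f n ≈ g n
  open _≋_ public

  ≋-isEquivalence : IsEquivalence _≋_
  ≋-isEquivalence = record
    { refl  = pointwise λ _ → refl
    ; sym   = λ e → pointwise λ n → sym (at e n)
    ; trans = λ e e′ → pointwise λ n → trans (at e n) (at e′ n)
    }

  tl : Pow → Pow
  tl f n = f (suc n)

  shift : Pow → Pow
  shift f zero    = 0#
  shift f (suc n) = f n

  const : Carrier → Pow
  const r zero    = r
  const r (suc _) = 0#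

  infixl 6 _⊕_
  infixl 7 _⊗_ _•_

  -- The Cauchy product recurses on the exponent through `tl`, so that the ring laws follow by
  -- peeling off the first coefficient of the left factor.
  _⊕_ _⊗_ : Pow → Pow → Pow
  (f ⊕ g) n = f n + g n
  (f ⊗ g) zero    = f 0 * g 0
  (f ⊗ g) (suc n) = f 0 * g (suc n) + (tl f ⊗ g) n

  ⊝_ : Pow → Pow
  (⊝ f) n = - f n

  _•_ : Carrier → Pow → Pow
  (r • f) n = r * f n

  𝟘 𝟙 X : Pow
  𝟘 _ = 0#
  𝟙 = const 1#
  X = shift 𝟙

  ⊗-cong : ∀ {f f′ g g′} → f ≋ f′ → g ≋ g′ → ∀ n → (f ⊗ g) n ≈ (f′ ⊗ g′) n
  ⊗-cong e e′ zero    = *-cong (at e 0) (at e′ 0)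
  ⊗-cong e e′ (suc n) = +-cong (*-cong (at e 0) (at e′ (suc n)))
                               (⊗-cong (pointwise λ k → at e (suc k)) e′ n)

  ⊗-distribʳ : ∀ f g h n → ((g ⊕ h) ⊗ f) n ≈ (g ⊗ f) n + (h ⊗ f) n
  ⊗-distribʳ f g h zero    = distribʳ _ _ _
  ⊗-distribʳ f g h (suc n) = begin
    (g 0 + h 0) * f (suc n) + ((tl g ⊕ tl h) ⊗ f) n
      ≈⟨ +-congˡ (⊗-distribʳ f (tl g) (tl h) n) ⟩
    (g 0 + h 0) * f (suc n) + ((tl g ⊗ f) n + (tl h ⊗ f) n)
      ≈⟨ solve 5 (λ a b x u v → (a :+ b) :* x :+ (u :+ v) := (a :* x :+ u) :+ (b :* x :+ v)) refl _ _ _ _ _ ⟩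
    _ ∎

  ⊗-zeroˡ : ∀ f n → (𝟘 ⊗ f) n ≈ 0#
  ⊗-zeroˡ f zero    = zeroˡ _
  ⊗-zeroˡ f (suc n) = trans (+-cong (zeroˡ _) (⊗-zeroˡ f n)) (+-identityˡ _)

  •-⊗ : ∀ r f g n → ((r • f) ⊗ g) n ≈ r * (f ⊗ g) n
  •-⊗ r f g zero    = *-assoc _ _ _
  •-⊗ r f g (suc n) = trans (+-cong (*-assoc _ _ _) (•-⊗ r (tl f) g n)) (sym (distribˡ _ _ _))

  ⊗-suc : ∀ f g n → (f ⊗ g) (suc n) ≈ (f ⊗ tl g) n + f (suc n) * g 0
  ⊗-suc f g zero    = refl
  ⊗-suc f g (suc n) = trans (+-congˡ (⊗-suc (tl f) g n)) (sym (+-assoc _ _ _))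

  ⊗-comm : ∀ f g n → (f ⊗ g) n ≈ (g ⊗ f) n
  ⊗-comm f g zero    = *-comm _ _
  ⊗-comm f g (suc n) = begin
    f 0 * g (suc n) + (tl f ⊗ g) n   ≈⟨ +-cong (*-comm _ _) (⊗-comm (tl f) g n) ⟩
    g (suc n) * f 0 + (g ⊗ tl f) n   ≈⟨ +-comm _ _ ⟩
    (g ⊗ tl f) n + g (suc n) * f 0   ≈⟨ ⊗-suc g f n ⟨
    (g ⊗ f) (suc n)                  ∎

  ⊗-assoc : ∀ f g h n → ((f ⊗ g) ⊗ h) n ≈ (f ⊗ (g ⊗ h)) n
  ⊗-assoc f g h zero    = *-assoc _ _ _
  ⊗-assoc f g h (suc n) = begin
    f 0 * g 0 * h (suc n) + (((f 0 • tl g) ⊕ (tl f ⊗ g)) ⊗ h) n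
      ≈⟨ +-congˡ (trans (⊗-distribʳ h (f 0 • tl g) (tl f ⊗ g) n)
                        (+-cong (•-⊗ (f 0) (tl g) h n) (⊗-assoc (tl f) g h n))) ⟩
    f 0 * g 0 * h (suc n) + (f 0 * (tl g ⊗ h) n + (tl f ⊗ (g ⊗ h)) n)
      ≈⟨ solve 5 (λ a b x u v → a :* b :* x :+ (a :* u :+ v) := a :* (b :* x :+ u) :+ v) refl _ _ _ _ _ ⟩
    f 0 * (g 0 * h (suc n) + (tl g ⊗ h) n) + (tl f ⊗ (g ⊗ h)) n ∎

  const-⊗ : ∀ r f n → (const r ⊗ f) n ≈ r * f n
  const-⊗ r f zero    = refl
  const-⊗ r f (suc n) = trans (+-congˡ (⊗-zeroˡ f n)) (+-identityʳ _)

  shift-⊗ : ∀ f g n → (shift f ⊗ g) n ≈ shift (f ⊗ g) n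
  shift-⊗ f g zero    = zeroˡ _
  shift-⊗ f g (suc n) = trans (+-congʳ (zeroˡ _)) (+-identityˡ _)

  private
    ⊗-identityˡ : ∀ f n → (𝟙 ⊗ f) n ≈ f n
    ⊗-identityˡ f n = trans (const-⊗ 1# f n) (*-identityˡ _)

  series : CommutativeRing c ℓ
  series = record
    { Carrier = Pow
    ; _≈_ = _≋_
    ; _+_ = _⊕_
    ; _*_ = _⊗_
    ; -_ = ⊝_
    ; 0# = 𝟘
    ; 1# = 𝟙
    ; isCommutativeRing = record
      { isRing = record
        { +-isAbelianGroup = record
          { isGroup = record
            { isMonoid = record
              { isSemigroup = record
                { isMagma = record
                  { isEquivalence = ≋-isEquivalence
                  ; ∙-cong = λ e e′ → pointwise λ n → +-cong (at e n) (at e′ n) }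
                ; assoc = λ f g h → pointwise λ n → +-assoc _ _ _ }
              ; identity = (λ f → pointwise λ n → +-identityˡ _) , (λ f → pointwise λ n → +-identityʳ _) }
            ; inverse = (λ f → pointwise λ n → -‿inverseˡ _) , (λ f → pointwise λ n → -‿inverseʳ _)
            ; ⁻¹-cong = λ e → pointwise λ n → -‿cong (at e n) }
          ; comm = λ f g → pointwise λ n → +-comm _ _ }
        ; *-cong = λ e e′ → pointwise (⊗-cong e e′)
        ; *-assoc = λ f g h → pointwise (⊗-assoc f g h)
        ; *-identity = (λ f → pointwise (⊗-identityˡ f))
                     , (λ f → pointwise λ n → trans (⊗-comm f 𝟙 n) (⊗-identityˡ f n))
        ; distrib = (λ f g h → pointwise λ n → trans (⊗-comm f (g ⊕ h) n)
                       (trans (⊗-distribʳ f g h n) (+-cong (⊗-comm g f n) (⊗-comm h f n))))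
                  , (λ f g h → pointwise (⊗-distribʳ f g h))
        }
      ; *-comm = λ f g → pointwise (⊗-comm f g)
      }
    }

  module S = CommutativeRing series
  module Sℤ = IntegerCoefficients series
  open import Algebra.Properties.Semiring.Exp S.semiring public using () renaming (_^_ to _⊗^_)

  shift-≋ : ∀ f → shift f ≋ X ⊗ f
  shift-≋ f = pointwise λ n → sym (trans (shift-⊗ 𝟙 f n) (shift-cong n))
    where
    shift-cong : ∀ n → shift (𝟙 ⊗ f) n ≈ shift f n
    shift-cong zero    = refl
    shift-cong (suc n) = ⊗-identityˡ f n

  X⊗-zero : ∀ f → (X ⊗ f) 0 ≈ 0#
  X⊗-zero f = zeroˡ _

  X⊗-suc : ∀ f n → (X ⊗ f) (suc n) ≈ f n
  X⊗-suc f n = sym (at (shift-≋ f) (suc n))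

  head-tail : ∀ f → f ≋ const (f 0) ⊕ X ⊗ tl f
  head-tail f = pointwise λ where
    zero    → sym (trans (+-congˡ (zeroˡ _)) (+-identityʳ _))
    (suc n) → sym (trans (+-identityˡ _) (X⊗-suc (tl f) n))

  fromℕ-const : ∀ n → Sℤ.fromℕ n ≋ const (fromℕ n)
  fromℕ-const zero = pointwise λ where
    zero    → refl
    (suc _) → refl
  fromℕ-const (suc n) = pointwise λ where
      zero    → trans (at (1+×ₛ n) 0) (trans (+-congˡ (at (fromℕ-const n) 0)) (sym (1+× n 1#)))
      (suc k) → trans (at (1+×ₛ n) (suc k)) (trans (+-identityˡ _) (at (fromℕ-const n) (suc k)))
    where
    open import Algebra.Properties.Semiring.Mult.TCOptimised semiring using (1+×)
    open import Algebra.Properties.Semiring.Mult.TCOptimised S.semiring using () renaming (1+× to 1+×′)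
    1+×ₛ : ∀ n → Sℤ.fromℕ (suc n) ≋ 𝟙 ⊕ Sℤ.fromℕ n
    1+×ₛ n = 1+×′ n 𝟙

  fromℕ-⊗ : ∀ m f n → (Sℤ.fromℕ m ⊗ f) n ≈ fromℕ m * f n
  fromℕ-⊗ m f n = trans (⊗-cong (fromℕ-const m) S.refl n) (const-⊗ _ f n)

  -- spread k j f is X^j times f(X^(k+1)); this form makes coefficientwise inductions structural.
  spread : ℕ → ℕ → Pow → Pow
  spread k zero    f zero    = f 0
  spread k zero    f (suc n) = spread k k (tl f) n
  spread k (suc j) f zero    = 0#
  spread k (suc j) f (suc n) = spread k j f n

  V : ℕ → Pow → Pow
  V m = spread (ℕ.pred m) 0

  spread-cong : ∀ k j {f g} → f ≋ g → ∀ n → spread k j f n ≈ spread k j g n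
  spread-cong k zero    e zero    = at e 0
  spread-cong k zero    e (suc n) = spread-cong k k (pointwise λ i → at e (suc i)) n
  spread-cong k (suc j) e zero    = refl
  spread-cong k (suc j) e (suc n) = spread-cong k j e n

  spread-⊕ : ∀ k j f g n → spread k j (f ⊕ g) n ≈ spread k j f n + spread k j g n
  spread-⊕ k zero    f g zero    = refl
  spread-⊕ k zero    f g (suc n) = spread-⊕ k k (tl f) (tl g) n
  spread-⊕ k (suc j) f g zero    = sym (+-identityˡ _)
  spread-⊕ k (suc j) f g (suc n) = spread-⊕ k j f g n

  spread-• : ∀ k j r f n → spread k j (r • f) n ≈ r * spread k j f n
  spread-• k zero    r f zero    = refl
  spread-• k zero    r f (suc n) = spread-• k k r (tl f) n
  spread-• k (suc j) r f zero    = sym (zeroʳ _)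
  spread-• k (suc j) r f (suc n) = spread-• k j r f n

  spread-𝟘 : ∀ k j n → spread k j 𝟘 n ≈ 0#
  spread-𝟘 k zero    zero    = refl
  spread-𝟘 k zero    (suc n) = spread-𝟘 k k n
  spread-𝟘 k (suc j) zero    = refl
  spread-𝟘 k (suc j) (suc n) = spread-𝟘 k j n

  spread-⊗ : ∀ k j f g n → (spread k j f ⊗ spread k 0 g) n ≈ spread k j (f ⊗ g) n
  spread-⊗ k zero f g zero = refl
  spread-⊗ k zero f g (suc n) = begin
    f 0 * spread k k (tl g) n + (spread k k (tl f) ⊗ spread k 0 g) n
      ≈⟨ +-cong (sym (spread-• k k (f 0) (tl g) n)) (spread-⊗ k k (tl f) g n) ⟩
    spread k k (f 0 • tl g) n + spread k k (tl f ⊗ g) n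
      ≈⟨ spread-⊕ k k (f 0 • tl g) (tl f ⊗ g) n ⟨
    spread k k (tl (f ⊗ g)) n ∎
  spread-⊗ k (suc j) f g zero = zeroˡ _
  spread-⊗ k (suc j) f g (suc n) = begin
    0# * spread k 0 g (suc n) + (spread k j f ⊗ spread k 0 g) n ≈⟨ +-congʳ (zeroˡ _) ⟩
    0# + (spread k j f ⊗ spread k 0 g) n                        ≈⟨ +-identityˡ _ ⟩
    (spread k j f ⊗ spread k 0 g) n                             ≈⟨ spread-⊗ k j f g n ⟩
    spread k j (f ⊗ g) n                                        ∎

  V-cong : ∀ m {f g} → f ≋ g → V m f ≋ V m g
  V-cong m e = pointwise (spread-cong _ 0 e)

  V-⊕ : ∀ m f g → V m (f ⊕ g) ≋ V m f ⊕ V m g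
  V-⊕ m f g = pointwise (spread-⊕ _ 0 f g)

  V-⊗ : ∀ m f g → V m (f ⊗ g) ≋ V m f ⊗ V m g
  V-⊗ m f g = pointwise λ n → sym (spread-⊗ _ 0 f g n)

  V-⊝ : ∀ m f → V m (⊝ f) ≋ ⊝ V m f
  V-⊝ m f = inverseʳ-unique (V m f) (V m (⊝ f))
    (S.trans (S.sym (V-⊕ m f (⊝ f))) (S.trans (V-cong m (S.-‿inverseʳ f)) (pointwise (spread-𝟘 _ 0))))
    where open import Algebra.Properties.Group S.+-group using (inverseʳ-unique)

  V-𝟙 : ∀ m → V m 𝟙 ≋ 𝟙
  V-𝟙 m = pointwise λ where
    zero    → refl
    (suc n) → spread-𝟘 (ℕ.pred m) (ℕ.pred m) n

  V-fromℕ : ∀ m n → V m (Sℤ.fromℕ n) ≋ Sℤ.fromℕ n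
  V-fromℕ m n = S.trans (V-cong m (fromℕ-const n)) (S.trans (pointwise λ where
    zero    → refl
    (suc k) → spread-𝟘 (ℕ.pred m) (ℕ.pred m) k) (S.sym (fromℕ-const n)))

  V-^ : ∀ m f n → V m (f ⊗^ n) ≋ V m f ⊗^ n
  V-^ m f zero    = V-𝟙 m
  V-^ m f (suc n) = S.trans (V-⊗ m f (f ⊗^ n)) (S.*-congˡ (V-^ m f n))

  U : ℕ → ℕ → Pow → Pow
  U m r f n = f (n ℕ.* m ℕ.+ r)

  private
    spread-low : ∀ k j f h {i} → i ℕ.< j → (spread k j f ⊗ h) i ≈ 0#
    spread-low k (suc j) f h {zero}  _ = zeroˡ _
    spread-low k (suc j) f h {suc i} i<j =
      trans (+-cong (zeroˡ _) (spread-low k j f h (ℕ.s<s⁻¹ i<j))) (+-identityˡ _)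

    spread-drop : ∀ k j f h i → (spread k j f ⊗ h) (j ℕ.+ i) ≈ (spread k 0 f ⊗ h) i
    spread-drop k zero    f h i = refl
    spread-drop k (suc j) f h i = begin
      0# * h (suc (j ℕ.+ i)) + (spread k j f ⊗ h) (j ℕ.+ i) ≈⟨ +-cong (zeroˡ _) (spread-drop k j f h i) ⟩
      0# + (spread k 0 f ⊗ h) i                             ≈⟨ +-identityˡ _ ⟩
      (spread k 0 f ⊗ h) i                                  ∎

    -- A series in X^(k+1) moves exponents only within their class modulo k + 1. At n = 0 the bound
    -- on r makes all coefficients of f beyond the first irrelevant; for larger n the gap of k zeros
    -- is skipped by `spread-drop`.
    spread-section : ∀ k {r} f h → r ℕ.≤ k → ∀ n →
      (spread k 0 f ⊗ h) (n ℕ.* suc k ℕ.+ r) ≈ (f ⊗ U (suc k) r h) n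
    spread-section k {zero}  f h r≤k zero = refl
    spread-section k {suc r} f h r≤k zero =
      trans (+-congˡ (spread-low k k (tl f) h r≤k)) (+-identityʳ _)
    spread-section k {r} f h r≤k (suc n) = +-congˡ (begin
      (spread k k (tl f) ⊗ h) (k ℕ.+ n ℕ.* suc k ℕ.+ r)
        ≡⟨ ≡.cong (spread k k (tl f) ⊗ h) (ℕₚ.+-assoc k (n ℕ.* suc k) r) ⟩
      (spread k k (tl f) ⊗ h) (k ℕ.+ (n ℕ.* suc k ℕ.+ r))
        ≈⟨ spread-drop k k (tl f) h (n ℕ.* suc k ℕ.+ r) ⟩
      (spread k 0 (tl f) ⊗ h) (n ℕ.* suc k ℕ.+ r)
        ≈⟨ spread-section k (tl f) h r≤k n ⟩
      (tl f ⊗ U (suc k) r h) n ∎)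

  U-cong : ∀ m r {f g} → f ≋ g → U m r f ≋ U m r g
  U-cong m r e = pointwise λ n → at e (n ℕ.* m ℕ.+ r)

  U-V⊗ : ∀ m r f h → r ℕ.< m → U m r (V m f ⊗ h) ≋ f ⊗ U m r h
  U-V⊗ (suc k) r f h r<m = pointwise (spread-section k f h (ℕ.s≤s⁻¹ r<m))

  Θ : Pow → Pow
  Θ f n = fromℕ n * f n

  private
    open import Algebra.Properties.Semiring.Mult.TCOptimised semiring using (1+×; ×1-homo-*)

    Θ-suc : ∀ f n → Θ f (suc n) ≈ (tl f ⊕ Θ (tl f)) n
    Θ-suc f n = trans (*-congʳ (1+× n 1#)) (trans (distribʳ _ _ _) (+-congʳ (*-identityˡ _)))

  Θ-cong : ∀ {f g} → f ≋ g → Θ f ≋ Θ g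
  Θ-cong e = pointwise λ n → *-congˡ (at e n)

  Θ-⊕ : ∀ f g → Θ (f ⊕ g) ≋ Θ f ⊕ Θ g
  Θ-⊕ f g = pointwise λ n → distribˡ _ _ _

  Θ-⊗ : ∀ f g → Θ (f ⊗ g) ≋ Θ f ⊗ g ⊕ f ⊗ Θ g
  Θ-⊗ f g = pointwise (go f)
    where
    go : ∀ f n → Θ (f ⊗ g) n ≈ (Θ f ⊗ g) n + (f ⊗ Θ g) n
    go f zero = solve 2 (λ u v → con (+ 0) :* (u :* v) := (con (+ 0) :* u) :* v :+ u :* (con (+ 0) :* v)) refl _ _
    go f (suc n) = begin
      fromℕ (suc n) * (f 0 * g (suc n) + (tl f ⊗ g) n)
        ≈⟨ distribˡ _ _ _ ⟩
      fromℕ (suc n) * (f 0 * g (suc n)) + fromℕ (suc n) * (tl f ⊗ g) n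
        ≈⟨ +-congˡ (trans (*-congʳ (1+× n 1#)) (distribʳ _ _ _)) ⟩
      fromℕ (suc n) * (f 0 * g (suc n)) + (1# * (tl f ⊗ g) n + fromℕ n * (tl f ⊗ g) n)
        ≈⟨ +-congˡ (+-congˡ (go (tl f) n)) ⟩
      fromℕ (suc n) * (f 0 * g (suc n)) + (1# * (tl f ⊗ g) n + ((Θ (tl f) ⊗ g) n + (tl f ⊗ Θ g) n))
        ≈⟨ solve 6 (λ m u v w x y → m :* (u :* v) :+ (con (+ 1) :* w :+ (x :+ y))
                    := (con (+ 0) :* u :* v :+ (w :+ x)) :+ (u :* (m :* v) :+ y)) refl _ _ _ _ _ _ ⟩
      (0# * f 0 * g (suc n) + ((tl f ⊗ g) n + (Θ (tl f) ⊗ g) n)) + (f 0 * Θ g (suc n) + (tl f ⊗ Θ g) n)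
        ≈⟨ +-congʳ (+-congˡ (trans (⊗-cong (pointwise (Θ-suc f)) S.refl n)
                                   (⊗-distribʳ g (tl f) (Θ (tl f)) n))) ⟨
      (0# * f 0 * g (suc n) + (tl (Θ f) ⊗ g) n) + (f 0 * Θ g (suc n) + (tl f ⊗ Θ g) n) ∎

  Θ-const : ∀ r → Θ (const r) ≋ 𝟘
  Θ-const r = pointwise λ where
    zero    → zeroˡ _
    (suc n) → zeroʳ _

  Θ-fromℕ : ∀ n → Θ (Sℤ.fromℕ n) ≋ 𝟘
  Θ-fromℕ n = S.trans (Θ-cong (fromℕ-const n)) (Θ-const _)

  Θ-V : ∀ m .{{_ : ℕ.NonZero m}} f → Θ (V m f) ≋ Sℤ.fromℕ m ⊗ V m (Θ f)
  Θ-V (suc k) f = pointwise λ n → trans (go n 0 0 f n (ℕₚ.+-identityʳ n)) (sym (fromℕ-⊗ (suc k) _ n))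
    where
    weighted : ℕ → Pow → Pow
    weighted i g l = fromℕ (i ℕ.+ l) * g l

    -- N is the exponent in V (suc k) f that belongs to position n after i coefficients were consumed.
    go : ∀ N i j g n → N ℕ.+ j ≡ i ℕ.* suc k ℕ.+ n →
         fromℕ N * spread k j g n ≈ fromℕ (suc k) * spread k j (weighted i g) n
    go N i zero g zero e = begin
      fromℕ N * g 0                                ≡⟨ ≡.cong (λ l → fromℕ l * g 0) N≡ ⟩
      fromℕ (suc k ℕ.* (i ℕ.+ 0)) * g 0            ≈⟨ *-congʳ (×1-homo-* (suc k) (i ℕ.+ 0)) ⟩
      fromℕ (suc k) * fromℕ (i ℕ.+ 0) * g 0        ≈⟨ *-assoc _ _ _ ⟩
      fromℕ (suc k) * (fromℕ (i ℕ.+ 0) * g 0)      ∎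
      where
      N≡ : N ≡ suc k ℕ.* (i ℕ.+ 0)
      N≡ = ≡.trans (≡.sym (ℕₚ.+-identityʳ N)) (≡.trans e (≡.trans (ℕₚ.+-identityʳ _)
             (≡.trans (ℕₚ.*-comm i (suc k)) (≡.cong (suc k ℕ.*_) (≡.sym (ℕₚ.+-identityʳ i))))))
    go N i zero g (suc n) e = trans (go N (suc i) k (tl g) n e′)
      (*-congˡ (spread-cong k k (pointwise λ l → *-congʳ (reflexive (≡.cong fromℕ (≡.sym (ℕₚ.+-suc i l))))) n))
      where
      e′ : N ℕ.+ k ≡ suc i ℕ.* suc k ℕ.+ n
      e′ = ≡.trans (≡.cong (ℕ._+ k) (≡.trans (≡.sym (ℕₚ.+-identityʳ N)) e))
             (ℕS.solve 3 (λ a k n → (a ℕS.:+ (ℕS.con 1 ℕS.:+ n)) ℕS.:+ k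
                            ℕS.:= ((ℕS.con 1 ℕS.:+ k) ℕS.:+ a) ℕS.:+ n) ≡.refl (i ℕ.* suc k) k n)
    go N i (suc j) g zero    e = trans (zeroʳ _) (sym (zeroʳ _))
    go N i (suc j) g (suc n) e = go N i j g n
      (ℕₚ.suc-injective (≡.trans (≡.sym (ℕₚ.+-suc N j)) (≡.trans e (ℕₚ.+-suc _ n))))

-- Binomial coefficients and the Frobenius map modulo a prime

prime∤! : ∀ {p} → Prime p → ∀ {k} → k < p → ¬ p ∣ k !
prime∤! {p} pp {zero}  k<p p∣1 = ℕ.nonTrivial⇒≢1 {{prime⇒nonTrivial pp}} (∣1⇒≡1 p∣1)
prime∤! {p} pp {suc k} k<p p∣  = [ (λ d → ℕₚ.<⇒≱ k<p (∣⇒≤ d)) , prime∤! pp (ℕₚ.<⇒≤ k<p) ]′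
                                   (euclidsLemma (suc k) (k !) pp p∣)

-- The product with k! (p - k)! is p!, and neither of these factorials is divisible by p.
prime∣C : ∀ {p} → Prime p → ∀ {k} → 0 < k → k < p → p ∣ (p C k)
prime∣C {p} pp {k} 0<k k<p with euclidsLemma (p C k) (k ! ℕ.* (p ∸ k) !) pp p∣product
  where
  instance
    _ = ℕₚ.m*n≢0 (k !) ((p ∸ k) !) {{ℕₚ._!≢0 k}} {{ℕₚ._!≢0 (p ∸ k)}}

  p!≡ : (p C k) ℕ.* (k ! ℕ.* (p ∸ k) !) ≡ p !
  p!≡ = ≡.trans (≡.cong (ℕ._* (k ! ℕ.* (p ∸ k) !)) (nCk≡n!/k![n-k]! (ℕₚ.<⇒≤ k<p)))
          (m/n*n≡m (≡.subst (_∣ p !) (ℕₚ.*-comm ((p ∸ k) !) (k !)) ([n∸k]!k!∣n! (ℕₚ.<⇒≤ k<p))))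

  p∣p! : ∀ q → .{{ℕ.NonZero q}} → q ∣ q !
  p∣p! (suc q) = m∣m*n (q !)

  p∣product : p ∣ (p C k) ℕ.* (k ! ℕ.* (p ∸ k) !)
  p∣product = ≡.subst (p ∣_) (≡.sym p!≡) (p∣p! p {{prime⇒nonZero pp}})
... | inj₁ d = d
... | inj₂ d with euclidsLemma (k !) ((p ∸ k) !) pp d
...   | inj₁ d′ = ⊥-elim (prime∤! pp k<p d′)
...   | inj₂ d′ = ⊥-elim (prime∤! pp (ℕₚ.∸-monoʳ-< 0<k (ℕₚ.<⇒≤ k<p)) d′)

module Characteristic {c ℓ} (R : CommutativeRing c ℓ) where
  open CommutativeRing R
  open IntegerCoefficients R
  open import Relation.Binary.Reasoning.Setoid setoid
  open import Algebra.Properties.Semiring.Mult semiring using (_×_; ×-congʳ; ×-assoc-*)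
  open import Algebra.Properties.Semiring.Mult.TCOptimised semiring using (×ᵤ≈×; 1+×; ×1-homo-*)
  open import Algebra.Properties.Semiring.Exp semiring using (_^_; ^-congˡ)
  open import Algebra.Properties.CommutativeSemiring.Binomial commutativeSemiring using (theorem; binomialTerm; binomial)
  open import Algebra.Properties.Semiring.Sum semiring using (sum; sum-cong-≋; sum-init-last; sum-replicate-zero)

  1^ : ∀ q → 1# ^ q ≈ 1#
  1^ zero    = refl
  1^ (suc q) = trans (*-identityˡ _) (1^ q)

  module _ {p} (char : fromℕ p ≈ 0#) where

    fromℕ-∣ : ∀ {n} → p ∣ n → fromℕ n ≈ 0#
    fromℕ-∣ (divides q ≡.refl) = trans (×1-homo-* q p) (trans (*-congˡ char) (zeroʳ _))

    ×-∣ : ∀ {n} → p ∣ n → ∀ x → n × x ≈ 0#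
    ×-∣ {n} p∣n x = begin
      n × x          ≈⟨ ×-congʳ n (*-identityˡ x) ⟨
      n × (1# * x)   ≈⟨ ×-assoc-* n 1# x ⟨
      (n × 1#) * x   ≈⟨ *-congʳ (trans (×ᵤ≈× n 1#) (fromℕ-∣ p∣n)) ⟩
      0# * x         ≈⟨ zeroˡ x ⟩
      0#             ∎

    frobenius-+ : Prime p → ∀ x y → (x + y) ^ p ≈ x ^ p + y ^ p
    frobenius-+ pp x y = trans (theorem p x y) (go p ≡.refl)
      where
      go : ∀ q → q ≡ p → sum (binomialTerm x y q) ≈ x ^ q + y ^ q
      go zero ≡.refl = ⊥-elim (ℕ.≢-nonZero⁻¹ 0 {{prime⇒nonZero pp}} ≡.refl)
      go (suc q) ≡.refl = begin
        t Fin.zero + sum (λ i → t (Fin.suc i))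
          ≈⟨ +-congˡ (sum-init-last (λ i → t (Fin.suc i))) ⟩
        t Fin.zero + (sum (λ i → t (Fin.suc (inject₁ i))) + t (Fin.suc (Fin.fromℕ q)))
          ≈⟨ +-cong first (+-cong (trans (sum-cong-≋ middle) (sum-replicate-zero q)) last) ⟩
        y ^ suc q + (0# + x ^ suc q)
          ≈⟨ +-congˡ (+-identityˡ _) ⟩
        y ^ suc q + x ^ suc q
          ≈⟨ +-comm _ _ ⟩
        x ^ suc q + y ^ suc q ∎
        where
        t = binomialTerm x y (suc q)

        first : t Fin.zero ≈ y ^ suc q
        first = trans (+-identityʳ _) (*-identityˡ _)

        middle : ∀ i → t (Fin.suc (inject₁ i)) ≈ 0#
        middle i = ×-∣ (prime∣C pp (ℕ.s≤s ℕ.z≤n)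
          (ℕ.s≤s (≡.subst (_< q) (≡.sym (Finₚ.toℕ-inject₁ i)) (Finₚ.toℕ<n i)))) (binomial x y (suc q) (Fin.suc (inject₁ i)))

        last : t (Fin.suc (Fin.fromℕ q)) ≈ x ^ suc q
        last rewrite Finₚ.toℕ-fromℕ q | nCn≡1 (suc q) | ℕₚ.n∸n≡0 q =
          trans (+-identityʳ _) (*-identityʳ _)

    fermat : Prime p → ∀ n → fromℕ n ^ p ≈ fromℕ n
    fermat pp zero = zero^ p {{prime⇒nonZero pp}}
      where
      zero^ : ∀ q → .{{ℕ.NonZero q}} → 0# ^ q ≈ 0#
      zero^ (suc q) = zeroˡ _
    fermat pp (suc n) = begin
      fromℕ (suc n) ^ p      ≈⟨ ^-congˡ p (1+× n 1#) ⟩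
      (1# + fromℕ n) ^ p     ≈⟨ frobenius-+ pp 1# (fromℕ n) ⟩
      1# ^ p + fromℕ n ^ p   ≈⟨ +-cong (1^ p) (fermat pp n) ⟩
      1# + fromℕ n           ≈⟨ 1+× n 1# ⟨
      fromℕ (suc n)          ∎

module SeriesFrobenius {c ℓ} (R : CommutativeRing c ℓ) {p : ℕ} (pp : Prime p)
  (char : CommutativeRing._≈_ R (IntegerCoefficients.fromℕ R p) (CommutativeRing.0# R)) where
  open CommutativeRing R
  open IntegerCoefficients R
  open PowerSeries R
  open import Algebra.Properties.Semiring.Exp semiring using (_^_)
  open import Algebra.Properties.CommutativeSemiring.Exp S.commutativeSemiring using (^-distrib-*)
  open import Relation.Binary.Reasoning.Setoid setoid

  series-char : Sℤ.fromℕ p ≋ 𝟘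
  series-char = S.trans (fromℕ-const p) (pointwise λ where
    zero    → char
    (suc _) → refl)

  open Characteristic series using () renaming (frobenius-+ to ⊕-frobenius)

  private
    const-^ : ∀ r q → const r ⊗^ q ≋ const (r ^ q)
    const-^ r zero    = S.refl
    const-^ r (suc q) = S.trans (S.*-congˡ (const-^ r q)) (pointwise λ where
      zero    → refl
      (suc n) → trans (const-⊗ r _ (suc n)) (zeroʳ _))

  -- Additivity of the p-th power gives f^p = f₀^p + X^p (tl f)^p. The hypothesis on the
  -- coefficients stands in for the prime field, since R is an arbitrary ring of characteristic p.
  frobenius : ∀ f → (∀ n → f n ^ p ≈ f n) → f ⊗^ p ≋ V p f
  frobenius f fixed = pointwise λ n → go p ≡.refl n f fixed
    where
    module _ {k} (p≡ : p ≡ suc k) where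
      expand : ∀ f → (∀ n → f n ^ p ≈ f n) → f ⊗^ p ≋ const (f 0) ⊕ X ⊗ (X ⊗^ k ⊗ tl f ⊗^ p)
      expand f fixed = S.trans (S.trans (^-cong (head-tail f)) (⊕-frobenius series-char pp (const (f 0)) (X ⊗ tl f)))
        (S.+-cong (S.trans (const-^ (f 0) p) (pointwise λ { zero → fixed 0 ; (suc _) → refl }))
          (S.trans (^-distrib-* X (tl f) p) (S.trans (S.*-congʳ (S.reflexive (≡.cong (X ⊗^_) p≡))) (S.*-assoc _ _ _))))
        where
        ^-cong : ∀ {f g} → f ≋ g → f ⊗^ p ≋ g ⊗^ p
        ^-cong = Algebra.Properties.Semiring.Exp.^-congˡ S.semiring p

      -- The power X^j mirrors the counter of `spread`: consuming a coefficient of f leaves X · X^k,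
      -- and each X lowers the exponent n on which the recursion runs.
      coefficient : ∀ n j f → (∀ n → f n ^ p ≈ f n) → (X ⊗^ j ⊗ f ⊗^ p) n ≈ spread k j f n
      coefficient zero zero f fixed = begin
        (𝟙 ⊗ f ⊗^ p) 0 ≈⟨ at (S.trans (S.*-identityˡ _) (expand f fixed)) 0 ⟩
        f 0 + (X ⊗ (X ⊗^ k ⊗ tl f ⊗^ p)) 0 ≈⟨ +-congˡ (X⊗-zero (X ⊗^ k ⊗ tl f ⊗^ p)) ⟩
        f 0 + 0#       ≈⟨ +-identityʳ _ ⟩
        f 0 ∎
      coefficient (suc n) zero f fixed = begin
        (𝟙 ⊗ f ⊗^ p) (suc n) ≈⟨ at (S.trans (S.*-identityˡ _) (expand f fixed)) (suc n) ⟩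
        0# + (X ⊗ (X ⊗^ k ⊗ tl f ⊗^ p)) (suc n) ≈⟨ +-identityˡ _ ⟩
        (X ⊗ (X ⊗^ k ⊗ tl f ⊗^ p)) (suc n) ≈⟨ X⊗-suc _ n ⟩
        (X ⊗^ k ⊗ tl f ⊗^ p) n ≈⟨ coefficient n k (tl f) (λ m → fixed (suc m)) ⟩
        spread k k (tl f) n ∎
      coefficient zero (suc j) f fixed = trans (at (S.*-assoc X (X ⊗^ j) (f ⊗^ p)) 0) (X⊗-zero (X ⊗^ j ⊗ f ⊗^ p))
      coefficient (suc n) (suc j) f fixed =
        trans (at (S.*-assoc X (X ⊗^ j) (f ⊗^ p)) (suc n)) (trans (X⊗-suc _ n) (coefficient n j f fixed))

    go : ∀ q → p ≡ q → ∀ n f → (∀ n → f n ^ p ≈ f n) → (f ⊗^ p) n ≈ V q f n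
    go zero    e n f fixed = ⊥-elim (ℕ.≢-nonZero⁻¹ p {{prime⇒nonZero pp}} e)
    go (suc k) e n f fixed = trans (at (S.sym (S.*-identityˡ _)) n) (coefficient e n 0 f fixed)

-- Sums over ℤ and theta series

half-≤ : ∀ {m} i j k → + 2 ℤ.* k ≡ i ℤ.+ j → ∣ i ∣ ≤ m → ∣ j ∣ ≤ m → ∣ k ∣ ≤ m
half-≤ {m} i j k e i≤ j≤ = ℕₚ.*-cancelˡ-≤ 2 (begin
  2 ℕ.* ∣ k ∣       ≡⟨ ℤₚ.abs-* (+ 2) k ⟨
  ∣ + 2 ℤ.* k ∣     ≡⟨ ≡.cong ∣_∣ e ⟩
  ∣ i ℤ.+ j ∣       ≤⟨ ℤₚ.∣i+j∣≤∣i∣+∣j∣ i j ⟩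
  ∣ i ∣ ℕ.+ ∣ j ∣   ≤⟨ ℕₚ.+-mono-≤ i≤ j≤ ⟩
  m ℕ.+ m           ≡⟨ ≡.cong (m ℕ.+_) (ℕₚ.+-identityʳ m) ⟨
  2 ℕ.* m           ∎)
  where open ℕₚ.≤-Reasoning

-- Changes of index are controlled through this: when 2k is the sum of two indices, a large k forces
-- one of them to be large.
half-< : ∀ {m} i j k → + 2 ℤ.* k ≡ i ℤ.+ j → m < ∣ k ∣ → m < ∣ i ∣ ⊎ m < ∣ j ∣
half-< {m} i j k e m<k with ∣ i ∣ ℕ.≤? m | ∣ j ∣ ℕ.≤? m
... | no i≰  | _      = inj₁ (ℕₚ.≰⇒> i≰)
... | yes _  | no j≰  = inj₂ (ℕₚ.≰⇒> j≰)
... | yes i≤ | yes j≤ = contradiction (half-≤ i j k e i≤ j≤) (ℕₚ.<⇒≱ m<k)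

2* 2*+1 : ℤ → ℤ
2* j   = + 2 ℤ.* j
2*+1 j = + 2 ℤ.* j ℤ.+ + 1

∣2*∣ : ∀ j → ∣ j ∣ ≤ ∣ 2* j ∣
∣2*∣ j = half-≤ (2* j) (+ 0) j (≡.sym (ℤₚ.+-identityʳ _)) ℕₚ.≤-refl ℕ.z≤n

∣2*+1∣ : ∀ j → ∣ j ∣ ≤ ∣ 2*+1 j ∣
-- 2j is the sum of 2j + 1 and -1, and an odd number has absolute value at least 1.
∣2*+1∣ j = half-≤ (2*+1 j) -[1+ 0 ] j (ℤS.solve 1 (λ j → ℤS.con (+ 2) ℤS.:* j ℤS.:=
  (ℤS.con (+ 2) ℤS.:* j ℤS.:+ ℤS.con (+ 1)) ℤS.:+ ℤS.con -[1+ 0 ]) ≡.refl j) ℕₚ.≤-refl (odd≥1 j)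
  where
  odd≥1 : ∀ j → 1 ≤ ∣ 2*+1 j ∣
  odd≥1 (+ n)    = ≡.subst (1 ≤_) (≡.sym (≡.trans (≡.cong (λ i → ∣ i ℤ.+ + 1 ∣) (≡.sym (ℤₚ.pos-* 2 n))) (ℕₚ.+-comm _ 1))) (ℕ.s≤s ℕ.z≤n)
  odd≥1 -[1+ n ] rewrite ℕₚ.+-suc n (n ℕ.+ 0) = ℕ.s≤s ℕ.z≤n

module IntegerSums {c ℓ} (R : CommutativeRing c ℓ) where
  open CommutativeRing R
  open PowerSeries R
  open IntegerCoefficients R using (solve; _:+_; _:=_)
  open import Relation.Binary.Reasoning.Setoid setoid

  sum : ℕ → (ℕ → Pow) → Pow
  sum zero    h = 𝟘
  sum (suc K) h = h 0 ⊕ sum K (λ i → h (suc i))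

  sum-cong : ∀ K h h′ n → (∀ i → h i n ≈ h′ i n) → sum K h n ≈ sum K h′ n
  sum-cong zero    h h′ n e = refl
  sum-cong (suc K) h h′ n e = +-cong (e 0) (sum-cong K _ _ n (λ i → e (suc i)))

  sum-zero : ∀ K h n → (∀ i → i < K → h i n ≈ 0#) → sum K h n ≈ 0#
  sum-zero zero    h n e = refl
  sum-zero (suc K) h n e =
    trans (+-cong (e 0 (ℕ.s≤s ℕ.z≤n)) (sum-zero K _ n (λ i i<K → e (suc i) (ℕ.s≤s i<K)))) (+-identityˡ _)

  sum-⊕ : ∀ K g h n → sum K (λ i → g i ⊕ h i) n ≈ sum K g n + sum K h n
  sum-⊕ zero    g h n = sym (+-identityˡ _)
  sum-⊕ (suc K) g h n = trans (+-congˡ (sum-⊕ K (λ i → g (suc i)) (λ i → h (suc i)) n))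
    (solve 4 (λ a b u v → (a :+ b) :+ (u :+ v) := (a :+ u) :+ (b :+ v)) refl _ _ _ _)

  sum-swap : ∀ K L (h : ℕ → ℕ → Pow) n →
             sum K (λ i → sum L (h i)) n ≈ sum L (λ j → sum K (λ i → h i j)) n
  sum-swap zero    L h n = sym (sum-zero L _ n (λ _ _ → refl))
  sum-swap (suc K) L h n = trans (+-congˡ (sum-swap K L (λ i → h (suc i)) n))
    (sym (sum-⊕ L (h 0) (λ j → sum K (λ i → h (suc i) j)) n))

  sum-split : ∀ K L h n → sum (K ℕ.+ L) h n ≈ sum K h n + sum L (λ i → h (K ℕ.+ i)) n
  sum-split zero    L h n = sym (+-identityˡ _)
  sum-split (suc K) L h n = trans (+-congˡ (sum-split K L (λ i → h (suc i)) n)) (sym (+-assoc _ _ _))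

  sum-parity : ∀ K h n → sum (K ℕ.+ K) h n ≈ sum K (λ i → h (i ℕ.+ i)) n + sum K (λ i → h (suc (i ℕ.+ i))) n
  sum-parity zero    h n = sym (+-identityˡ _)
  sum-parity (suc K) h n rewrite ℕₚ.+-suc K K = begin
    h 0 n + (h 1 n + sum (K ℕ.+ K) (λ i → h (suc (suc i))) n)
      ≈⟨ +-congˡ (+-congˡ (sum-parity K (λ i → h (suc (suc i))) n)) ⟩
    h 0 n + (h 1 n + (sum K (λ i → h (suc (suc (i ℕ.+ i)))) n + sum K (λ i → h (suc (suc (suc (i ℕ.+ i))))) n))
      ≈⟨ solve 4 (λ a b u v → a :+ (b :+ (u :+ v)) := (a :+ u) :+ (b :+ v)) refl _ _ _ _ ⟩
    (h 0 n + sum K (λ i → h (suc (suc (i ℕ.+ i)))) n) + (h 1 n + sum K (λ i → h (suc (suc (suc (i ℕ.+ i))))) n)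
      ≈⟨ +-cong (+-congˡ (sum-cong K _ (λ i → h (suc (i ℕ.+ suc i))) n (λ i → reflexive (≡.cong (λ k → h (suc k) n) (≡.sym (ℕₚ.+-suc i i))))))
                (+-congˡ (sum-cong K _ (λ i → h (suc (suc (i ℕ.+ suc i)))) n (λ i → reflexive (≡.cong (λ k → h (suc (suc k)) n) (≡.sym (ℕₚ.+-suc i i)))))) ⟩
    _ ∎

  sum-⊗ : ∀ K h f n → (sum K h ⊗ f) n ≈ sum K (λ i → h i ⊗ f) n
  sum-⊗ zero    h f n = ⊗-zeroˡ f n
  sum-⊗ (suc K) h f n = trans (⊗-distribʳ f (h 0) (sum K (λ i → h (suc i))) n)
    (+-congˡ (sum-⊗ K (λ i → h (suc i)) f n))

  sum-V : ∀ K h m n → V m (sum K h) n ≈ sum K (λ i → V m (h i)) n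
  sum-V zero    h m n = spread-𝟘 (ℕ.pred m) 0 n
  sum-V (suc K) h m n = trans (at (V-⊕ m (h 0) (sum K (λ i → h (suc i)))) n)
    (+-congˡ (sum-V K (λ i → h (suc i)) m n))

  Truncated : ℕ → Pow → Pow → Set ℓ
  Truncated n f g = ∀ i → i ≤ n → f i ≈ g i

  truncated-⊗ : ∀ {n f f′} g → Truncated n f f′ → Truncated n (f ⊗ g) (f′ ⊗ g)
  truncated-⊗ g e zero    i≤n = *-congʳ (e 0 i≤n)
  truncated-⊗ {suc n} g e (suc i) i≤n =
    +-cong (*-congʳ (e 0 ℕ.z≤n)) (truncated-⊗ {n} g (λ j j≤n → e (suc j) (ℕ.s≤s j≤n)) i (ℕ.s≤s⁻¹ i≤n))

  truncated-V : ∀ {n f f′} m → Truncated n f f′ → Truncated n (V m f) (V m f′)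
  truncated-V {n} m e i i≤n = go 0 i (λ j j≤i → e j (ℕₚ.≤-trans j≤i i≤n))
    where
    go : ∀ {f g} j i → Truncated i f g → spread (ℕ.pred m) j f i ≈ spread (ℕ.pred m) j g i
    go zero    zero    e = e 0 ℕ.z≤n
    go zero    (suc i) e = go (ℕ.pred m) i (λ j j≤i → e (suc j) (ℕ.s≤s j≤i))
    go (suc j) zero    e = refl
    go (suc j) (suc i) e = go j i (λ l l≤i → e l (ℕₚ.m≤n⇒m≤1+n l≤i))

  Family : Set c
  Family = ℤ → Pow

  -- One unit of slack in the bound keeps families bounded under j ↦ j + 1.
  Bounded : Family → Set ℓ
  Bounded g = ∀ n j → suc n < ∣ j ∣ → g j n ≈ 0#

  window : ℕ → Family → Pow
  window M g = sum (M ℕ.+ suc M) (λ i → g (+ i ℤ.- + M))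

  -- The coefficient at n sums over |j| ≤ n + 1, the range outside which a bounded family vanishes
  -- there; so infinite sums are handled without a notion of convergence.
  Σℤ : Family → Pow
  Σℤ g n = window (suc n) g n

  private
    -- Enlarging the window by a on the left and by b on the right adds only zeros. Truncation, the
    -- split by parity and translations all reduce to this.
    cover : ∀ {g} → Bounded g → ∀ n a b {K} (h : ℕ → Pow) → K ≡ a ℕ.+ ((suc n ℕ.+ suc (suc n)) ℕ.+ b) →
            (∀ i → h i n ≈ g (+ i ℤ.- + (a ℕ.+ suc n)) n) → sum K h n ≈ Σℤ g n
    cover {g} bd n a b h ≡.refl e = begin
      sum (a ℕ.+ (W ℕ.+ b)) h n
        ≈⟨ sum-split a (W ℕ.+ b) h n ⟩
      sum a h n + sum (W ℕ.+ b) h₁ n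
        ≈⟨ +-cong (sum-zero a h n front) (sum-split W b h₁ n) ⟩
      0# + (sum W h₁ n + sum b (λ i → h₁ (W ℕ.+ i)) n)
        ≈⟨ trans (+-identityˡ _) (+-congˡ (sum-zero b (λ i → h₁ (W ℕ.+ i)) n back)) ⟩
      sum W h₁ n + 0#
        ≈⟨ trans (+-identityʳ _) (sum-cong W h₁ (λ i → g (+ i ℤ.- + M)) n mid) ⟩
      Σℤ g n ∎
      where
      M = suc n
      W = M ℕ.+ suc M
      h₁ = λ i → h (a ℕ.+ i)

      front : ∀ i → i < a → h i n ≈ 0#
      front i i<a = trans (e i) (bd n _ (≡.subst (M <_)
        (≡.sym (≡.trans (≡.cong ∣_∣ (ℤₚ.m-n≡m⊖n i (a ℕ.+ M))) (ℤₚ.∣⊖∣-≤ (ℕₚ.≤-trans (ℕₚ.<⇒≤ i<a) (ℕₚ.m≤m+n a M)))))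
        (ℕₚ.m+n≤o⇒m≤o∸n (suc M) (≡.subst (_≤ a ℕ.+ M) (≡.cong suc (ℕₚ.+-comm i M)) (ℕₚ.+-monoˡ-≤ M i<a)))))

      mid : ∀ i → h₁ i n ≈ g (+ i ℤ.- + M) n
      mid i = trans (e (a ℕ.+ i)) (reflexive (≡.cong (λ j → g j n) (≡.trans
        (≡.cong₂ ℤ._-_ (ℤₚ.pos-+ a i) (ℤₚ.pos-+ a M))
        (ℤS.solve 3 (λ a i m → (a ℤS.:+ i) ℤS.:- (a ℤS.:+ m) ℤS.:= i ℤS.:- m) ≡.refl (+ a) (+ i) (+ M)))))

      back : ∀ i → i < b → h₁ (W ℕ.+ i) n ≈ 0#
      back i _ = trans (mid (W ℕ.+ i)) (bd n _ (≡.subst (λ j → M < ∣ j ∣) (≡.sym pos) (ℕₚ.m≤m+n (suc M) i)))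
        where
        pos : + (W ℕ.+ i) ℤ.- + M ≡ + (suc M ℕ.+ i)
        pos = ≡.trans (≡.cong (λ k → + k ℤ.- + M) (ℕₚ.+-assoc M (suc M) i))
          (≡.trans (≡.cong (ℤ._- + M) (ℤₚ.pos-+ M (suc M ℕ.+ i)))
            (ℤS.solve 2 (λ m k → (m ℤS.:+ k) ℤS.:- m ℤS.:= k) ≡.refl (+ M) (+ (suc M ℕ.+ i))))

  Σℤ-cong : ∀ {g g′} → (∀ j → g j ≋ g′ j) → Σℤ g ≋ Σℤ g′
  Σℤ-cong {g} {g′} e = pointwise λ n → sum-cong (suc n ℕ.+ suc (suc n)) (λ i → g (+ i ℤ.- + suc n)) (λ i → g′ (+ i ℤ.- + suc n)) n (λ i → at (e (+ i ℤ.- + suc n)) n)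

  Σℤ-bounded : ∀ {g : ℤ → Family} → (∀ n i j → suc n < ∣ i ∣ → g i j n ≈ 0#) → Bounded (λ i → Σℤ (g i))
  Σℤ-bounded {g} bd n i n<i = sum-zero (suc n ℕ.+ suc (suc n)) (λ k → g i (+ k ℤ.- + suc n)) n (λ k _ → bd n i (+ k ℤ.- + suc n) n<i)

  -- At exponent n both iterated sums run over the same square window, so this is an exchange of two
  -- finite sums.
  Σℤ-swap : ∀ (g : ℤ → Family) → Σℤ (λ i → Σℤ (g i)) ≋ Σℤ (λ j → Σℤ (λ i → g i j))
  Σℤ-swap g = pointwise λ n →
    let W = suc n ℕ.+ suc (suc n)
        h = λ i j → g (+ i ℤ.- + suc n) (+ j ℤ.- + suc n)
    in begin
    Σℤ (λ i → Σℤ (g i)) n              ≈⟨ sum-cong W (λ i → Σℤ (g (+ i ℤ.- + suc n))) (λ i → sum W (h i)) n (λ i → refl) ⟩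
    sum W (λ i → sum W (h i)) n        ≈⟨ sum-swap W W h n ⟩
    sum W (λ j → sum W (λ i → h i j)) n ≈⟨ sum-cong W (λ j → sum W (λ i → h i j)) (λ j → Σℤ (λ i → g i (+ j ℤ.- + suc n))) n (λ j → refl) ⟩
    Σℤ (λ j → Σℤ (λ i → g i j)) n      ∎

  Σℤ-truncated : ∀ {g} → Bounded g → ∀ n → Truncated n (Σℤ g) (window (suc n) g)
  Σℤ-truncated {g} bd n i i≤n = sym (cover bd i d d (λ k → g (+ k ℤ.- + suc n)) K≡ λ k → reflexive (≡.cong (λ m → g (+ k ℤ.- + m) i) M≡))
    where
    d = n ℕ.∸ i
    M≡ : suc n ≡ d ℕ.+ suc i
    M≡ = ≡.sym (≡.trans (ℕₚ.+-suc d i) (≡.cong suc (ℕₚ.m∸n+n≡m i≤n)))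
    K≡ : suc n ℕ.+ suc (suc n) ≡ d ℕ.+ ((suc i ℕ.+ suc (suc i)) ℕ.+ d)
    K≡ = ≡.trans (≡.cong (λ m → m ℕ.+ suc m) M≡) (ℕS.solve 2 (λ d m → (d ℕS.:+ m) ℕS.:+ (ℕS.con 1 ℕS.:+ (d ℕS.:+ m))
      ℕS.:= d ℕS.:+ ((m ℕS.:+ (ℕS.con 1 ℕS.:+ m)) ℕS.:+ d)) ≡.refl d (suc i))

  Σℤ-⊗ : ∀ {g} → Bounded g → ∀ f → Σℤ g ⊗ f ≋ Σℤ (λ j → g j ⊗ f)
  Σℤ-⊗ {g} bd f = pointwise λ n → trans (truncated-⊗ f (Σℤ-truncated bd n) n ℕₚ.≤-refl)
    (sum-⊗ (suc n ℕ.+ suc (suc n)) (λ i → g (+ i ℤ.- + suc n)) f n)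

  Σℤ-V : ∀ {g} → Bounded g → ∀ m → V m (Σℤ g) ≋ Σℤ (λ j → V m (g j))
  Σℤ-V {g} bd m = pointwise λ n → trans (truncated-V m (Σℤ-truncated bd n) n ℕₚ.≤-refl)
    (sum-V (suc n ℕ.+ suc (suc n)) (λ i → g (+ i ℤ.- + suc n)) m n)

  Σℤ-product : ∀ {g h} → Bounded g → Bounded h → Σℤ g ⊗ Σℤ h ≋ Σℤ (λ i → Σℤ (λ j → g i ⊗ h j))
  Σℤ-product {g} {h} bg bh = S.trans (Σℤ-⊗ bg (Σℤ h)) (Σℤ-cong λ i →
    S.trans (S.*-comm (g i) (Σℤ h)) (S.trans (Σℤ-⊗ bh (g i)) (Σℤ-cong λ j → S.*-comm (h j) (g i))))

  Σℤ-parity : ∀ {g} → Bounded g → Σℤ g ≋ Σℤ (λ j → g (2* j)) ⊕ Σℤ (λ j → g (2*+1 j))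
  Σℤ-parity {g} bd = pointwise λ n → let M = suc n; W = M ℕ.+ suc M in begin
    Σℤ g n
      -- The window from -2M to 2M + 1 is taken because its members are exactly 2j and 2j + 1 for
      -- the same range |j| ≤ M.
      ≈⟨ cover bd n M (suc M) (λ i → g (+ i ℤ.- + (M ℕ.+ M))) (W+W≡ M) (λ _ → refl) ⟨
    sum (W ℕ.+ W) (λ i → g (+ i ℤ.- + (M ℕ.+ M))) n
      ≈⟨ sum-parity W (λ i → g (+ i ℤ.- + (M ℕ.+ M))) n ⟩
    sum W (λ i → g (+ (i ℕ.+ i) ℤ.- + (M ℕ.+ M))) n + sum W (λ i → g (+ suc (i ℕ.+ i) ℤ.- + (M ℕ.+ M))) n
      ≈⟨ +-cong (sum-cong W (λ i → g (+ (i ℕ.+ i) ℤ.- + (M ℕ.+ M))) (λ i → g (2* (+ i ℤ.- + M))) n (λ i → reflexive (≡.cong (λ j → g j n) (even i M))))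
                (sum-cong W (λ i → g (+ suc (i ℕ.+ i) ℤ.- + (M ℕ.+ M))) (λ i → g (2*+1 (+ i ℤ.- + M))) n (λ i → reflexive (≡.cong (λ j → g j n) (odd i M)))) ⟩
    _ ∎
    where
    W+W≡ : ∀ M → (M ℕ.+ suc M) ℕ.+ (M ℕ.+ suc M) ≡ M ℕ.+ ((M ℕ.+ suc M) ℕ.+ suc M)
    W+W≡ = ℕS.solve 1 (λ m → (m ℕS.:+ (ℕS.con 1 ℕS.:+ m)) ℕS.:+ (m ℕS.:+ (ℕS.con 1 ℕS.:+ m))
      ℕS.:= m ℕS.:+ ((m ℕS.:+ (ℕS.con 1 ℕS.:+ m)) ℕS.:+ (ℕS.con 1 ℕS.:+ m))) ≡.refl

    even : ∀ i M → + (i ℕ.+ i) ℤ.- + (M ℕ.+ M) ≡ 2* (+ i ℤ.- + M)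
    even i M = ≡.trans (≡.cong₂ ℤ._-_ (ℤₚ.pos-+ i i) (ℤₚ.pos-+ M M))
      (ℤS.solve 2 (λ i m → (i ℤS.:+ i) ℤS.:- (m ℤS.:+ m) ℤS.:= ℤS.con (+ 2) ℤS.:* (i ℤS.:- m)) ≡.refl (+ i) (+ M))

    odd : ∀ i M → + suc (i ℕ.+ i) ℤ.- + (M ℕ.+ M) ≡ 2*+1 (+ i ℤ.- + M)
    odd i M = ≡.trans (≡.cong₂ ℤ._-_ (≡.trans (ℤₚ.pos-+ 1 (i ℕ.+ i)) (≡.cong (λ k → + 1 ℤ.+ k) (ℤₚ.pos-+ i i))) (ℤₚ.pos-+ M M))
      (ℤS.solve 2 (λ i m → (ℤS.con (+ 1) ℤS.:+ (i ℤS.:+ i)) ℤS.:- (m ℤS.:+ m)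
        ℤS.:= ℤS.con (+ 2) ℤS.:* (i ℤS.:- m) ℤS.:+ ℤS.con (+ 1)) ≡.refl (+ i) (+ M))

  private
    shift-pos : ∀ {g} m → Bounded g → Bounded (λ j → g (j ℤ.+ + m)) → Σℤ (λ j → g (j ℤ.+ + m)) ≋ Σℤ g
    shift-pos {g} m bg bgm = pointwise λ n → let M = suc n; W = M ℕ.+ suc M in begin
      Σℤ (λ j → g (j ℤ.+ + m)) n
        ≈⟨ cover bgm n m 0 h (≡.trans (ℕₚ.+-comm W m) (≡.cong (m ℕ.+_) (≡.sym (ℕₚ.+-identityʳ W))))
             (λ i → reflexive (≡.cong (λ j → g j n) (unshift i M))) ⟨
      sum (W ℕ.+ m) h n
        ≈⟨ cover bg n 0 m h ≡.refl (λ i → refl) ⟩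
      Σℤ g n ∎
      where
      h : ∀ {n} → ℕ → Pow
      h {n} i = g (+ i ℤ.- + suc n)

      unshift : ∀ i M → + i ℤ.- + M ≡ (+ i ℤ.- + (m ℕ.+ M)) ℤ.+ + m
      unshift i M = ≡.sym (≡.trans (≡.cong (λ k → (+ i ℤ.- k) ℤ.+ + m) (ℤₚ.pos-+ m M))
        (ℤS.solve 3 (λ i m k → (i ℤS.:- (m ℤS.:+ k)) ℤS.:+ m ℤS.:= i ℤS.:- k) ≡.refl (+ i) (+ m) (+ M)))

  Σℤ-shift : ∀ {g} k → Bounded g → Bounded (λ j → g (j ℤ.+ k)) → Σℤ (λ j → g (j ℤ.+ k)) ≋ Σℤ g
  Σℤ-shift     (+ m)    bg bgk = shift-pos m bg bgk
  -- A negative translation is undone by applying the positive one to the translated family.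
  Σℤ-shift {g} -[1+ m ] bg bgk = S.trans
    (S.sym (shift-pos {λ j → g (j ℤ.+ -[1+ m ])} (suc m) bgk (λ n j lt → trans (g≡ n j) (bg n j lt))))
    (Σℤ-cong λ j → pointwise λ n → g≡ n j)
    where
    g≡ : ∀ n j → g (j ℤ.+ + suc m ℤ.+ -[1+ m ]) n ≈ g j n
    g≡ n j = reflexive (≡.cong (λ i → g i n) (≡.trans (ℤₚ.+-assoc j (+ suc m) -[1+ m ])
      (≡.trans (≡.cong (λ k → j ℤ.+ k) (ℤₚ.+-inverseʳ (+ suc m))) (ℤₚ.+-identityʳ j))))

  module _ (F : ℤ → Family) (bound₁ : ∀ n u v → suc n < ∣ u ∣ → F u v n ≈ 0#)
                            (bound₂ : ∀ n u v → suc n < ∣ v ∣ → F u v n ≈ 0#) where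
    private
      either : ∀ n u v → suc n < ∣ u ∣ ⊎ suc n < ∣ v ∣ → F u v n ≈ 0#
      either n u v (inj₁ lt) = bound₁ n u v lt
      either n u v (inj₂ lt) = bound₂ n u v lt

      F≡ : ∀ {u u′ v v′} → u ≡ u′ → v ≡ v′ → F u v ≋ F u′ v′
      F≡ ≡.refl ≡.refl = S.refl

    -- (j, k) ↦ (j + k, j − k) is a bijection of ℤ² onto the pairs of equal parity.
    Σℤ-rotate : Σℤ (λ j → Σℤ (λ k → F (j ℤ.+ k) (j ℤ.- k))) ≋
                Σℤ (λ j → Σℤ (λ k → F (2* j) (2* k))) ⊕ Σℤ (λ j → Σℤ (λ k → F (2*+1 j) (2*+1 k)))
    Σℤ-rotate = S.trans (S.trans (Σℤ-cong columns) (Σℤ-swap (λ j v → F v (2* j ℤ.- v))))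
      (S.trans (Σℤ-parity (Σℤ-bounded {λ v j → F v (2* j ℤ.- v)} (λ n v j → bound₁ n v (2* j ℤ.- v))))
        (S.+-cong (Σℤ-cong evens) (Σℤ-cong odds)))
      where
      -- Replacing k by v = j + k turns the pair into (v, 2j - v). Once the order of summation is
      -- exchanged, the parity of v separates the two sums, and for fixed v only a translation of j
      -- remains.
      columns : ∀ j → Σℤ (λ k → F (j ℤ.+ k) (j ℤ.- k)) ≋ Σℤ (λ v → F v (2* j ℤ.- v))
      columns j = S.trans (Σℤ-cong λ k → F≡ (ℤₚ.+-comm j k) (second k))
        (Σℤ-shift {λ v → F v (2* j ℤ.- v)} j (λ n v → bound₁ n v (2* j ℤ.- v))
          (λ n k lt → either n (k ℤ.+ j) (2* j ℤ.- (k ℤ.+ j)) (swap (k ℤ.+ j) (2* j ℤ.- (k ℤ.+ j)) (half-< (k ℤ.+ j) (ℤ.- (2* j ℤ.- (k ℤ.+ j))) k (2k k) lt))))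
        where
        second : ∀ k → j ℤ.- k ≡ 2* j ℤ.- (k ℤ.+ j)
        second k = ℤS.solve 2 (λ j k → j ℤS.:- k ℤS.:= ℤS.con (+ 2) ℤS.:* j ℤS.:- (k ℤS.:+ j)) ≡.refl j k
        2k : ∀ k → + 2 ℤ.* k ≡ (k ℤ.+ j) ℤ.+ ℤ.- (2* j ℤ.- (k ℤ.+ j))
        2k k = ℤS.solve 2 (λ j k → ℤS.con (+ 2) ℤS.:* k ℤS.:=
          (k ℤS.:+ j) ℤS.:+ ℤS.:- (ℤS.con (+ 2) ℤS.:* j ℤS.:- (k ℤS.:+ j))) ≡.refl j k
        swap : ∀ {m} u v → m < ∣ u ∣ ⊎ m < ∣ ℤ.- v ∣ → m < ∣ u ∣ ⊎ m < ∣ v ∣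
        swap u v (inj₁ lt) = inj₁ lt
        swap {m} u v (inj₂ lt) = inj₂ (≡.subst (m <_) (ℤₚ.∣-i∣≡∣i∣ v) lt)

      evens : ∀ w → Σℤ (λ j → F (2* w) (2* j ℤ.- 2* w)) ≋ Σℤ (λ i → F (2* w) (2* i))
      evens w = S.trans (Σℤ-cong λ j → F≡ ≡.refl (eq j))
        (Σℤ-shift {λ i → F (2* w) (2* i)} (ℤ.- w) (λ n i lt → bound₂ n (2* w) (2* i) (ℕₚ.<-≤-trans lt (∣2*∣ i)))
          (λ n j lt → either n (2* w) (2* (j ℤ.+ ℤ.- w)) (half-< (2* w) (2* (j ℤ.+ ℤ.- w)) j (2j j) lt)))
        where
        eq : ∀ j → 2* j ℤ.- 2* w ≡ 2* (j ℤ.+ ℤ.- w)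
        eq j = ℤS.solve 2 (λ j w → ℤS.con (+ 2) ℤS.:* j ℤS.:- ℤS.con (+ 2) ℤS.:* w ℤS.:=
          ℤS.con (+ 2) ℤS.:* (j ℤS.:+ ℤS.:- w)) ≡.refl j w
        2j : ∀ j → + 2 ℤ.* j ≡ 2* w ℤ.+ 2* (j ℤ.+ ℤ.- w)
        2j j = ℤS.solve 2 (λ j w → ℤS.con (+ 2) ℤS.:* j ℤS.:=
          ℤS.con (+ 2) ℤS.:* w ℤS.:+ ℤS.con (+ 2) ℤS.:* (j ℤS.:+ ℤS.:- w)) ≡.refl j w

      odds : ∀ w → Σℤ (λ j → F (2*+1 w) (2* j ℤ.- 2*+1 w)) ≋ Σℤ (λ i → F (2*+1 w) (2*+1 i))
      odds w = S.trans (Σℤ-cong λ j → F≡ ≡.refl (eq j))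
        (Σℤ-shift {λ i → F (2*+1 w) (2*+1 i)} s (λ n i lt → bound₂ n (2*+1 w) (2*+1 i) (ℕₚ.<-≤-trans lt (∣2*+1∣ i)))
          (λ n j lt → either n (2*+1 w) (2*+1 (j ℤ.+ s)) (half-< (2*+1 w) (2*+1 (j ℤ.+ s)) j (2j j) lt)))
        where
        s = ℤ.- w ℤ.- + 1
        eq : ∀ j → 2* j ℤ.- 2*+1 w ≡ 2*+1 (j ℤ.+ s)
        eq j = ℤS.solve 2 (λ j w → ℤS.con (+ 2) ℤS.:* j ℤS.:- (ℤS.con (+ 2) ℤS.:* w ℤS.:+ ℤS.con (+ 1)) ℤS.:=
          ℤS.con (+ 2) ℤS.:* (j ℤS.:+ (ℤS.:- w ℤS.:- ℤS.con (+ 1))) ℤS.:+ ℤS.con (+ 1)) ≡.refl j w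
        2j : ∀ j → + 2 ℤ.* j ≡ 2*+1 w ℤ.+ 2*+1 (j ℤ.+ s)
        2j j = ℤS.solve 2 (λ j w → ℤS.con (+ 2) ℤS.:* j ℤS.:= (ℤS.con (+ 2) ℤS.:* w ℤS.:+ ℤS.con (+ 1)) ℤS.:+
          (ℤS.con (+ 2) ℤS.:* (j ℤS.:+ (ℤS.:- w ℤS.:- ℤS.con (+ 1))) ℤS.:+ ℤS.con (+ 1))) ≡.refl j w

-- Quadratic and triangular exponents

module SumsOfSquares where
  open ℤS using (_:+_; _:*_; _:-_; con; _:=_)

  2∙_ : ℕ → ℕ
  2∙ n = n ℕ.+ n

  sq : ℤ → ℕ
  sq j = ∣ j ∣ ℕ.* ∣ j ∣

  private
    sq-ℤ : ∀ j → + sq j ≡ j ℤ.* j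
    sq-ℤ (+ n)    = ℤₚ.pos-* n n
    sq-ℤ -[1+ n ] = ≡.refl

    from-ℤ : ∀ {m n i j} → + m ≡ i → + n ≡ j → i ≡ j → m ≡ n
    from-ℤ e e′ i≡j = ℤₚ.+-injective (≡.trans e (≡.trans i≡j (≡.sym e′)))

    +-ℤ : ∀ {m n i j} → + m ≡ i → + n ≡ j → + (m ℕ.+ n) ≡ i ℤ.+ j
    +-ℤ {m} {n} ≡.refl ≡.refl = ℤₚ.pos-+ m n

  sq-2* : ∀ j → sq (2* j) ≡ (sq j ℕ.+ sq j) ℕ.+ (sq j ℕ.+ sq j)
  sq-2* j = from-ℤ (sq-ℤ (2* j)) (+-ℤ (+-ℤ (sq-ℤ j) (sq-ℤ j)) (+-ℤ (sq-ℤ j) (sq-ℤ j)))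
    (ℤS.solve 1 (λ j → (con (+ 2) :* j) :* (con (+ 2) :* j) := (j :* j :+ j :* j) :+ (j :* j :+ j :* j)) ≡.refl j)

  -- The factor 2 comes from rotating ℤ² by 45°.
  dsq : ℤ → ℤ → ℕ
  dsq u v = 2∙ (sq u ℕ.+ sq v)

  private
    dsq-ℤ : ∀ u v → + dsq u v ≡ (u ℤ.* u ℤ.+ v ℤ.* v) ℤ.+ (u ℤ.* u ℤ.+ v ℤ.* v)
    dsq-ℤ u v = +-ℤ (+-ℤ (sq-ℤ u) (sq-ℤ v)) (+-ℤ (sq-ℤ u) (sq-ℤ v))

  dsq-even : ∀ j k → sq (2* j) ℕ.+ sq (2* k) ≡ dsq (j ℤ.+ k) (j ℤ.- k)
  dsq-even j k = from-ℤ (+-ℤ (sq-ℤ (2* j)) (sq-ℤ (2* k))) (dsq-ℤ (j ℤ.+ k) (j ℤ.- k))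
    (ℤS.solve 2 (λ j k → (con (+ 2) :* j) :* (con (+ 2) :* j) :+ (con (+ 2) :* k) :* (con (+ 2) :* k) :=
       ((j :+ k) :* (j :+ k) :+ (j :- k) :* (j :- k)) :+ ((j :+ k) :* (j :+ k) :+ (j :- k) :* (j :- k))) ≡.refl j k)

  dsq-odd : ∀ j k → sq (2*+1 j) ℕ.+ sq (2*+1 k) ≡ dsq (j ℤ.+ k ℤ.+ + 1) (j ℤ.- k)
  dsq-odd j k = from-ℤ (+-ℤ (sq-ℤ (2*+1 j)) (sq-ℤ (2*+1 k))) (dsq-ℤ (j ℤ.+ k ℤ.+ + 1) (j ℤ.- k))
    (ℤS.solve 2 (λ j k → let a = con (+ 2) :* j :+ con (+ 1); b = con (+ 2) :* k :+ con (+ 1)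
                             u = j :+ k :+ con (+ 1); v = j :- k in
       a :* a :+ b :* b := (u :* u :+ v :* v) :+ (u :* u :+ v :* v)) ≡.refl j k)

  2*+1-suc : ∀ j → 2*+1 j ℤ.+ + 1 ≡ 2* (j ℤ.+ + 1)
  2*+1-suc = ℤS.solve 1 (λ j → (con (+ 2) :* j :+ con (+ 1)) :+ con (+ 1) := con (+ 2) :* (j :+ con (+ 1))) ≡.refl

  ∣j∣≤sq : ∀ j → ∣ j ∣ ≤ sq j
  ∣j∣≤sq j = go ∣ j ∣
    where
    go : ∀ m → m ≤ m ℕ.* m
    go zero    = ℕ.z≤n
    go (suc m) = ℕₚ.m≤m+n (suc m) (m ℕ.* suc m)

  sq≤dsqˡ : ∀ u v → sq u ≤ dsq u v
  sq≤dsqˡ u v = ℕₚ.≤-trans (ℕₚ.m≤m+n (sq u) (sq v)) (ℕₚ.m≤m+n _ _)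

  sq≤dsqʳ : ∀ u v → sq v ≤ dsq u v
  sq≤dsqʳ u v = ℕₚ.≤-trans (ℕₚ.m≤n+m (sq v) (sq u)) (ℕₚ.m≤m+n _ _)

  -- This identifies j with -1 - j, the symmetry that changes the sign of 2j + 1. Thus
  -- `tri (fold j)` is j(j + 1)/2 for every integer j.
  fold : ℤ → ℕ
  fold (+ n)    = n
  fold -[1+ n ] = n

  ∣2*+1∣≡ : ∀ j → ∣ 2*+1 j ∣ ≡ suc (fold j ℕ.+ fold j)
  ∣2*+1∣≡ (+ n) = ≡.trans (≡.cong (λ i → ∣ i ℤ.+ + 1 ∣) (≡.sym (ℤₚ.pos-* 2 n)))
    (≡.trans (ℕₚ.+-comm _ 1) (≡.cong (λ k → suc (n ℕ.+ k)) (ℕₚ.+-identityʳ n)))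
  ∣2*+1∣≡ -[1+ n ] rewrite ℕₚ.+-suc n (n ℕ.+ 0) | ℕₚ.+-identityʳ n = ≡.refl

  tri : ℕ → ℕ
  tri zero    = 0
  tri (suc n) = suc n ℕ.+ tri n

  8tri : ∀ n → suc (n ℕ.+ n) ℕ.* suc (n ℕ.+ n) ≡ suc (2∙ 2∙ 2∙ tri n)
  8tri zero    = ≡.refl
  8tri (suc n) = ≡.trans
    (ℕS.solve 1 (λ n → let m = ℕS.con 1 ℕS.:+ n; a = ℕS.con 1 ℕS.:+ (n ℕS.:+ n); b = ℕS.con 1 ℕS.:+ (m ℕS.:+ m) in
       b ℕS.:* b ℕS.:= a ℕS.:* a ℕS.:+ ℕS.con 8 ℕS.:* m) ≡.refl n)
    (≡.trans (≡.cong (ℕ._+ 8 ℕ.* suc n) (8tri n))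
    (ℕS.solve 2 (λ n t → let m = ℕS.con 1 ℕS.:+ n; d = λ a → a ℕS.:+ a in
       ℕS.con 1 ℕS.:+ d (d (d t)) ℕS.:+ ℕS.con 8 ℕS.:* m ℕS.:= ℕS.con 1 ℕS.:+ d (d (d (m ℕS.:+ t)))) ≡.refl n (tri n)))

  sq-2*+1 : ∀ j → sq (2*+1 j) ≡ suc (2∙ 2∙ 2∙ tri (fold j))
  sq-2*+1 j = ≡.trans (≡.cong (λ m → m ℕ.* m) (∣2*+1∣≡ j)) (8tri (fold j))

  -- Equality holds at j = -1, where the triangular number is 0.
  ∣j∣≤tri : ∀ j → ∣ j ∣ ≤ suc (tri (fold j))
  ∣j∣≤tri (+ zero)   = ℕ.z≤n
  ∣j∣≤tri (+ suc n)  = ℕₚ.m≤n⇒m≤1+n (ℕₚ.m≤m+n (suc n) (tri n))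
  ∣j∣≤tri -[1+ zero ]  = ℕₚ.≤-refl
  ∣j∣≤tri -[1+ suc n ] = ℕ.s≤s (ℕₚ.m≤m+n (suc n) (tri n))

open SumsOfSquares

-- Theta series and their dilations

module ThetaSeries {c ℓ} (R : CommutativeRing c ℓ) where
  open CommutativeRing R hiding (_+_; _*_; _-_; -_)
  open PowerSeries R public
  open IntegerSums R public

  mono : ℕ → Pow
  mono zero    = 𝟙
  mono (suc n) = shift (mono n)

  shift-cong : ∀ {f g} → f ≋ g → shift f ≋ shift g
  shift-cong e = pointwise λ where
    zero    → refl
    (suc n) → at e n

  mono-⊗ : ∀ i j → mono i ⊗ mono j ≋ mono (i ℕ.+ j)
  mono-⊗ zero    j = S.*-identityˡ _
  mono-⊗ (suc i) j = S.trans (pointwise (shift-⊗ (mono i) (mono j))) (shift-cong (mono-⊗ i j))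

  mono-suc-⊗ : ∀ i f n → (mono (suc i) ⊗ f) (suc n) ≈ (mono i ⊗ f) n
  mono-suc-⊗ i f n = shift-⊗ (mono i) f (suc n)

  mono-⊗-low : ∀ {i n} f → n < i → (mono i ⊗ f) n ≈ 0#
  mono-⊗-low {suc i} {zero}  f n<i = shift-⊗ (mono i) f 0
  mono-⊗-low {suc i} {suc n} f n<i = trans (mono-suc-⊗ i f n) (mono-⊗-low f (ℕ.s<s⁻¹ n<i))

  mono-⊗-+ : ∀ i f n → (mono i ⊗ f) (i ℕ.+ n) ≈ f n
  mono-⊗-+ zero    f n = at (S.*-identityˡ f) n
  mono-⊗-+ (suc i) f n = trans (mono-suc-⊗ i f (i ℕ.+ n)) (mono-⊗-+ i f n)

  mono-low : ∀ {i n} → n < i → mono i n ≈ 0#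
  mono-low {i} {n} n<i = trans (at (S.sym (S.*-identityʳ (mono i))) n) (mono-⊗-low 𝟙 n<i)

  V-mono : ∀ i → V 2 (mono i) ≋ mono (i ℕ.+ i)
  V-mono zero = V-𝟙 2
  V-mono (suc i) rewrite ℕₚ.+-suc i i = pointwise λ where
    zero          → refl
    (suc zero)    → refl
    (suc (suc n)) → at (V-mono i) n

  ≡⇒≋ : ∀ {m n} → m ≡ n → mono m ≋ mono n
  ≡⇒≋ ≡.refl = S.refl

  Σmono : (ℤ → ℕ) → Pow
  Σmono e = Σℤ (λ j → mono (e j))

  mono-bounded : ∀ (e : ℤ → ℕ) → (∀ j → ∣ j ∣ ≤ suc (e j)) → Bounded (λ j → mono (e j))
  mono-bounded e h n j n<j = mono-low (ℕ.s<s⁻¹ (ℕₚ.<-≤-trans n<j (h j)))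

  private
    bd : ∀ (f : ℤ → ℤ) → (∀ j → ∣ j ∣ ≤ ∣ f j ∣) → Bounded (λ j → mono (sq (f j)))
    bd f h = mono-bounded (λ j → sq (f j)) (λ (j : ℤ) → ℕₚ.m≤n⇒m≤1+n (ℕₚ.≤-trans (h j) (∣j∣≤sq (f j))))

    x-bd = bd (λ j → j) (λ _ → ℕₚ.≤-refl)
    E-bd = bd 2* ∣2*∣
    O-bd = bd 2*+1 ∣2*+1∣

  -- x is Ramanujan's φ(q), and ψ is twice Ramanujan's ψ(q).
  x E O ψ : Pow
  x = Σmono sq
  E = Σmono (λ j → sq (2* j))
  O = Σmono (λ j → sq (2*+1 j))
  ψ = Σmono (λ j → tri (fold j))

  x-split : x ≋ E ⊕ O
  x-split = Σℤ-parity x-bd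

  V-Σmono : ∀ (e : ℤ → ℕ) → (∀ j → ∣ j ∣ ≤ suc (e j)) → V 2 (Σmono e) ≋ Σmono (λ j → 2∙ e j)
  V-Σmono e h = S.trans (Σℤ-V {λ j → mono (e j)} (mono-bounded e h) 2) (Σℤ-cong λ j → V-mono (e j))

  private
    slack : ∀ {e : ℤ → ℕ} → (∀ j → ∣ j ∣ ≤ suc (e j)) → ∀ j → ∣ j ∣ ≤ suc (2∙ e j)
    slack h j = ℕₚ.≤-trans (h j) (ℕ.s≤s (ℕₚ.m≤m+n _ _))

    sq-slack : ∀ j → ∣ j ∣ ≤ suc (sq j)
    sq-slack j = ℕₚ.m≤n⇒m≤1+n (∣j∣≤sq j)

  E-dilation : E ≋ V 2 (V 2 x)
  E-dilation = S.sym (S.trans (V-cong 2 (V-Σmono sq sq-slack))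
    (S.trans (V-Σmono _ (slack sq-slack)) (Σℤ-cong λ j → ≡⇒≋ (≡.sym (sq-2* j)))))

  -- Since (2j + 1)² = 8 · j(j + 1)/2 + 1, every exponent of `O` is 1 modulo 8. The dissection
  -- modulo 4 rests on this.
  O-dilation : O ≋ X ⊗ V 2 (V 2 (V 2 ψ))
  O-dilation = S.sym (S.trans (S.*-congˡ (S.trans (V-cong 2 (V-cong 2 (V-Σmono _ ∣j∣≤tri)))
      (S.trans (V-cong 2 (V-Σmono _ (slack ∣j∣≤tri))) (V-Σmono _ (slack (slack ∣j∣≤tri))))))
    (S.trans (S.*-comm _ _) (S.trans (Σℤ-⊗ {λ j → mono (2∙ 2∙ 2∙ tri (fold j))} (mono-bounded _ (slack (slack (slack ∣j∣≤tri)))) X)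
      (Σℤ-cong λ j → S.trans (mono-⊗ (2∙ 2∙ 2∙ tri (fold j)) 1) (≡⇒≋ (≡.trans (ℕₚ.+-comm _ 1) (≡.sym (sq-2*+1 j))))))))

  private
    low : ∀ {m e} i → m < ∣ i ∣ → ∣ i ∣ ≤ e → mono e m ≈ 0#
    low i lt le = mono-low (ℕₚ.<-≤-trans lt le)

    product : ∀ (f g : ℤ → ℤ) → (∀ j → ∣ j ∣ ≤ ∣ f j ∣) → (∀ j → ∣ j ∣ ≤ ∣ g j ∣) →
      Σmono (λ j → sq (f j)) ⊗ Σmono (λ j → sq (g j)) ≋ Σℤ (λ j → Σmono (λ k → sq (f j) ℕ.+ sq (g k)))
    product f g hf hg = S.trans (Σℤ-product (bd f hf) (bd g hg))
      (Σℤ-cong λ j → Σℤ-cong λ k → mono-⊗ (sq (f j)) (sq (g k)))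

    V-product : ∀ (f g : ℤ → ℤ) → (∀ j → ∣ j ∣ ≤ ∣ f j ∣) → (∀ j → ∣ j ∣ ≤ ∣ g j ∣) →
      V 2 (Σmono (λ j → sq (f j)) ⊗ Σmono (λ j → sq (g j))) ≋ Σℤ (λ j → Σmono (λ k → dsq (f j) (g k)))
    V-product f g hf hg = S.trans (V-cong 2 (product f g hf hg)) (S.trans
      (Σℤ-V {λ j → Σmono (λ k → sq (f j) ℕ.+ sq (g k))} (Σℤ-bounded {λ j k → mono (sq (f j) ℕ.+ sq (g k))} λ n j k lt →
        low j (ℕₚ.<-trans (ℕₚ.n<1+n n) lt) (ℕₚ.≤-trans (hf j) (ℕₚ.≤-trans (∣j∣≤sq (f j)) (ℕₚ.m≤m+n (sq (f j)) (sq (g k)))))) 2)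
      (Σℤ-cong λ j → V-Σmono (λ k → sq (f j) ℕ.+ sq (g k)) λ k → ℕₚ.m≤n⇒m≤1+n (ℕₚ.≤-trans (hg k) (ℕₚ.≤-trans (∣j∣≤sq (g k)) (ℕₚ.m≤n+m (sq (g k)) (sq (f j)))))))

  -- By (2j)² + (2k)² = 2((j + k)² + (j - k)²) the sum runs over pairs of equal parity with doubled
  -- exponents; pairs of even numbers give E², pairs of odd numbers O².
  E²-dilation : E ⊗ E ≋ V 2 (E ⊗ E ⊕ O ⊗ O)
  E²-dilation = begin
    E ⊗ E
      ≈⟨ S.trans (product 2* 2* ∣2*∣ ∣2*∣) (Σℤ-cong λ j → Σℤ-cong λ k → ≡⇒≋ (dsq-even j k)) ⟩
    Σℤ (λ j → Σmono (λ k → dsq (j ℤ.+ k) (j ℤ.- k)))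
      ≈⟨ Σℤ-rotate (λ u v → mono (dsq u v))
           (λ n u v lt → low u (ℕₚ.<-trans (ℕₚ.n<1+n n) lt) (ℕₚ.≤-trans (∣j∣≤sq u) (sq≤dsqˡ u v)))
           (λ n u v lt → low v (ℕₚ.<-trans (ℕₚ.n<1+n n) lt) (ℕₚ.≤-trans (∣j∣≤sq v) (sq≤dsqʳ u v))) ⟩
    Σℤ (λ j → Σmono (λ k → dsq (2* j) (2* k))) ⊕ Σℤ (λ j → Σmono (λ k → dsq (2*+1 j) (2*+1 k)))
      ≈⟨ S.+-cong (V-product 2* 2* ∣2*∣ ∣2*∣) (V-product 2*+1 2*+1 ∣2*+1∣ ∣2*+1∣) ⟨
    V 2 (E ⊗ E) ⊕ V 2 (O ⊗ O)
      ≈⟨ V-⊕ 2 (E ⊗ E) (O ⊗ O) ⟨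
    V 2 (E ⊗ E ⊕ O ⊗ O) ∎
    where open import Relation.Binary.Reasoning.Setoid S.setoid

  -- Here (2j + 1)² + (2k + 1)² = 2((j + k + 1)² + (j - k)²), and the two numbers squared have
  -- opposite parity. This produces the mixed products.
  O²-dilation : O ⊗ O ≋ V 2 (O ⊗ E ⊕ E ⊗ O)
  O²-dilation = begin
    O ⊗ O
      ≈⟨ S.trans (product 2*+1 2*+1 ∣2*+1∣ ∣2*+1∣) (Σℤ-cong λ j → Σℤ-cong λ k → ≡⇒≋ (dsq-odd j k)) ⟩
    Σℤ (λ j → Σmono (λ k → dsq (j ℤ.+ k ℤ.+ + 1) (j ℤ.- k)))
      ≈⟨ Σℤ-rotate (λ u v → mono (dsq (u ℤ.+ + 1) v))
           -- Adding 1 to u may lower its absolute value by 1, which the unit of slack in the bound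
           -- absorbs.
           (λ n u v lt → low (u ℤ.+ + 1) (ℕₚ.+-cancelʳ-< 1 _ _ (≡.subst (_< ∣ u ℤ.+ + 1 ∣ ℕ.+ 1) (ℕₚ.+-comm 1 n) (ℕₚ.<-≤-trans lt (∣u∣≤ u)))) (ℕₚ.≤-trans (∣j∣≤sq (u ℤ.+ + 1)) (sq≤dsqˡ (u ℤ.+ + 1) v)))
           (λ n u v lt → low v (ℕₚ.<-trans (ℕₚ.n<1+n n) lt) (ℕₚ.≤-trans (∣j∣≤sq v) (sq≤dsqʳ (u ℤ.+ + 1) v))) ⟩
    Σℤ (λ j → Σmono (λ k → dsq (2* j ℤ.+ + 1) (2* k))) ⊕ Σℤ (λ j → Σmono (λ k → dsq (2*+1 j ℤ.+ + 1) (2*+1 k)))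
      -- For odd pairs the first number has become 2j + 2; a translation brings it back to 2j.
      ≈⟨ S.+-congˡ (S.trans (Σℤ-cong λ j → Σℤ-cong λ k → ≡⇒≋ (≡.cong (λ u → dsq u (2*+1 k)) (2*+1-suc j)))
           (Σℤ-shift {λ j → Σmono (λ k → dsq (2* j) (2*+1 k))} (+ 1)
             (Σℤ-bounded {λ j k → mono (dsq (2* j) (2*+1 k))} λ n j k lt → low j (ℕₚ.<-trans (ℕₚ.n<1+n n) lt) (far j k))
             (Σℤ-bounded {λ j k → mono (dsq (2* (j ℤ.+ + 1)) (2*+1 k))} λ n j k lt →
               low (2* (j ℤ.+ + 1)) (ℕₚ.<-≤-trans (ℕₚ.+-cancelʳ-< 1 _ _ (≡.subst (_< ∣ j ℤ.+ + 1 ∣ ℕ.+ 1) (ℕₚ.+-comm 1 n) (ℕₚ.<-≤-trans lt (∣u∣≤ j)))) (∣2*∣ (j ℤ.+ + 1)))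
                 (ℕₚ.≤-trans (∣j∣≤sq (2* (j ℤ.+ + 1))) (sq≤dsqˡ (2* (j ℤ.+ + 1)) (2*+1 k)))))) ⟩
    Σℤ (λ j → Σmono (λ k → dsq (2*+1 j) (2* k))) ⊕ Σℤ (λ j → Σmono (λ k → dsq (2* j) (2*+1 k)))
      ≈⟨ S.+-cong (V-product 2*+1 2* ∣2*+1∣ ∣2*∣) (V-product 2* 2*+1 ∣2*∣ ∣2*+1∣) ⟨
    V 2 (O ⊗ E) ⊕ V 2 (E ⊗ O)
      ≈⟨ V-⊕ 2 (O ⊗ E) (E ⊗ O) ⟨
    V 2 (O ⊗ E ⊕ E ⊗ O) ∎
    where
    open import Relation.Binary.Reasoning.Setoid S.setoid

    ∣u∣≤ : ∀ u → ∣ u ∣ ≤ ∣ u ℤ.+ + 1 ∣ ℕ.+ 1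
    ∣u∣≤ u = ≡.subst (λ i → ∣ i ∣ ≤ ∣ u ℤ.+ + 1 ∣ ℕ.+ 1)
      (≡.trans (ℤₚ.+-assoc u (+ 1) -[1+ 0 ]) (ℤₚ.+-identityʳ u)) (ℤₚ.∣i+j∣≤∣i∣+∣j∣ (u ℤ.+ + 1) -[1+ 0 ])

    far : ∀ j k → ∣ j ∣ ≤ dsq (2* j) (2*+1 k)
    far j k = ℕₚ.≤-trans (∣2*∣ j) (ℕₚ.≤-trans (∣j∣≤sq (2* j)) (sq≤dsqˡ (2* j) (2*+1 k)))

-- Gauss's identity

⊛-suc : ∀ f g n → (f ⊛ g) (suc n) ≡ f 0 ℕ.* g (suc n) ℕ.+ ((λ i → f (suc i)) ⊛ g) n
⊛-suc f g n = sumTo-suc n (λ i → f i ℕ.* g (suc n ℕ.∸ i))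
  where
  sumTo-suc : ∀ m h → sumTo (suc m) h ≡ h 0 ℕ.+ sumTo m (λ i → h (suc i))
  sumTo-suc zero    h = ≡.refl
  sumTo-suc (suc m) h = ≡.trans (≡.cong (ℕ._+ h (suc (suc m))) (sumTo-suc m h)) (ℕₚ.+-assoc (h 0) _ _)

factor-∣ : ∀ k n → suc k ∣ suc n → factor k (suc n) ≡ 2
factor-∣ k n d = ≡.cong (if_then 2 else 0) (dec-true (suc k ∣? suc n) d)

factor-∤ : ∀ k n → ¬ suc k ∣ suc n → factor k (suc n) ≡ 0
factor-∤ k n ∤ = ≡.cong (if_then 2 else 0) (dec-false (suc k ∣? suc n) ∤)

factor-low : ∀ k {n} → 0 < n → n ≤ k → factor k n ≡ 0
factor-low k {suc n} _ n≤k = factor-∤ k n (λ d → ℕₚ.<⇒≱ (ℕ.s≤s n≤k) (∣⇒≤ d))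

factor-periodic : ∀ k n → factor k (suc k ℕ.+ suc n) ≡ factor k (suc n)
factor-periodic k n with suc k ∣? suc n
... | yes d = ≡.trans (factor-∣ k (k ℕ.+ suc n) (∣m∣n⇒∣m+n ∣-refl d)) (≡.sym (factor-∣ k n d))
... | no ∤  = ≡.trans (factor-∤ k (k ℕ.+ suc n) (λ d → ∤ (∣m+n∣m⇒∣n d ∣-refl))) (≡.sym (factor-∤ k n ∤))

module GaussIdentity {c ℓ} (R : CommutativeRing c ℓ) where
  open CommutativeRing R hiding (_+_; _*_; _-_; -_)
  open CommutativeRing R using () renaming (_+_ to _+ᴿ_)
  open IntegerCoefficients R using (fromℕ)
  open ThetaSeries R
  open Sℤ using (con; _:+_; _:*_; _:-_; :-_; _:=_)
  open import Algebra.Properties.Semiring.Mult.TCOptimised semiring using (×-homo-+; ×1-homo-*)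
  open import Algebra.Properties.Ring S.ring using (-1*x≈-x)

  σ : ℕ → Pow
  σ zero    = 𝟙
  σ (suc n) = ⊝ σ n

  private
    σ-double : ∀ n → σ (n ℕ.+ n) ≋ 𝟙
    σ-double zero    = S.refl
    σ-double (suc n) rewrite ℕₚ.+-suc n n = S.trans (Sℤ.solve 1 (λ a → :- (:- a) := a) S.refl (σ (n ℕ.+ n))) (σ-double n)

  signed : Family
  signed j = σ ∣ j ∣ ⊗ mono (sq j)

  -- y is φ(−q)
  y : Pow
  y = Σℤ signed

  signed-bounded : Bounded signed
  signed-bounded n j lt = trans (at (S.*-comm (σ ∣ j ∣) (mono (sq j))) n)
    (mono-⊗-low (σ ∣ j ∣) (ℕₚ.<-≤-trans (ℕₚ.<-trans (ℕₚ.n<1+n n) lt) (∣j∣≤sq j)))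

  y-split : y ≋ E ⊕ ⊝ O
  y-split = S.trans (Σℤ-parity signed-bounded) (S.+-cong
    (Σℤ-cong {λ j → signed (2* j)} {λ j → mono (sq (2* j))} λ j → S.trans (S.*-congʳ (even j)) (S.*-identityˡ _))
    (S.trans (Σℤ-cong {λ j → signed (2*+1 j)} {λ j → mono (sq (2*+1 j)) ⊗ ⊝ 𝟙} λ j →
        S.trans (S.*-congʳ (odd j)) (S.*-comm (⊝ 𝟙) (mono (sq (2*+1 j)))))
      (S.trans (S.sym (Σℤ-⊗ {λ j → mono (sq (2*+1 j))} O-bounded (⊝ 𝟙))) (S.trans (S.*-comm O (⊝ 𝟙)) (-1*x≈-x O)))))
    where
    O-bounded : Bounded (λ j → mono (sq (2*+1 j)))
    O-bounded = mono-bounded (λ j → sq (2*+1 j)) (λ j → ℕₚ.m≤n⇒m≤1+n (ℕₚ.≤-trans (∣2*+1∣ j) (∣j∣≤sq (2*+1 j))))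

    even : ∀ j → σ ∣ 2* j ∣ ≋ 𝟙
    even j = S.trans (S.reflexive (≡.cong σ (≡.trans (ℤₚ.abs-* (+ 2) j) (≡.cong (∣ j ∣ ℕ.+_) (ℕₚ.+-identityʳ _))))) (σ-double ∣ j ∣)

    odd : ∀ j → σ ∣ 2*+1 j ∣ ≋ ⊝ 𝟙
    odd j = S.trans (S.reflexive (≡.cong σ (∣2*+1∣≡ j))) (S.-‿cong (σ-double (fold j)))

  partial : ℕ → Pow
  partial M = window M signed

  partial-zero : partial 0 ≋ 𝟙
  partial-zero = S.trans (S.+-identityʳ _) (S.*-identityˡ _)

  partial-suc : ∀ M → partial (suc M) ≋ partial M ⊕ Sℤ.fromℕ 2 ⊗ (σ (suc M) ⊗ mono (suc M ℕ.* suc M))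
  partial-suc M = pointwise λ n → begin
    signed -[1+ M ] n +ᴿ sum (M ℕ.+ suc (suc M)) h n
      ≡⟨ ≡.cong (λ K → signed -[1+ M ] n +ᴿ sum K h n) (≡.trans (ℕₚ.+-suc M (suc M)) (ℕₚ.+-comm 1 _)) ⟩
    signed -[1+ M ] n +ᴿ sum ((M ℕ.+ suc M) ℕ.+ 1) h n
      ≈⟨ +-congˡ (sum-split (M ℕ.+ suc M) 1 h n) ⟩
    signed -[1+ M ] n +ᴿ (sum (M ℕ.+ suc M) h n +ᴿ (h (M ℕ.+ suc M ℕ.+ 0) n +ᴿ 0#))
      ≈⟨ +-congˡ (+-cong
           (sum-cong (M ℕ.+ suc M) h (λ i → signed (+ i ℤ.- + M)) n (λ i → reflexive (≡.cong (λ j → signed j n) (inner i))))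
           (+-congʳ (reflexive (≡.cong (λ j → signed j n) outer)))) ⟩
    signed -[1+ M ] n +ᴿ (partial M n +ᴿ (signed (+ suc M) n +ᴿ 0#))
      ≈⟨ at (Sℤ.solve 2 (λ a b → a :+ (b :+ (a :+ con (+ 0))) := b :+ con (+ 2) :* a) S.refl (signed (+ suc M)) (partial M)) n ⟩
    _ ∎
    where
    open import Relation.Binary.Reasoning.Setoid setoid
    h = λ i → signed (+ suc i ℤ.- + suc M)

    inner : ∀ i → + suc i ℤ.- + suc M ≡ + i ℤ.- + M
    inner i = ≡.trans (ℤₚ.m-n≡m⊖n (suc i) (suc M)) (≡.trans (ℤₚ.[1+m]⊖[1+n]≡m⊖n i M) (≡.sym (ℤₚ.m-n≡m⊖n i M)))

    outer : + suc (M ℕ.+ suc M ℕ.+ 0) ℤ.- + suc M ≡ + suc M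
    outer = ≡.trans (inner (M ℕ.+ suc M ℕ.+ 0)) (≡.trans (≡.cong (λ k → + k ℤ.- + M) (ℕₚ.+-identityʳ _))
      (≡.trans (≡.cong (ℤ._- + M) (ℤₚ.pos-+ M (suc M)))
        (ℤS.solve 2 (λ a b → (a ℤS.:+ b) ℤS.:- a ℤS.:= b) ≡.refl (+ M) (+ suc M))))

  lift : Series → Pow
  lift f n = fromℕ (f n)

  lift-⊛ : ∀ f g n → lift (f ⊛ g) n ≈ (lift f ⊗ lift g) n
  lift-⊛ f g zero    = ×1-homo-* (f 0) (g 0)
  lift-⊛ f g (suc n) = trans (reflexive (≡.cong fromℕ (⊛-suc f g n)))
    (trans (×-homo-+ 1# (f 0 ℕ.* g (suc n)) _) (+-cong (×1-homo-* (f 0) (g (suc n))) (lift-⊛ (λ i → f (suc i)) g n)))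

  fac : ℕ → Pow
  fac k = lift (factor k)

  -- This is (1 - q^(k+1)) f = 1 + q^(k+1), arranged for comparison of coefficients: the coefficient
  -- at k + 1 is 1 + 1, and beyond it divisibility by k + 1 is periodic.
  fac-equation : ∀ k → fac k ≋ 𝟙 ⊕ mono (suc k) ⊗ (𝟙 ⊕ fac k)
  fac-equation k = pointwise go
    where
    go : ∀ n → fac k n ≈ 𝟙 n +ᴿ (mono (suc k) ⊗ (𝟙 ⊕ fac k)) n
    go zero = sym (trans (+-congˡ (mono-⊗-low {suc k} (𝟙 ⊕ fac k) (ℕ.s≤s ℕ.z≤n))) (+-identityʳ _))
    go (suc n) with ℕₚ.≤-<-connex (suc n) k
    ... | inj₁ n<k = trans (reflexive (≡.cong fromℕ (factor-low k (ℕ.s≤s ℕ.z≤n) n<k)))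
                       (sym (trans (+-identityˡ _) (mono-⊗-low {suc k} (𝟙 ⊕ fac k) (ℕ.s≤s n<k))))
    ... | inj₂ k≤n with ℕₚ.m≤n⇒∃[o]m+o≡n k≤n
    ...   | zero  , e with ≡.refl ← ≡.trans (≡.sym (ℕₚ.suc-injective e)) (ℕₚ.+-identityʳ k) =
      trans (reflexive (≡.cong fromℕ (factor-∣ k k ∣-refl)))
        (sym (trans (+-identityˡ _) (trans (reflexive (≡.cong (mono (suc k) ⊗ (𝟙 ⊕ fac k)) (≡.sym (ℕₚ.+-identityʳ (suc k)))))
          (mono-⊗-+ (suc k) (𝟙 ⊕ fac k) 0))))
    ...   | suc i , ≡.refl = trans (reflexive (≡.cong fromℕ (factor-periodic k i)))
      (sym (trans (+-identityˡ _) (trans (mono-⊗-+ (suc k) (𝟙 ⊕ fac k) (suc i)) (+-identityˡ _))))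

  Q : ℕ → Pow
  Q K = lift (prodTo K)

  Q-zero : Q 0 ≋ 𝟙
  Q-zero = pointwise λ where
    zero    → refl
    (suc _) → refl

  Q-suc : ∀ K → Q (suc K) ≋ Q K ⊗ fac K
  Q-suc K = pointwise (lift-⊛ (prodTo K) (factor K))

  Q-equation : ∀ K → (𝟙 ⊕ ⊝ mono (suc K)) ⊗ Q (suc K) ≋ (𝟙 ⊕ mono (suc K)) ⊗ Q K
  Q-equation K = begin
    (𝟙 ⊕ ⊝ m) ⊗ Q (suc K)
      ≈⟨ S.*-congˡ (Q-suc K) ⟩
    (𝟙 ⊕ ⊝ m) ⊗ (Q K ⊗ fac K)
      ≈⟨ Sℤ.solve 3 (λ m q f → (con (+ 1) :+ :- m) :* (q :* f) := q :* (f :- m :* f)) S.refl m (Q K) (fac K) ⟩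
    Q K ⊗ (fac K ⊕ ⊝ (m ⊗ fac K))
      ≈⟨ S.*-congˡ (S.+-congʳ (fac-equation K)) ⟩
    Q K ⊗ ((𝟙 ⊕ m ⊗ (𝟙 ⊕ fac K)) ⊕ ⊝ (m ⊗ fac K))
      ≈⟨ Sℤ.solve 3 (λ m q f → q :* ((con (+ 1) :+ m :* (con (+ 1) :+ f)) :- m :* f) := (con (+ 1) :+ m) :* q) S.refl m (Q K) (fac K) ⟩
    (𝟙 ⊕ m) ⊗ Q K ∎
    where
    m = mono (suc K)
    open import Relation.Binary.Reasoning.Setoid S.setoid

  -- Shanks' finite form: Q n ⊗ partial n ≋ shanks n n
  shanks : ℕ → ℕ → Pow
  shanks n zero    = 𝟙
  shanks n (suc k) = shanks n k ⊕ σ (suc k) ⊗ (mono (suc k ℕ.* suc n) ⊗ (Q k ⊕ Q (suc k)))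

  private
    split-* : ∀ k n → mono (suc k ℕ.* suc n) ≋ mono (suc k ℕ.* n) ⊗ mono (suc k)
    split-* k n = S.trans (≡⇒≋ (≡.trans (ℕₚ.*-suc (suc k) n) (ℕₚ.+-comm (suc k) _))) (S.sym (mono-⊗ (suc k ℕ.* n) (suc k)))

  -- Raising n by 1 multiplies the j-th term by q^j. Because (1 - q^j) Qⱼ = (1 + q^j) Qⱼ₋₁, the
  -- changes telescope and leave one boundary term.
  shanks-step : ∀ n k → (𝟙 ⊕ ⊝ mono (suc n)) ⊗ shanks (suc n) k ≋
    (𝟙 ⊕ mono (suc n)) ⊗ shanks n k ⊕ Sℤ.fromℕ 2 ⊗ (σ (suc k) ⊗ (mono (suc k ℕ.* suc n) ⊗ Q k))
  shanks-step n zero = S.trans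
    (Sℤ.solve 1 (λ a → (con (+ 1) :- a) :* con (+ 1) :=
       (con (+ 1) :+ a) :* con (+ 1) :+ con (+ 2) :* ((:- con (+ 1)) :* (a :* con (+ 1)))) S.refl (mono (suc n)))
    (S.+-congˡ (S.*-congˡ (S.*-congˡ (S.*-cong (≡⇒≋ (≡.sym (ℕₚ.+-identityʳ (suc n)))) (S.sym Q-zero)))))
  shanks-step n (suc k) = begin
    (𝟙 ⊕ ⊝ a) ⊗ (shanks (suc n) k ⊕ s ⊗ (mono (suc k ℕ.* suc (suc n)) ⊗ (q ⊕ q′)))
      ≈⟨ S.*-congˡ (S.+-congˡ (S.*-congˡ (S.*-congʳ (split-* k (suc n))))) ⟩
    (𝟙 ⊕ ⊝ a) ⊗ (shanks (suc n) k ⊕ s ⊗ ((b ⊗ d) ⊗ (q ⊕ q′)))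
      ≈⟨ Sℤ.solve 7 (λ a t s b d q q′ → (con (+ 1) :- a) :* (t :+ s :* ((b :* d) :* (q :+ q′)))
           := (con (+ 1) :- a) :* t :+ (con (+ 1) :- a) :* (s :* ((b :* d) :* (q :+ q′)))) S.refl a _ s b d q q′ ⟩
    (𝟙 ⊕ ⊝ a) ⊗ shanks (suc n) k ⊕ (𝟙 ⊕ ⊝ a) ⊗ (s ⊗ ((b ⊗ d) ⊗ (q ⊕ q′)))
      ≈⟨ S.+-congʳ (shanks-step n k) ⟩
    ((𝟙 ⊕ a) ⊗ shanks n k ⊕ Sℤ.fromℕ 2 ⊗ (s ⊗ (b ⊗ q))) ⊕ (𝟙 ⊕ ⊝ a) ⊗ (s ⊗ ((b ⊗ d) ⊗ (q ⊕ q′)))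
      -- The last summand on the right isolates a multiple of the recurrence `Q-equation k`, so it
      -- vanishes in the next step.
      ≈⟨ Sℤ.solve 7 (λ a t s b d q q′ →
           ((con (+ 1) :+ a) :* t :+ con (+ 2) :* (s :* (b :* q))) :+ (con (+ 1) :- a) :* (s :* ((b :* d) :* (q :+ q′)))
           := (con (+ 1) :+ a) :* (t :+ s :* (b :* (q :+ q′))) :+ con (+ 2) :* ((:- s) :* ((b :* a) :* q′))
              :+ (con (+ 1) :- a) :* s :* b :* ((con (+ 1) :+ d) :* q :- (con (+ 1) :- d) :* q′)) S.refl a _ s b d q q′ ⟩
    ((𝟙 ⊕ a) ⊗ (shanks n k ⊕ s ⊗ (b ⊗ (q ⊕ q′))) ⊕ Sℤ.fromℕ 2 ⊗ (⊝ s ⊗ ((b ⊗ a) ⊗ q′)))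
      ⊕ (𝟙 ⊕ ⊝ a) ⊗ s ⊗ b ⊗ ((𝟙 ⊕ d) ⊗ q ⊕ ⊝ ((𝟙 ⊕ ⊝ d) ⊗ q′))
      ≈⟨ S.+-cong (S.+-congˡ (S.*-congˡ (S.*-congˡ (S.*-congʳ (S.trans (S.*-comm b a) (mono-⊗ (suc n) (suc k ℕ.* suc n)))))))
                  (S.trans (S.*-congˡ (S.trans (S.+-congʳ (S.sym (Q-equation k))) (S.-‿inverseʳ _))) (S.zeroʳ _)) ⟩
    _ ⊕ 𝟘
      ≈⟨ S.+-identityʳ _ ⟩
    (𝟙 ⊕ a) ⊗ shanks n (suc k) ⊕ Sℤ.fromℕ 2 ⊗ (⊝ s ⊗ (mono (suc (suc k) ℕ.* suc n) ⊗ q′)) ∎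
    where
    open import Relation.Binary.Reasoning.Setoid S.setoid
    a = mono (suc n)
    s = σ (suc k)
    b = mono (suc k ℕ.* suc n)
    d = mono (suc k)
    q = Q k
    q′ = Q (suc k)

  private
    -- Multiplication by a positive power of q pushes the lowest nonzero coefficient upwards, so
    -- only 0 can be fixed.
    fixed-zero : ∀ m f → f ≋ mono (suc m) ⊗ f → f ≋ 𝟘
    fixed-zero m f e = pointwise λ n → zeros n n ℕₚ.≤-refl
      where
      zeros : ∀ n → Truncated n f 𝟘
      zeros n       zero    i≤n = trans (at e 0) (mono-⊗-low {suc m} f (ℕ.s≤s ℕ.z≤n))
      zeros (suc n) (suc i) i≤n = trans (at e (suc i)) (trans (mono-suc-⊗ m f i) (trans (at (S.*-comm (mono m) f) i)
        (trans (truncated-⊗ (mono m) (zeros n) i (ℕ.s≤s⁻¹ i≤n)) (⊗-zeroˡ (mono m) i))))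

    cancel : ∀ m f g → (𝟙 ⊕ ⊝ mono (suc m)) ⊗ f ≋ (𝟙 ⊕ ⊝ mono (suc m)) ⊗ g → f ≋ g
    cancel m f g e = S.trans (Sℤ.solve 2 (λ f g → f := (f :- g) :+ g) S.refl f g)
      (S.trans (S.+-congʳ (fixed-zero m (f ⊕ ⊝ g) difference)) (S.+-identityˡ g))
      where
      difference : f ⊕ ⊝ g ≋ mono (suc m) ⊗ (f ⊕ ⊝ g)
      difference = S.trans
        (Sℤ.solve 3 (λ f g a → f :- g := a :* (f :- g) :+ ((con (+ 1) :- a) :* f :- (con (+ 1) :- a) :* g)) S.refl f g (mono (suc m)))
        (S.trans (S.+-congˡ (S.trans (S.+-congʳ e) (S.-‿inverseʳ _))) (S.+-identityʳ _))

  -- Multiplying by 1 - q^(n+1) lowers the product to Qₙ; the two new terms of the theta sum match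
  -- the boundary term of `shanks-step` with k = n, and what is left is the new last summand of
  -- `shanks`. The factor is then cancelled.
  shanks-identity : ∀ n → Q n ⊗ partial n ≋ shanks n n
  shanks-identity zero    = S.trans (S.*-cong Q-zero partial-zero) (S.*-identityˡ _)
  shanks-identity (suc n) = cancel n _ _ (begin
    (𝟙 ⊕ ⊝ a) ⊗ (Q (suc n) ⊗ partial (suc n))
      ≈⟨ S.sym (S.*-assoc _ _ _) ⟩
    (𝟙 ⊕ ⊝ a) ⊗ Q (suc n) ⊗ partial (suc n)
      ≈⟨ S.*-cong (Q-equation n) (partial-suc n) ⟩
    (𝟙 ⊕ a) ⊗ q ⊗ (partial n ⊕ Sℤ.fromℕ 2 ⊗ (s ⊗ b))
      ≈⟨ Sℤ.solve 5 (λ a q p s b → (con (+ 1) :+ a) :* q :* (p :+ con (+ 2) :* (s :* b))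
           := (con (+ 1) :+ a) :* (q :* p) :+ con (+ 2) :* (s :* (b :* q)) :+ con (+ 2) :* s :* b :* a :* q) S.refl a q _ s b ⟩
    ((𝟙 ⊕ a) ⊗ (q ⊗ partial n) ⊕ Sℤ.fromℕ 2 ⊗ (s ⊗ (b ⊗ q))) ⊕ Sℤ.fromℕ 2 ⊗ s ⊗ b ⊗ a ⊗ q
      ≈⟨ S.+-congʳ (S.trans (S.+-congʳ (S.*-congˡ (shanks-identity n))) (S.sym (shanks-step n n))) ⟩
    (𝟙 ⊕ ⊝ a) ⊗ shanks (suc n) n ⊕ Sℤ.fromℕ 2 ⊗ s ⊗ b ⊗ a ⊗ q
      ≈⟨ Sℤ.solve 6 (λ a t q q′ s b → (con (+ 1) :- a) :* t :+ con (+ 2) :* s :* b :* a :* q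
           := (con (+ 1) :- a) :* (t :+ s :* ((b :* a) :* (q :+ q′)))
              :+ s :* b :* a :* ((con (+ 1) :+ a) :* q :- (con (+ 1) :- a) :* q′)) S.refl a _ q q′ s b ⟩
    (𝟙 ⊕ ⊝ a) ⊗ (shanks (suc n) n ⊕ s ⊗ ((b ⊗ a) ⊗ (q ⊕ q′))) ⊕ s ⊗ b ⊗ a ⊗ ((𝟙 ⊕ a) ⊗ q ⊕ ⊝ ((𝟙 ⊕ ⊝ a) ⊗ q′))
      ≈⟨ S.+-cong (S.*-congˡ (S.+-congˡ (S.*-congˡ (S.*-congʳ (S.sym (split-* n (suc n)))))))
                  (S.trans (S.*-congˡ (S.trans (S.+-congʳ (S.sym (Q-equation n))) (S.-‿inverseʳ _))) (S.zeroʳ _)) ⟩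
    (𝟙 ⊕ ⊝ a) ⊗ shanks (suc n) (suc n) ⊕ 𝟘
      ≈⟨ S.+-identityʳ _ ⟩
    (𝟙 ⊕ ⊝ a) ⊗ shanks (suc n) (suc n) ∎)
    where
    open import Relation.Binary.Reasoning.Setoid S.setoid
    a = mono (suc n)
    s = σ (suc n)
    b = mono (suc n ℕ.* suc n)
    q = Q n
    q′ = Q (suc n)

  -- Each term after the initial 1 carries q^(j(n+1)) with j ≥ 1. So the finite identity says that
  -- the product of the two sides of Gauss's identity is 1 up to exponent n.
  shanks-truncated : ∀ n k → Truncated n (shanks n k) 𝟙
  shanks-truncated n zero    i i≤n = refl
  shanks-truncated n (suc k) i i≤n = trans (+-cong (shanks-truncated n k i i≤n)
    (trans (at (Sℤ.solve 3 (λ s m q → s :* (m :* q) := m :* (s :* q)) S.refl (σ (suc k)) (mono (suc k ℕ.* suc n)) _) i)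
      (mono-⊗-low _ (ℕₚ.<-≤-trans (ℕ.s≤s i≤n) (ℕₚ.m≤m+n (suc n) (k ℕ.* suc n)))))) (+-identityʳ _)

  P : Pow
  P = lift overpartition

  private
    Q-stable : ∀ n d → Truncated n (Q (d ℕ.+ n)) (Q n)
    Q-stable n zero    i i≤n = refl
    Q-stable n (suc d) i i≤n = trans (at (Q-suc (d ℕ.+ n)) i) (trans (at (S.*-comm (Q (d ℕ.+ n)) (fac (d ℕ.+ n))) i)
      (trans (truncated-⊗ {f′ = 𝟙} (Q (d ℕ.+ n)) fac≈𝟙 i i≤n)
        (trans (at (S.*-identityˡ _) i) (Q-stable n d i i≤n))))
      where
      fac≈𝟙 : Truncated n (fac (d ℕ.+ n)) 𝟙
      fac≈𝟙 zero    _   = refl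
      fac≈𝟙 (suc j) j≤n = reflexive (≡.cong fromℕ (factor-low (d ℕ.+ n) (ℕ.s≤s ℕ.z≤n) (ℕₚ.≤-trans j≤n (ℕₚ.m≤n+m n d))))

    P-truncated : ∀ n → Truncated n P (Q n)
    P-truncated n i i≤n = sym (trans (reflexive (≡.cong (λ m → Q m i) (≡.sym (ℕₚ.m∸n+n≡m i≤n))))
      (Q-stable i (n ℕ.∸ i) i ℕₚ.≤-refl))

  P⊗y : P ⊗ y ≋ 𝟙
  P⊗y = pointwise λ n → begin
    (P ⊗ y) n
      ≈⟨ truncated-⊗ y (λ i i≤n → P-truncated (suc n) i (ℕₚ.m≤n⇒m≤1+n i≤n)) n ℕₚ.≤-refl ⟩
    (Q (suc n) ⊗ y) n
      ≈⟨ at (S.*-comm (Q (suc n)) y) n ⟩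
    (y ⊗ Q (suc n)) n
      ≈⟨ truncated-⊗ (Q (suc n)) (Σℤ-truncated signed-bounded n) n ℕₚ.≤-refl ⟩
    (partial (suc n) ⊗ Q (suc n)) n
      ≈⟨ at (S.trans (S.*-comm _ _) (shanks-identity (suc n))) n ⟩
    shanks (suc n) (suc n) n
      ≈⟨ shanks-truncated (suc n) (suc n) n (ℕₚ.n≤1+n n) ⟩
    𝟙 n ∎
    where open import Relation.Binary.Reasoning.Setoid setoid

-- The arithmetic-geometric mean iteration

module MeanIteration {c ℓ} (R : CommutativeRing c ℓ) where
  open CommutativeRing R hiding (_+_; _*_; _-_; -_)
  open CommutativeRing R using () renaming (_*_ to _*ᴿ_)
  open ThetaSeries R
  open GaussIdentity R using (y; y-split)
  open Sℤ using (con; _:+_; _:*_; _:-_; :-_; _:=_; fromℕ)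
  open import Relation.Binary.Reasoning.Setoid S.setoid

  a b : Pow
  a = y ⊗ y
  b = x ⊗ x

  -- E² and O² are dilations of E² + O² and 2EO. Their sum is therefore a dilation of (E + O)², and
  -- their difference, used for `V-a`, of (E - O)².
  V-b : V 2 b ≋ E ⊗ E ⊕ O ⊗ O
  V-b = begin
    V 2 (x ⊗ x)                                   ≈⟨ V-cong 2 (S.*-cong x-split x-split) ⟩
    V 2 ((E ⊕ O) ⊗ (E ⊕ O))
      ≈⟨ V-cong 2 (Sℤ.solve 2 (λ e o → (e :+ o) :* (e :+ o) := (e :* e :+ o :* o) :+ (o :* e :+ e :* o)) S.refl E O) ⟩
    V 2 ((E ⊗ E ⊕ O ⊗ O) ⊕ (O ⊗ E ⊕ E ⊗ O))       ≈⟨ V-⊕ 2 _ _ ⟩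
    V 2 (E ⊗ E ⊕ O ⊗ O) ⊕ V 2 (O ⊗ E ⊕ E ⊗ O)     ≈⟨ S.+-cong E²-dilation O²-dilation ⟨
    E ⊗ E ⊕ O ⊗ O                                 ∎

  V-a : V 2 a ≋ y ⊗ x
  V-a = begin
    V 2 (y ⊗ y)                                   ≈⟨ V-cong 2 (S.*-cong y-split y-split) ⟩
    V 2 ((E ⊕ ⊝ O) ⊗ (E ⊕ ⊝ O))
      ≈⟨ V-cong 2 (Sℤ.solve 2 (λ e o → (e :+ :- o) :* (e :+ :- o) := (e :* e :+ o :* o) :+ :- (o :* e :+ e :* o)) S.refl E O) ⟩
    V 2 ((E ⊗ E ⊕ O ⊗ O) ⊕ ⊝ (O ⊗ E ⊕ E ⊗ O))     ≈⟨ S.trans (V-⊕ 2 _ _) (S.+-congˡ (V-⊝ 2 _)) ⟩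
    V 2 (E ⊗ E ⊕ O ⊗ O) ⊕ ⊝ V 2 (O ⊗ E ⊕ E ⊗ O)   ≈⟨ S.+-cong E²-dilation (S.-‿cong O²-dilation) ⟨
    E ⊗ E ⊕ ⊝ (O ⊗ O)
      ≈⟨ Sℤ.solve 2 (λ e o → e :* e :+ :- (o :* o) := (e :+ :- o) :* (e :+ o)) S.refl E O ⟩
    (E ⊕ ⊝ O) ⊗ (E ⊕ O)                           ≈⟨ S.*-cong y-split x-split ⟨
    y ⊗ x                                         ∎

  mean : fromℕ 2 ⊗ V 2 b ≋ a ⊕ b
  mean = begin
    fromℕ 2 ⊗ V 2 b                     ≈⟨ S.*-congˡ V-b ⟩
    fromℕ 2 ⊗ (E ⊗ E ⊕ O ⊗ O)
      ≈⟨ Sℤ.solve 2 (λ e o → con (+ 2) :* (e :* e :+ o :* o) :=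
           (e :+ :- o) :* (e :+ :- o) :+ (e :+ o) :* (e :+ o)) S.refl E O ⟩
    (E ⊕ ⊝ O) ⊗ (E ⊕ ⊝ O) ⊕ (E ⊕ O) ⊗ (E ⊕ O)
      ≈⟨ S.+-cong (S.*-cong y-split y-split) (S.*-cong x-split x-split) ⟨
    a ⊕ b                               ∎

  geometric : V 2 a ⊗ V 2 a ≋ a ⊗ b
  geometric = S.trans (S.*-cong V-a V-a)
    (Sℤ.solve 2 (λ y x → (y :* x) :* (y :* x) := (y :* y) :* (x :* x)) S.refl y x)

  difference : b ⊕ ⊝ a ≋ fromℕ 4 ⊗ (E ⊗ O)
  difference = S.trans (S.+-cong (S.*-cong x-split x-split) (S.-‿cong (S.*-cong y-split y-split)))
    (Sℤ.solve 2 (λ e o → (e :+ o) :* (e :+ o) :- (e :+ :- o) :* (e :+ :- o) := con (+ 4) :* (e :* o)) S.refl E O)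

  -- The factorisation (E - O)(E + O)(E² + O²) is the product of the geometric and the arithmetic
  -- mean of a and b, and ab is itself the square of a mean.
  quartic : (E ⊗ E) ⊗ (E ⊗ E) ⊕ ⊝ ((O ⊗ O) ⊗ (O ⊗ O)) ≋ V 2 (V 2 (a ⊗ a))
  quartic = begin
    (E ⊗ E) ⊗ (E ⊗ E) ⊕ ⊝ ((O ⊗ O) ⊗ (O ⊗ O))
      ≈⟨ Sℤ.solve 2 (λ e o → (e :* e) :* (e :* e) :- (o :* o) :* (o :* o) :=
           ((e :+ :- o) :* (e :+ o)) :* (e :* e :+ o :* o)) S.refl E O ⟩
    ((E ⊕ ⊝ O) ⊗ (E ⊕ O)) ⊗ (E ⊗ E ⊕ O ⊗ O)
      ≈⟨ S.*-cong (S.*-cong y-split x-split) V-b ⟨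
    (y ⊗ x) ⊗ V 2 b             ≈⟨ S.*-congʳ V-a ⟨
    V 2 a ⊗ V 2 b               ≈⟨ V-⊗ 2 a b ⟨
    V 2 (a ⊗ b)                 ≈⟨ V-cong 2 geometric ⟨
    V 2 (V 2 a ⊗ V 2 a)         ≈⟨ V-cong 2 (V-⊗ 2 a a) ⟨
    V 2 (V 2 (a ⊗ a))           ∎

  -- Under q ↦ q², W and −K/2 satisfy the same functional equation. It determines its solutions
  -- from their coefficients of 1 and q, so Z vanishes.
  module Wronskian (½ : Pow) (2½ : fromℕ 2 ⊗ ½ ≋ 𝟙) where

    -- `u` is defined so that b - a = 8Xu. Its constant coefficient is 1, because ψ starts with 2,
    -- from j = 0 and j = -1. Likewise Z = 8Xζ, and ζ has constant coefficient 0.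
    W K Z u ζ : Pow
    W = Θ a ⊗ b ⊕ ⊝ (a ⊗ Θ b)
    K = (b ⊗ b ⊕ ⊝ (a ⊗ a)) ⊗ (a ⊗ b)
    Z = fromℕ 2 ⊗ W ⊕ K
    u = ½ ⊗ (E ⊗ V 2 (V 2 (V 2 ψ)))
    ζ = fromℕ 2 ⊗ (Θ a ⊗ u ⊕ ⊝ (a ⊗ u) ⊕ ⊝ (a ⊗ Θ u)) ⊕ u ⊗ (b ⊕ a) ⊗ (a ⊗ b)

    private
      double-V-Θ : ∀ f → fromℕ 2 ⊗ V 2 (Θ f) ≋ Θ (V 2 f)
      double-V-Θ f = S.sym (Θ-V 2 f)

      2ΘVb : fromℕ 2 ⊗ Θ (V 2 b) ≋ Θ a ⊕ Θ b
      2ΘVb = begin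
        fromℕ 2 ⊗ Θ (V 2 b)
          ≈⟨ Sℤ.solve 2 (λ v t → con (+ 2) :* t := con (+ 0) :* v :+ con (+ 2) :* t) S.refl (V 2 b) (Θ (V 2 b)) ⟩
        fromℕ 0 ⊗ V 2 b ⊕ fromℕ 2 ⊗ Θ (V 2 b)   ≈⟨ S.+-congʳ (S.*-congʳ (Θ-fromℕ 2)) ⟨
        Θ (fromℕ 2) ⊗ V 2 b ⊕ fromℕ 2 ⊗ Θ (V 2 b) ≈⟨ Θ-⊗ (fromℕ 2) (V 2 b) ⟨
        Θ (fromℕ 2 ⊗ V 2 b)                     ≈⟨ Θ-cong mean ⟩
        Θ (a ⊕ b)                               ≈⟨ Θ-⊕ a b ⟩
        Θ a ⊕ Θ b                               ∎

      2VaΘVa : fromℕ 2 ⊗ (V 2 a ⊗ Θ (V 2 a)) ≋ Θ a ⊗ b ⊕ a ⊗ Θ b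
      2VaΘVa = begin
        fromℕ 2 ⊗ (V 2 a ⊗ Θ (V 2 a))
          ≈⟨ Sℤ.solve 2 (λ v t → con (+ 2) :* (v :* t) := t :* v :+ v :* t) S.refl (V 2 a) (Θ (V 2 a)) ⟩
        Θ (V 2 a) ⊗ V 2 a ⊕ V 2 a ⊗ Θ (V 2 a)   ≈⟨ Θ-⊗ (V 2 a) (V 2 a) ⟨
        Θ (V 2 a ⊗ V 2 a)                       ≈⟨ Θ-cong geometric ⟩
        Θ (a ⊗ b)                               ≈⟨ Θ-⊗ a b ⟩
        Θ a ⊗ b ⊕ a ⊗ Θ b                       ∎

      VW : V 2 W ≋ V 2 (Θ a) ⊗ V 2 b ⊕ ⊝ (V 2 a ⊗ V 2 (Θ b))
      VW = S.trans (V-⊕ 2 _ _) (S.+-cong (V-⊗ 2 (Θ a) b) (S.trans (V-⊝ 2 _) (S.-‿cong (V-⊗ 2 a (Θ b)))))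

      VK : V 2 K ≋ (V 2 b ⊗ V 2 b ⊕ ⊝ (V 2 a ⊗ V 2 a)) ⊗ (V 2 a ⊗ V 2 b)
      VK = S.trans (V-⊗ 2 _ _) (S.*-cong (S.trans (V-⊕ 2 _ _) (S.+-cong (V-⊗ 2 b b)
        (S.trans (V-⊝ 2 _) (S.-‿cong (V-⊗ 2 a a))))) (V-⊗ 2 a b))

      -- Differentiating both mean relations, with Θ(V f) = 2 V(Θ f), expresses V W through a, b and
      -- their derivatives; powers of 2 clear the denominators of the means.
      W-equation : fromℕ 8 ⊗ (V 2 a ⊗ V 2 W) ≋ (b ⊕ ⊝ a) ⊗ W
      W-equation = begin
        fromℕ 8 ⊗ (A ⊗ V 2 W)
          ≈⟨ S.*-congˡ (S.*-congˡ VW) ⟩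
        fromℕ 8 ⊗ (A ⊗ (V 2 (Θ a) ⊗ B ⊕ ⊝ (A ⊗ V 2 (Θ b))))
          ≈⟨ Sℤ.solve 4 (λ A B s t → con (+ 8) :* (A :* (s :* B :- A :* t)) :=
               (con (+ 2) :* (A :* (con (+ 2) :* s))) :* (con (+ 2) :* B) :- con (+ 2) :* ((A :* A) :* (con (+ 2) :* (con (+ 2) :* t)))) S.refl A B _ _ ⟩
        (fromℕ 2 ⊗ (A ⊗ (fromℕ 2 ⊗ V 2 (Θ a)))) ⊗ (fromℕ 2 ⊗ B) ⊕
          ⊝ (fromℕ 2 ⊗ ((A ⊗ A) ⊗ (fromℕ 2 ⊗ (fromℕ 2 ⊗ V 2 (Θ b)))))
          ≈⟨ S.+-cong (S.*-cong (S.trans (S.*-congˡ (S.*-congˡ (double-V-Θ a))) 2VaΘVa) mean)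
               (S.-‿cong (S.*-congˡ (S.*-cong geometric (S.trans (S.*-congˡ (double-V-Θ b)) 2ΘVb)))) ⟩
        (Θ a ⊗ b ⊕ a ⊗ Θ b) ⊗ (a ⊕ b) ⊕ ⊝ (fromℕ 2 ⊗ ((a ⊗ b) ⊗ (Θ a ⊕ Θ b)))
          ≈⟨ Sℤ.solve 4 (λ a b s t → (s :* b :+ a :* t) :* (a :+ b) :- con (+ 2) :* ((a :* b) :* (s :+ t)) :=
               (b :- a) :* (s :* b :- a :* t)) S.refl a b _ _ ⟩
        (b ⊕ ⊝ a) ⊗ W ∎
        where
        A = V 2 a
        B = V 2 b

      -- Four times the difference of the squared means is (a + b)² - 4ab = (b - a)².
      K-equation : fromℕ 8 ⊗ (V 2 a ⊗ V 2 K) ≋ (b ⊕ ⊝ a) ⊗ K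
      K-equation = begin
        fromℕ 8 ⊗ (A ⊗ V 2 K)
          ≈⟨ S.*-congˡ (S.*-congˡ VK) ⟩
        fromℕ 8 ⊗ (A ⊗ ((B ⊗ B ⊕ ⊝ (A ⊗ A)) ⊗ (A ⊗ B)))
          ≈⟨ Sℤ.solve 2 (λ A B → con (+ 8) :* (A :* ((B :* B :- A :* A) :* (A :* B))) :=
               (A :* A) :* (con (+ 2) :* B) :* ((con (+ 2) :* B) :* (con (+ 2) :* B) :- con (+ 4) :* (A :* A))) S.refl A B ⟩
        (A ⊗ A) ⊗ (fromℕ 2 ⊗ B) ⊗ ((fromℕ 2 ⊗ B) ⊗ (fromℕ 2 ⊗ B) ⊕ ⊝ (fromℕ 4 ⊗ (A ⊗ A)))
          ≈⟨ S.*-cong (S.*-cong geometric mean) (S.+-cong (S.*-cong mean mean) (S.-‿cong (S.*-congˡ geometric))) ⟩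
        (a ⊗ b) ⊗ (a ⊕ b) ⊗ ((a ⊕ b) ⊗ (a ⊕ b) ⊕ ⊝ (fromℕ 4 ⊗ (a ⊗ b)))
          ≈⟨ Sℤ.solve 2 (λ a b → (a :* b) :* (a :+ b) :* ((a :+ b) :* (a :+ b) :- con (+ 4) :* (a :* b)) :=
               (b :- a) :* ((b :* b :- a :* a) :* (a :* b))) S.refl a b ⟩
        (b ⊕ ⊝ a) ⊗ K ∎
        where
        A = V 2 a
        B = V 2 b

      Z-equation : fromℕ 8 ⊗ (V 2 a ⊗ V 2 Z) ≋ (b ⊕ ⊝ a) ⊗ Z
      Z-equation = begin
        fromℕ 8 ⊗ (V 2 a ⊗ V 2 Z)
          ≈⟨ S.*-congˡ (S.*-congˡ (S.trans (V-⊕ 2 _ _) (S.+-congʳ (S.trans (V-⊗ 2 _ _) (S.*-congʳ (V-fromℕ 2 2)))))) ⟩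
        fromℕ 8 ⊗ (V 2 a ⊗ (fromℕ 2 ⊗ V 2 W ⊕ V 2 K))
          ≈⟨ Sℤ.solve 3 (λ A w k → con (+ 8) :* (A :* (con (+ 2) :* w :+ k)) :=
               con (+ 2) :* (con (+ 8) :* (A :* w)) :+ con (+ 8) :* (A :* k)) S.refl (V 2 a) _ _ ⟩
        fromℕ 2 ⊗ (fromℕ 8 ⊗ (V 2 a ⊗ V 2 W)) ⊕ fromℕ 8 ⊗ (V 2 a ⊗ V 2 K)
          ≈⟨ S.+-cong (S.*-congˡ W-equation) K-equation ⟩
        fromℕ 2 ⊗ ((b ⊕ ⊝ a) ⊗ W) ⊕ (b ⊕ ⊝ a) ⊗ K
          ≈⟨ Sℤ.solve 3 (λ d w k → con (+ 2) :* (d :* w) :+ d :* k := d :* (con (+ 2) :* w :+ k)) S.refl (b ⊕ ⊝ a) W K ⟩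
        (b ⊕ ⊝ a) ⊗ Z ∎

      b-a : b ⊕ ⊝ a ≋ fromℕ 8 ⊗ (X ⊗ u)
      b-a = begin
        b ⊕ ⊝ a                         ≈⟨ difference ⟩
        fromℕ 4 ⊗ (E ⊗ O)               ≈⟨ S.*-congˡ (S.*-congˡ O-dilation) ⟩
        fromℕ 4 ⊗ (E ⊗ (X ⊗ g))
          ≈⟨ S.*-congˡ (S.*-identityˡ _) ⟨
        fromℕ 4 ⊗ (𝟙 ⊗ (E ⊗ (X ⊗ g)))   ≈⟨ S.*-congˡ (S.*-congʳ 2½) ⟨
        fromℕ 4 ⊗ ((fromℕ 2 ⊗ ½) ⊗ (E ⊗ (X ⊗ g)))
          ≈⟨ Sℤ.solve 4 (λ h e q g → con (+ 4) :* ((con (+ 2) :* h) :* (e :* (q :* g))) :=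
               con (+ 8) :* (q :* (h :* (e :* g)))) S.refl ½ E X g ⟩
        fromℕ 8 ⊗ (X ⊗ u)               ∎
        where g = V 2 (V 2 (V 2 ψ))

      cancel-8 : ∀ f g → fromℕ 8 ⊗ f ≋ fromℕ 8 ⊗ g → f ≋ g
      cancel-8 f g e = begin
        f                                     ≈⟨ unit f ⟩
        ½ ⊗ ½ ⊗ ½ ⊗ (fromℕ 8 ⊗ f)             ≈⟨ S.*-congˡ e ⟩
        ½ ⊗ ½ ⊗ ½ ⊗ (fromℕ 8 ⊗ g)             ≈⟨ unit g ⟨
        g                                     ∎
        where
        unit : ∀ f → f ≋ ½ ⊗ ½ ⊗ ½ ⊗ (fromℕ 8 ⊗ f)
        unit f = begin
          f ≈⟨ S.trans (S.*-identityˡ _) (S.trans (S.*-congʳ (S.*-identityˡ _)) (S.*-identityˡ f)) ⟨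
          𝟙 ⊗ (𝟙 ⊗ 𝟙 ⊗ f) ≈⟨ S.*-cong 2½ (S.*-congʳ (S.*-cong 2½ 2½)) ⟨
          (fromℕ 2 ⊗ ½) ⊗ ((fromℕ 2 ⊗ ½) ⊗ (fromℕ 2 ⊗ ½) ⊗ f)
            ≈⟨ Sℤ.solve 2 (λ h f → (con (+ 2) :* h) :* ((con (+ 2) :* h) :* (con (+ 2) :* h) :* f) := h :* h :* h :* (con (+ 8) :* f)) S.refl ½ f ⟩
          ½ ⊗ ½ ⊗ ½ ⊗ (fromℕ 8 ⊗ f) ∎

      -- The left side doubles the exponents of Z, the right side shifts them by 1, so for n ≥ 2 the
      -- coefficient Zₙ is determined by earlier ones. With Z₀ = 0 the case n = 1 only says Z₁ = Z₁,
      -- so Z₁ has to be computed.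
      Z-recursion : V 2 Z ⊗ V 2 a ≋ X ⊗ (Z ⊗ u)
      Z-recursion = cancel-8 _ _ (begin
        fromℕ 8 ⊗ (V 2 Z ⊗ V 2 a)     ≈⟨ S.*-congˡ (S.*-comm _ _) ⟩
        fromℕ 8 ⊗ (V 2 a ⊗ V 2 Z)     ≈⟨ S.trans Z-equation (S.*-congʳ b-a) ⟩
        fromℕ 8 ⊗ (X ⊗ u) ⊗ Z         ≈⟨ Sℤ.solve 3 (λ q u z → con (+ 8) :* (q :* u) :* z := con (+ 8) :* (q :* (z :* u))) S.refl X u Z ⟩
        fromℕ 8 ⊗ (X ⊗ (Z ⊗ u))       ∎)

      ΘX : Θ X ≋ X
      ΘX = pointwise λ where
        zero          → zeroˡ _
        (suc zero)    → *-identityˡ _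
        (suc (suc n)) → zeroʳ _

      -- Substituting b = a + 8Xu cancels all terms without X, which exposes the first two
      -- coefficients of Z.
      Z-factor : Z ≋ fromℕ 8 ⊗ (X ⊗ ζ)
      Z-factor = begin
        fromℕ 2 ⊗ (Θ a ⊗ b ⊕ ⊝ (a ⊗ Θ b)) ⊕ K
          ≈⟨ S.+-cong (S.*-congˡ (S.+-cong (S.*-congˡ b≋) (S.-‿cong (S.*-congˡ Θb≋))))
               (Sℤ.solve 2 (λ a b → (b :* b :- a :* a) :* (a :* b) := (b :- a) :* (b :+ a) :* (a :* b)) S.refl a b) ⟩
        fromℕ 2 ⊗ (Θ a ⊗ (a ⊕ fromℕ 8 ⊗ (X ⊗ u)) ⊕ ⊝ (a ⊗ (Θ a ⊕ fromℕ 8 ⊗ (X ⊗ u ⊕ X ⊗ Θ u)))) ⊕ (b ⊕ ⊝ a) ⊗ (b ⊕ a) ⊗ (a ⊗ b)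
          ≈⟨ S.+-congˡ (S.*-congʳ (S.*-congʳ b-a)) ⟩
        fromℕ 2 ⊗ (Θ a ⊗ (a ⊕ fromℕ 8 ⊗ (X ⊗ u)) ⊕ ⊝ (a ⊗ (Θ a ⊕ fromℕ 8 ⊗ (X ⊗ u ⊕ X ⊗ Θ u)))) ⊕ fromℕ 8 ⊗ (X ⊗ u) ⊗ (b ⊕ a) ⊗ (a ⊗ b)
          ≈⟨ Sℤ.solve 6 (λ a b s u v q →
               con (+ 2) :* (s :* (a :+ con (+ 8) :* (q :* u)) :- a :* (s :+ con (+ 8) :* (q :* u :+ q :* v))) :+ con (+ 8) :* (q :* u) :* (b :+ a) :* (a :* b)
               := con (+ 8) :* (q :* (con (+ 2) :* (s :* u :- a :* u :- a :* v) :+ u :* (b :+ a) :* (a :* b)))) S.refl a b (Θ a) u (Θ u) X ⟩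
        fromℕ 8 ⊗ (X ⊗ ζ) ∎
        where
        b≋ : b ≋ a ⊕ fromℕ 8 ⊗ (X ⊗ u)
        b≋ = S.trans (Sℤ.solve 2 (λ a b → b := a :+ (b :- a)) S.refl a b) (S.+-congˡ b-a)

        Θb≋ : Θ b ≋ Θ a ⊕ fromℕ 8 ⊗ (X ⊗ u ⊕ X ⊗ Θ u)
        Θb≋ = begin
          Θ b                                     ≈⟨ S.trans (Θ-cong b≋) (Θ-⊕ a _) ⟩
          Θ a ⊕ Θ (fromℕ 8 ⊗ (X ⊗ u))             ≈⟨ S.+-congˡ (Θ-⊗ (fromℕ 8) (X ⊗ u)) ⟩
          Θ a ⊕ (Θ (fromℕ 8) ⊗ (X ⊗ u) ⊕ fromℕ 8 ⊗ Θ (X ⊗ u))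
            ≈⟨ S.+-congˡ (S.+-cong (S.trans (S.*-congʳ (Θ-fromℕ 8)) (S.zeroˡ _))
                 (S.*-congˡ (S.trans (Θ-⊗ X u) (S.+-congʳ (S.*-congʳ ΘX))))) ⟩
          Θ a ⊕ (𝟘 ⊕ fromℕ 8 ⊗ (X ⊗ u ⊕ X ⊗ Θ u)) ≈⟨ S.+-congˡ (S.+-identityˡ _) ⟩
          Θ a ⊕ fromℕ 8 ⊗ (X ⊗ u ⊕ X ⊗ Θ u)       ∎

    private
      open module ℤᴿ = IntegerCoefficients R using () renaming (solve to solveᴿ; con to conᴿ; _:+_ to _:+ᴿ_; _:*_ to _:*ᴿ_; _:-_ to _:-ᴿ_; _:=_ to _:=ᴿ_; :-_ to :-ᴿ_)

    x₀ : x 0 ≈ 1#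
    x₀ = trans (+-identityˡ _) (trans (+-congˡ (+-identityˡ _)) (+-identityʳ _))

    E₀ : E 0 ≈ 1#
    E₀ = trans (at E-dilation 0) x₀

    O₀ : O 0 ≈ 0#
    O₀ = trans (at O-dilation 0) (X⊗-zero (V 2 (V 2 (V 2 ψ))))

    a₀ : a 0 ≈ 1#
    a₀ = trans (*-cong y₀ y₀) (*-identityˡ _)
      where
      y₀ : y 0 ≈ 1#
      y₀ = trans (at y-split 0) (trans (+-cong E₀ (-‿cong O₀)) (solveᴿ 0 (conᴿ (+ 1) :-ᴿ conᴿ (+ 0) :=ᴿ conᴿ (+ 1)) refl))

    b₀ : b 0 ≈ 1#
    b₀ = trans (*-cong x₀ x₀) (*-identityˡ _)

    V-low : ∀ i f → (∀ k → k ℕ.+ k ≤ i → f k ≈ 0#) → V 2 f i ≈ 0#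
    V-low zero          f low = low 0 ℕ.z≤n
    V-low (suc zero)    f low = refl
    V-low (suc (suc i)) f low = V-low i (tl f) (λ k le → low (suc k)
      (≡.subst (_≤ suc (suc i)) (≡.cong suc (≡.sym (ℕₚ.+-suc k k))) (ℕ.s≤s (ℕ.s≤s le))))

    private
      u₀ : u 0 ≈ 1#
      u₀ = trans (*-congˡ (*-cong E₀ (+-congˡ (trans (+-congˡ (+-identityˡ _)) (+-identityʳ _)))))
        (trans (solveᴿ 1 (λ h → h :*ᴿ (conᴿ (+ 1) :*ᴿ conᴿ (+ 2)) :=ᴿ conᴿ (+ 2) :*ᴿ h) refl (½ 0)) (at 2½ 0))

      ζ₀ : ζ 0 ≈ 0#
      ζ₀ = trans (+-cong (*-congˡ (+-cong (+-cong (*-cong (zeroˡ _) u₀) (-‿cong (*-cong a₀ u₀))) (-‿cong (*-cong a₀ (zeroˡ _)))))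
                         (*-cong (*-cong u₀ (+-cong b₀ a₀)) (*-cong a₀ b₀)))
             (solveᴿ 0 (conᴿ (+ 2) :*ᴿ (conᴿ (+ 0) :*ᴿ conᴿ (+ 1) :+ᴿ :-ᴿ (conᴿ (+ 1) :*ᴿ conᴿ (+ 1)) :+ᴿ :-ᴿ (conᴿ (+ 1) :*ᴿ conᴿ (+ 0)))
                :+ᴿ conᴿ (+ 1) :*ᴿ (conᴿ (+ 1) :+ᴿ conᴿ (+ 1)) :*ᴿ (conᴿ (+ 1) :*ᴿ conᴿ (+ 1)) :=ᴿ conᴿ (+ 0)) refl)

      Z₀ : Z 0 ≈ 0#
      Z₀ = trans (at Z-factor 0) (trans (*-congˡ (X⊗-zero ζ)) (zeroʳ _))

      Z₁ : Z 1 ≈ 0#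
      Z₁ = trans (at Z-factor 1) (trans (fromℕ-⊗ 8 (X ⊗ ζ) 1) (trans (*-congˡ (trans (X⊗-suc ζ 0) ζ₀)) (zeroʳ _)))

      ⊗-leading : ∀ n f g → (∀ i → i < n → f i ≈ 0#) → (f ⊗ g) n ≈ f n *ᴿ g 0
      ⊗-leading zero    f g low = refl
      ⊗-leading (suc n) f g low =
        trans (+-cong (trans (*-congʳ (low 0 (ℕ.s≤s ℕ.z≤n))) (zeroˡ _)) (⊗-leading n (tl f) g (λ i i<n → low (suc i) (ℕ.s≤s i<n))))
          (+-identityˡ _)

      Z-below : ∀ n i → i < n → Z i ≈ 0#
      Z-below (suc n)             zero          _   = Z₀
      Z-below (suc n)             (suc zero)    _   = Z₁
      -- As Z vanishes below m, the coefficient of Zu at m is Zₘ u₀ = Zₘ. By the recursion it is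
      -- also the coefficient of V(Z) V(a) at m + 1, which involves only Zₖ with 2k ≤ m + 1, hence k
      -- < m.
      Z-below (suc n)             (suc (suc i)) i<n = trans (sym (*-identityʳ _)) (trans (sym (*-congˡ u₀))
        (trans (sym (⊗-leading m Z u (λ j j<m → Z-below n j (ℕₚ.<-≤-trans j<m (ℕ.s≤s⁻¹ i<n)))))
          (trans (sym (X⊗-suc (Z ⊗ u) m)) (trans (sym (at Z-recursion (suc m)))
            (trans (truncated-⊗ {f′ = 𝟘} (V 2 a) V-zero (suc m) ℕₚ.≤-refl) (⊗-zeroˡ (V 2 a) (suc m)))))))
        where
        m = suc (suc i)
        V-zero : Truncated (suc m) (V 2 Z) 𝟘
        V-zero j j≤ = V-low j Z λ k 2k≤j → Z-below n k (ℕₚ.<-≤-trans (half k (ℕₚ.≤-trans 2k≤j j≤)) (ℕ.s≤s⁻¹ i<n))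
          where
          half : ∀ k → k ℕ.+ k ≤ suc (suc (suc i)) → k < suc (suc i)
          half k le with ℕₚ.≤-<-connex (suc (suc i)) k
          ... | inj₂ lt = lt
          ... | inj₁ ge = contradiction (ℕₚ.≤-trans (ℕₚ.+-mono-≤ ge ge) le)
                  (ℕₚ.<⇒≱ (≡.subst (suc (suc (suc i)) <_) (≡.cong suc (≡.cong suc (≡.sym (ℕₚ.+-suc i (suc i))))) (ℕ.s≤s (ℕ.s≤s (ℕ.s≤s (ℕₚ.m≤n+m (suc i) i))))))

    wronskian : fromℕ 2 ⊗ W ⊕ K ≋ 𝟘
    wronskian = pointwise λ n → Z-below (suc n) n (ℕₚ.n<1+n n)

-- Polynomial identities modulo p

module ModularCoefficients {c ℓ} (R : CommutativeRing c ℓ) (p-1 : ℕ)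
  (char : CommutativeRing._≈_ R (IntegerCoefficients.fromℕ R (suc p-1)) (CommutativeRing.0# R)) where
  open CommutativeRing R
  open IntegerCoefficients R using (fromℕ)
  open Characteristic R using (fromℕ-∣)
  open import Algebra.Properties.Group +-group using (inverseˡ-unique)
  open import Algebra.Properties.Semiring.Mult.TCOptimised semiring using (×-homo-+; ×1-homo-*; 1+×)
  open import Algebra.Properties.Ring ring using (-1*x≈-x)
  open import Relation.Binary.Reasoning.Setoid setoid

  private
    p = suc p-1

    fromℕ-% : ∀ n → fromℕ (n % p) ≈ fromℕ n
    fromℕ-% n = begin
      fromℕ (n % p)                        ≈⟨ +-identityʳ _ ⟨
      fromℕ (n % p) + 0#                   ≈⟨ +-congˡ (fromℕ-∣ char {n / p ℕ.* p} (divides (n / p) ≡.refl)) ⟨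
      fromℕ (n % p) + fromℕ (n / p ℕ.* p)  ≈⟨ ×-homo-+ 1# (n % p) (n / p ℕ.* p) ⟨
      fromℕ (n % p ℕ.+ n / p ℕ.* p)        ≡⟨ ≡.cong fromℕ (m≡m%n+[m/n]*n n p) ⟨
      fromℕ n                              ∎

    fromℕ-p-1 : fromℕ p-1 ≈ - 1#
    fromℕ-p-1 = inverseˡ-unique (fromℕ p-1) 1# (trans (+-comm _ _) (trans (sym (1+× p-1 1#)) char))

    -- Coefficients of normal forms are kept as residues below p, so identities that hold only
    -- modulo p are decided by computing both sides.
    ℕ%-rawRing : RawRing _ _
    ℕ%-rawRing = record
      { Carrier = ℕ
      ; _≈_ = _≡_
      ; _+_ = λ m n → (m ℕ.+ n) % p
      ; _*_ = λ m n → (m ℕ.* n) % p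
      ; -_  = λ m → (p-1 ℕ.* m) % p
      ; 0#  = 0
      ; 1#  = 1
      }

    homomorphism : ℕ%-rawRing -Raw-AlmostCommutative⟶ fromCommutativeRing R
    homomorphism = record
      { ⟦_⟧    = fromℕ
      ; +-homo = λ m n → trans (fromℕ-% (m ℕ.+ n)) (×-homo-+ 1# m n)
      ; *-homo = λ m n → trans (fromℕ-% (m ℕ.* n)) (×1-homo-* m n)
      ; -‿homo = λ m → trans (fromℕ-% (p-1 ℕ.* m)) (trans (×1-homo-* p-1 m) (trans (*-congʳ fromℕ-p-1) (-1*x≈-x (fromℕ m))))
      ; 0-homo = refl
      ; 1-homo = refl
      }

    ≟-weakly : WeaklyDecidable (Induced-equivalence homomorphism)
    ≟-weakly m n with m ℕ.≟ n
    ... | yes ≡.refl = just refl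
    ... | no _       = nothing

  open import Algebra.Solver.Ring ℕ%-rawRing (fromCommutativeRing R) homomorphism ≟-weakly public
    using (Polynomial; con; _:+_; _:*_; _:-_; :-_; _:^_; _:=_; solve)

infixl 6 _⊞_
_⊞_ : List ℕ → List ℕ → List ℕ
[]       ⊞ ds       = ds
(c ∷ cs) ⊞ []       = c ∷ cs
(c ∷ cs) ⊞ (d ∷ ds) = c ℕ.+ d ∷ cs ⊞ ds

derivative : List ℕ → List ℕ
derivative []       = []
derivative (c ∷ cs) = cs ⊞ (0 ∷ derivative cs)

-- Lists are polynomials with the constant coefficient first.
module Evaluation {c ℓ} (R : CommutativeRing c ℓ) where
  open CommutativeRing R
  open IntegerCoefficients R using (fromℕ)
  open import Algebra.Properties.Semiring.Exp semiring using (_^_)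

  ev : List ℕ → Carrier → Carrier
  ev []       x = 0#
  ev (c ∷ cs) x = fromℕ c + x * ev cs x

  -- ∑ cᵢ x^(d−i) y^i, where d + 1 is the length of the list
  hom : List ℕ → Carrier → Carrier → Carrier
  hom []       x y = 0#
  hom (c ∷ cs) x y = fromℕ c * x ^ length cs + y * hom cs x y

  open import Algebra.Properties.Semiring.Exp semiring using (^-congˡ)
  open import Algebra.Properties.Semiring.Mult.TCOptimised semiring using (×-homo-+)
  open Characteristic R using (1^)
  open import Algebra.Properties.CommutativeSemiring.Exp commutativeSemiring using (^-distrib-*)
  open import Relation.Binary.Reasoning.Setoid setoid
  private open module ℤᴿ = IntegerCoefficients R using (_:+_; _:*_; _:=_) renaming (solve to solveℤ)

  ev-⊞ : ∀ cs ds x → ev (cs ⊞ ds) x ≈ ev cs x + ev ds x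
  ev-⊞ []       ds       x = sym (+-identityˡ _)
  ev-⊞ (c ∷ cs) []       x = sym (+-identityʳ _)
  ev-⊞ (c ∷ cs) (d ∷ ds) x = trans (+-cong (×-homo-+ 1# c d) (*-congˡ (ev-⊞ cs ds x)))
    (solveℤ 5 (λ c d x v w → (c :+ d) :+ x :* (v :+ w) := (c :+ x :* v) :+ (d :+ x :* w)) refl (fromℕ c) (fromℕ d) x _ _)

  ev-derivative : ∀ c cs x → ev (derivative (c ∷ cs)) x ≈ ev cs x + x * ev (derivative cs) x
  ev-derivative c cs x = trans (ev-⊞ cs (0 ∷ derivative cs) x) (+-congˡ (+-identityˡ _))

  ev-cong : ∀ cs {x y} → x ≈ y → ev cs x ≈ ev cs y
  ev-cong []       e = refl
  ev-cong (c ∷ cs) e = +-congˡ (*-cong e (ev-cong cs e))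

  hom-cong : ∀ cs {x x′ y y′} → x ≈ x′ → y ≈ y′ → hom cs x y ≈ hom cs x′ y′
  hom-cong []       e e′ = refl
  hom-cong (c ∷ cs) e e′ = +-cong (*-congˡ (^-congˡ (length cs) e)) (*-cong e′ (hom-cong cs e e′))

  hom-1 : ∀ cs y → hom cs 1# y ≈ ev cs y
  hom-1 []       y = refl
  hom-1 (c ∷ cs) y = +-cong (trans (*-congˡ (1^ (length cs))) (*-identityʳ _)) (*-congˡ (hom-1 cs y))

  hom-scale : ∀ k c cs x y → hom (c ∷ cs) (k * x) (k * y) ≈ k ^ length cs * hom (c ∷ cs) x y
  hom-scale k c cs x y = begin
    fromℕ c * (k * x) ^ length cs + k * y * hom cs (k * x) (k * y)
      ≈⟨ +-cong (*-congˡ (^-distrib-* k x (length cs)))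
           (trans (solveℤ 3 (λ k y z → k :* y :* z := y :* (k :* z)) refl k y _) (*-congˡ (suc-degree cs))) ⟩
    fromℕ c * (k ^ length cs * x ^ length cs) + y * (k ^ length cs * hom cs x y)
      ≈⟨ solveℤ 5 (λ c k x y z → c :* (k :* x) :+ y :* (k :* z) := k :* (c :* x :+ y :* z)) refl (fromℕ c) (k ^ length cs) (x ^ length cs) y _ ⟩
    k ^ length cs * hom (c ∷ cs) x y ∎
    where
    suc-degree : ∀ cs → k * hom cs (k * x) (k * y) ≈ k ^ length cs * hom cs x y
    suc-degree []       = trans (zeroʳ k) (sym (zeroʳ _))
    suc-degree (c ∷ cs) = trans (*-congˡ (hom-scale k c cs x y)) (sym (*-assoc _ _ _))

module PolynomialEvaluation {c ℓ} (R : CommutativeRing c ℓ) (p-1 : ℕ)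
  (char : CommutativeRing._≈_ R (IntegerCoefficients.fromℕ R (suc p-1)) (CommutativeRing.0# R)) where
  open ModularCoefficients R p-1 char public

  evₚ : ∀ {m} → List ℕ → Polynomial m → Polynomial m
  evₚ []       x = con 0
  evₚ (c ∷ cs) x = con c :+ x :* evₚ cs x

  homₚ : ∀ {m} → List ℕ → Polynomial m → Polynomial m → Polynomial m
  homₚ []       x y = con 0
  homₚ (c ∷ cs) x y = con c :* x :^ length cs :+ y :* homₚ cs x y

-- Dissection modulo 4

module Dissection {c ℓ} (R : CommutativeRing c ℓ) where
  open CommutativeRing R hiding (_+_; _*_; _-_; -_)
  open ThetaSeries R
  open MeanIteration R
  open Sℤ using (con; _:+_; _:*_; _:-_; :-_; _:=_; fromℕ)
  open Evaluation series
  open import Relation.Binary.Reasoning.Setoid S.setoid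

  V-hom : ∀ m cs f g → V m (hom cs f g) ≋ hom cs (V m f) (V m g)
  V-hom m []       f g = pointwise (spread-𝟘 (ℕ.pred m) 0)
  V-hom m (c ∷ cs) f g = S.trans (V-⊕ m _ _) (S.+-cong
    (S.trans (V-⊗ m _ _) (S.*-cong (V-fromℕ m c) (V-^ m f (length cs))))
    (S.trans (V-⊗ m _ _) (S.*-congˡ (V-hom m cs f g))))

  -- A polynomial in x and x⁴ − y⁴: substituting q⁴ for q turns x into E and x⁴ − y⁴ into O⁴.
  cell : ℕ → List ℕ → Pow
  cell r cs = x ⊗^ r ⊗ hom cs (b ⊗ b) (b ⊗ b ⊕ ⊝ (a ⊗ a))

  dilatedCell : ℕ → List ℕ → Pow
  dilatedCell r cs = E ⊗^ r ⊗ hom cs ((E ⊗ E) ⊗ (E ⊗ E)) ((O ⊗ O) ⊗ (O ⊗ O))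

  VV-cell : ∀ r cs → V 2 (V 2 (cell r cs)) ≋ dilatedCell r cs
  VV-cell r cs = begin
    V 2 (V 2 (x ⊗^ r ⊗ hom cs (b ⊗ b) D))
      ≈⟨ S.trans (V-cong 2 (V-⊗ 2 _ _)) (V-⊗ 2 _ _) ⟩
    V 2 (V 2 (x ⊗^ r)) ⊗ V 2 (V 2 (hom cs (b ⊗ b) D))
      ≈⟨ S.*-cong (S.trans (V-cong 2 (V-^ 2 x r)) (V-^ 2 (V 2 x) r)) (S.trans (V-cong 2 (V-hom 2 cs _ _)) (V-hom 2 cs _ _)) ⟩
    V 2 (V 2 x) ⊗^ r ⊗ hom cs (V 2 (V 2 (b ⊗ b))) (V 2 (V 2 D))
      ≈⟨ S.*-cong (^-congˡ r (S.sym E-dilation)) (hom-cong cs b² d) ⟩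
    dilatedCell r cs ∎
    where
    open import Algebra.Properties.Semiring.Exp S.semiring using (^-congˡ)
    D = b ⊗ b ⊕ ⊝ (a ⊗ a)
    E⁴ = (E ⊗ E) ⊗ (E ⊗ E)
    O⁴ = (O ⊗ O) ⊗ (O ⊗ O)

    VV-⊗ : ∀ f g → V 2 (V 2 (f ⊗ g)) ≋ V 2 (V 2 f) ⊗ V 2 (V 2 g)
    VV-⊗ f g = S.trans (V-cong 2 (V-⊗ 2 f g)) (V-⊗ 2 _ _)

    VV-b : V 2 (V 2 b) ≋ E ⊗ E
    VV-b = S.trans (VV-⊗ x x) (S.*-cong (S.sym E-dilation) (S.sym E-dilation))

    b² : V 2 (V 2 (b ⊗ b)) ≋ E⁴
    b² = S.trans (VV-⊗ b b) (S.*-cong VV-b VV-b)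

    d : V 2 (V 2 D) ≋ O⁴
    d = begin
      V 2 (V 2 (b ⊗ b ⊕ ⊝ (a ⊗ a)))             ≈⟨ S.trans (V-cong 2 (V-⊕ 2 _ _)) (V-⊕ 2 _ _) ⟩
      V 2 (V 2 (b ⊗ b)) ⊕ V 2 (V 2 (⊝ (a ⊗ a))) ≈⟨ S.+-cong b² (S.trans (V-cong 2 (V-⊝ 2 _)) (V-⊝ 2 _)) ⟩
      E⁴ ⊕ ⊝ V 2 (V 2 (a ⊗ a))                  ≈⟨ S.+-congˡ (S.-‿cong quartic) ⟨
      E⁴ ⊕ ⊝ (E⁴ ⊕ ⊝ O⁴)                        ≈⟨ Sℤ.solve 2 (λ e o → e :- (e :- o) := o) S.refl E⁴ O⁴ ⟩
      O⁴                                        ∎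

  U-odd-𝟙 : U 2 1 𝟙 ≋ 𝟘
  U-odd-𝟙 = pointwise λ where
    zero    → refl
    (suc n) → refl

  U-even-𝟙 : U 2 0 𝟙 ≋ 𝟙
  U-even-𝟙 = pointwise λ where
    zero    → refl
    (suc n) → refl

  U-even-X : U 2 0 X ≋ 𝟘
  U-even-X = pointwise λ where
    zero    → refl
    (suc n) → refl

  U-odd-X : U 2 1 X ≋ 𝟙
  U-odd-X = pointwise λ where
    zero    → refl
    (suc n) → refl

  private
    0<2 : 0 ℕ.< 2
    0<2 = ℕ.s≤s ℕ.z≤n
    1<2 : 1 ℕ.< 2
    1<2 = ℕ.s≤s (ℕ.s≤s ℕ.z≤n)

  U-even-V : ∀ f → U 2 0 (V 2 f) ≋ f
  U-even-V f = S.trans (U-cong 2 0 (S.sym (S.*-identityʳ (V 2 f))))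
    (S.trans (U-V⊗ 2 0 f 𝟙 0<2) (S.trans (S.*-congˡ U-even-𝟙) (S.*-identityʳ f)))

  U-odd-V : ∀ f → U 2 1 (V 2 f) ≋ 𝟘
  U-odd-V f = S.trans (U-cong 2 1 (S.sym (S.*-identityʳ (V 2 f))))
    (S.trans (U-V⊗ 2 1 f 𝟙 1<2) (S.trans (S.*-congˡ U-odd-𝟙) (S.zeroʳ f)))

  U-even-VX : ∀ f → U 2 0 (V 2 f ⊗ X) ≋ 𝟘
  U-even-VX f = S.trans (U-V⊗ 2 0 f X 0<2) (S.trans (S.*-congˡ U-even-X) (S.zeroʳ f))

  U-odd-VX : ∀ f → U 2 1 (V 2 f ⊗ X) ≋ f
  U-odd-VX f = S.trans (U-V⊗ 2 1 f X 1<2) (S.trans (S.*-congˡ U-odd-X) (S.*-identityʳ f))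

  -- `O` is X times this series evaluated at X⁴. So Oʲ lies in the class j modulo 4, and extracting
  -- that class below leaves the j-th power of `g` as a factor.
  g : Pow
  g = V 2 ψ

  module _ {F f₀ f₁ f₂ f₃}
    (dissected : F ≋ V 2 (V 2 f₀) ⊕ V 2 (V 2 f₁) ⊗ O ⊕ V 2 (V 2 f₂) ⊗ (O ⊗ O) ⊕ V 2 (V 2 f₃) ⊗ (O ⊗ O ⊗ O)) where

    private
      X² : X ⊗ X ≋ V 2 X
      X² = S.trans (S.sym (shift-≋ X)) (pointwise λ where
        zero                → refl
        (suc zero)          → refl
        (suc (suc zero))    → refl
        (suc (suc (suc zero)))    → refl
        (suc (suc (suc (suc n)))) → sym (spread-𝟘 1 0 n))

      even odd : Pow
      even = V 2 f₀ ⊕ V 2 (f₂ ⊗ (g ⊗ g)) ⊗ X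
      odd  = V 2 (f₁ ⊗ g) ⊕ V 2 (f₃ ⊗ (g ⊗ g ⊗ g)) ⊗ X

      VVg = V 2 (V 2 g)

      halves : F ≋ V 2 even ⊕ V 2 odd ⊗ X
      halves = begin
        F ≈⟨ dissected ⟩
        V 2 (V 2 f₀) ⊕ V 2 (V 2 f₁) ⊗ O ⊕ V 2 (V 2 f₂) ⊗ (O ⊗ O) ⊕ V 2 (V 2 f₃) ⊗ (O ⊗ O ⊗ O)
          ≈⟨ S.+-cong (S.+-cong (S.+-congˡ (S.*-congˡ O-dilation)) (S.*-congˡ (S.*-cong O-dilation O-dilation)))
               (S.*-congˡ (S.*-cong (S.*-cong O-dilation O-dilation) O-dilation)) ⟩
        V 2 (V 2 f₀) ⊕ V 2 (V 2 f₁) ⊗ (X ⊗ VVg) ⊕ V 2 (V 2 f₂) ⊗ (X ⊗ VVg ⊗ (X ⊗ VVg)) ⊕ V 2 (V 2 f₃) ⊗ (X ⊗ VVg ⊗ (X ⊗ VVg) ⊗ (X ⊗ VVg))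
          ≈⟨ Sℤ.solve 6 (λ F₀ F₁ F₂ F₃ q γ → F₀ :+ F₁ :* (q :* γ) :+ F₂ :* (q :* γ :* (q :* γ)) :+ F₃ :* (q :* γ :* (q :* γ) :* (q :* γ)) :=
               (F₀ :+ (F₂ :* (γ :* γ)) :* (q :* q)) :+ (F₁ :* γ :+ (F₃ :* (γ :* γ :* γ)) :* (q :* q)) :* q) S.refl
               (V 2 (V 2 f₀)) (V 2 (V 2 f₁)) (V 2 (V 2 f₂)) (V 2 (V 2 f₃)) X VVg ⟩
        (V 2 (V 2 f₀) ⊕ (V 2 (V 2 f₂) ⊗ (VVg ⊗ VVg)) ⊗ (X ⊗ X)) ⊕ (V 2 (V 2 f₁) ⊗ VVg ⊕ (V 2 (V 2 f₃) ⊗ (VVg ⊗ VVg ⊗ VVg)) ⊗ (X ⊗ X)) ⊗ X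
          ≈⟨ S.+-cong (S.+-congˡ (S.*-cong (S.trans (S.*-congˡ (S.sym (VV-⊗ g g))) (S.sym (VV-⊗ f₂ (g ⊗ g)))) X²))
               (S.*-congʳ (S.+-cong (S.sym (VV-⊗ f₁ g)) (S.*-cong (S.trans (S.*-congˡ (S.trans (S.*-congʳ (S.sym (VV-⊗ g g))) (S.sym (VV-⊗ (g ⊗ g) g)))) (S.sym (VV-⊗ f₃ (g ⊗ g ⊗ g)))) X²))) ⟩
        (V 2 (V 2 f₀) ⊕ V 2 (V 2 (f₂ ⊗ (g ⊗ g))) ⊗ V 2 X) ⊕ (V 2 (V 2 (f₁ ⊗ g)) ⊕ V 2 (V 2 (f₃ ⊗ (g ⊗ g ⊗ g))) ⊗ V 2 X) ⊗ X
          ≈⟨ S.+-cong (S.+-congˡ (S.sym (V-⊗ 2 _ X))) (S.*-congʳ (S.+-congˡ (S.sym (V-⊗ 2 _ X)))) ⟩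
        (V 2 (V 2 f₀) ⊕ V 2 (V 2 (f₂ ⊗ (g ⊗ g)) ⊗ X)) ⊕ (V 2 (V 2 (f₁ ⊗ g)) ⊕ V 2 (V 2 (f₃ ⊗ (g ⊗ g ⊗ g)) ⊗ X)) ⊗ X
          ≈⟨ S.+-cong (S.sym (V-⊕ 2 _ _)) (S.*-congʳ (S.sym (V-⊕ 2 _ _))) ⟩
        V 2 even ⊕ V 2 odd ⊗ X ∎
        where
        VV-⊗ : ∀ f g → V 2 (V 2 (f ⊗ g)) ≋ V 2 (V 2 f) ⊗ V 2 (V 2 g)
        VV-⊗ f g = S.trans (V-cong 2 (V-⊗ 2 f g)) (V-⊗ 2 _ _)

      U-even-F : U 2 0 F ≋ even
      U-even-F = S.trans (U-cong 2 0 halves) (S.trans (S.+-cong (U-even-V even) (U-even-VX odd)) (S.+-identityʳ even))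

      U-odd-F : U 2 1 F ≋ odd
      U-odd-F = S.trans (U-cong 2 1 halves) (S.trans (S.+-cong (U-odd-V even) (U-odd-VX odd)) (S.+-identityˡ odd))

    section₀ : U 2 0 (U 2 0 F) ≋ f₀
    section₀ = S.trans (U-cong 2 0 U-even-F) (S.trans (S.+-cong (U-even-V f₀) (U-even-VX _)) (S.+-identityʳ _))

    section₁ : U 2 0 (U 2 1 F) ≋ f₁ ⊗ g
    section₁ = S.trans (U-cong 2 0 U-odd-F) (S.trans (S.+-cong (U-even-V _) (U-even-VX _)) (S.+-identityʳ _))

    section₃ : U 2 1 (U 2 1 F) ≋ f₃ ⊗ (g ⊗ g ⊗ g)
    section₃ = S.trans (U-cong 2 1 U-odd-F) (S.trans (S.+-cong (U-odd-V _) (U-odd-VX _)) (S.+-identityˡ _))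

  -- x⁴ + y⁴ = (a + b)² - 2ab, where a + b is twice the dilation of b and ab is the square of the
  -- dilation of a. This is why symmetry in x⁴ and y⁴ produces series in q².
  fourthPowers : b ⊗ b ⊕ a ⊗ a ≋ V 2 (fromℕ 4 ⊗ (b ⊗ b) ⊕ ⊝ (fromℕ 2 ⊗ (a ⊗ a)))
  fourthPowers = S.sym (begin
    V 2 (fromℕ 4 ⊗ (b ⊗ b) ⊕ ⊝ (fromℕ 2 ⊗ (a ⊗ a)))
      ≈⟨ S.trans (V-⊕ 2 _ _) (S.+-cong (S.trans (V-⊗ 2 _ _) (S.*-cong (V-fromℕ 2 4) (V-⊗ 2 b b)))
           (S.trans (V-⊝ 2 _) (S.-‿cong (S.trans (V-⊗ 2 _ _) (S.*-cong (V-fromℕ 2 2) (V-⊗ 2 a a)))))) ⟩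
    fromℕ 4 ⊗ (V 2 b ⊗ V 2 b) ⊕ ⊝ (fromℕ 2 ⊗ (V 2 a ⊗ V 2 a))
      ≈⟨ S.+-cong (Sℤ.solve 1 (λ v → con (+ 4) :* (v :* v) := (con (+ 2) :* v) :* (con (+ 2) :* v)) S.refl (V 2 b))
           (S.-‿cong (S.*-congˡ geometric)) ⟩
    (fromℕ 2 ⊗ V 2 b) ⊗ (fromℕ 2 ⊗ V 2 b) ⊕ ⊝ (fromℕ 2 ⊗ (a ⊗ b))
      ≈⟨ S.+-congʳ (S.*-cong mean mean) ⟩
    (a ⊕ b) ⊗ (a ⊕ b) ⊕ ⊝ (fromℕ 2 ⊗ (a ⊗ b))
      ≈⟨ Sℤ.solve 2 (λ a b → (a :+ b) :* (a :+ b) :- con (+ 2) :* (a :* b) := b :* b :+ a :* a) S.refl a b ⟩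
    b ⊗ b ⊕ a ⊗ a ∎)

  U-odd-dilation : ∀ {f f′ h h′} → f ≋ V 2 f′ → h ≋ V 2 h′ → U 2 1 (f ⊗ h) ≋ 𝟘
  U-odd-dilation {f′ = f′} {h′ = h′} e e′ =
    S.trans (U-cong 2 1 (S.trans (S.*-cong e e′) (S.sym (V-⊗ 2 f′ h′)))) (U-odd-V (f′ ⊗ h′))

-- The Hasse invariant and sections modulo p

module Hasse {c ℓ} (R : CommutativeRing c ℓ) (n : ℕ) (prime : Prime (suc (n ℕ.+ n)))
  (char : CommutativeRing._≈_ R (IntegerCoefficients.fromℕ R (suc (n ℕ.+ n))) (CommutativeRing.0# R)) where
  open CommutativeRing R hiding (_+_; _*_; _-_; -_)
  open ThetaSeries R
  open GaussIdentity R using (y; P; P⊗y)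
  open MeanIteration R
  open Dissection R using (V-hom)
  open SeriesFrobenius R prime char
  open Sℤ using (con; _:+_; _:*_; _:-_; :-_; _:=_; fromℕ)
  open Evaluation series
  open Characteristic series using (1^)
  open import Algebra.Properties.Semiring.Exp S.semiring using (^-congˡ; ^-homo-*; ^-assocʳ)
  open import Algebra.Properties.CommutativeSemiring.Exp S.commutativeSemiring using (^-distrib-*)
  open import Algebra.Properties.Semiring.Mult.TCOptimised S.semiring using (×-homo-+; ×1-homo-*; 1+×)
  open import Algebra.Properties.Group S.+-group using (inverseʳ-unique)
  open import Relation.Binary.Reasoning.Setoid S.setoid

  p : ℕ
  p = suc (n ℕ.+ n)

  -- 2(n + 1) = p + 1, so n + 1 inverts 2.
  ½ : Pow
  ½ = fromℕ (suc n)

  2½ : fromℕ 2 ⊗ ½ ≋ 𝟙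
  2½ = begin
    fromℕ 2 ⊗ fromℕ (suc n)     ≈⟨ ×1-homo-* 2 (suc n) ⟨
    fromℕ (2 ℕ.* suc n)         ≡⟨ ≡.cong fromℕ (≡.cong suc (≡.trans (≡.cong (n ℕ.+_) (ℕₚ.+-identityʳ (suc n))) (ℕₚ.+-suc n n))) ⟩
    fromℕ (suc p)               ≈⟨ 1+× p 𝟙 ⟩
    𝟙 ⊕ fromℕ p                 ≈⟨ S.+-congˡ series-char ⟩
    𝟙 ⊕ 𝟘                       ≈⟨ S.+-identityʳ 𝟙 ⟩
    𝟙                           ∎

  open Wronskian ½ 2½

  -- By Gauss's identity α is 1/a. Hence t = b/a and s = b²/a² = x⁴/y⁴.
  α t s : Pow
  α = P ⊗ P
  t = b ⊗ α
  s = t ⊗ t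

  aα : a ⊗ α ≋ 𝟙
  aα = begin
    (y ⊗ y) ⊗ (P ⊗ P)   ≈⟨ Sℤ.solve 2 (λ y p → (y :* y) :* (p :* p) := (p :* y) :* (p :* y)) S.refl y P ⟩
    (P ⊗ y) ⊗ (P ⊗ y)   ≈⟨ S.*-cong P⊗y P⊗y ⟩
    𝟙 ⊗ 𝟙               ≈⟨ S.*-identityˡ 𝟙 ⟩
    𝟙                   ∎

  at≋b : a ⊗ t ≋ b
  at≋b = begin
    a ⊗ (b ⊗ α)   ≈⟨ Sℤ.solve 3 (λ a b α → a :* (b :* α) := b :* (a :* α)) S.refl a b α ⟩
    b ⊗ (a ⊗ α)   ≈⟨ S.*-congˡ aα ⟩
    b ⊗ 𝟙         ≈⟨ S.*-identityʳ b ⟩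
    b             ∎

  cancel-a : ∀ f g → a ⊗ f ≋ a ⊗ g → f ≋ g
  cancel-a f g e = S.trans (unit f) (S.trans (S.*-congˡ e) (S.sym (unit g)))
    where
    unit : ∀ f → f ≋ α ⊗ (a ⊗ f)
    unit f = S.sym (S.trans (Sℤ.solve 3 (λ α a f → α :* (a :* f) := (a :* α) :* f) S.refl α a f)
      (S.trans (S.*-congʳ aα) (S.*-identityˡ f)))

  -- After multiplication by a² the left side is -2W, which the Wronskian identity replaces by K.
  Θt : fromℕ 2 ⊗ Θ t ≋ (a ⊗ a) ⊗ (s ⊕ ⊝ 𝟙) ⊗ t
  Θt = cancel-a _ _ (cancel-a _ _ (begin
    a ⊗ (a ⊗ (fromℕ 2 ⊗ Θ t))
      ≈⟨ Sℤ.solve 4 (λ a a′ t t′ → a :* (a :* (con (+ 2) :* t′)) :=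
           :- (con (+ 2) :* (a′ :* (a :* t) :- a :* (a′ :* t :+ a :* t′)))) S.refl a (Θ a) t (Θ t) ⟩
    ⊝ (fromℕ 2 ⊗ (Θ a ⊗ (a ⊗ t) ⊕ ⊝ (a ⊗ (Θ a ⊗ t ⊕ a ⊗ Θ t))))
      ≈⟨ S.-‿cong (S.*-congˡ (S.+-cong (S.*-congˡ at≋b) (S.-‿cong (S.*-congˡ (S.trans (S.sym (Θ-⊗ a t)) (Θ-cong at≋b)))))) ⟩
    ⊝ (fromℕ 2 ⊗ W)
      ≈⟨ inverseʳ-unique (fromℕ 2 ⊗ W) K wronskian ⟨
    K
      ≈⟨ S.*-cong (S.+-congʳ (S.*-cong at≋b at≋b)) (S.*-congˡ at≋b) ⟨
    ((a ⊗ t) ⊗ (a ⊗ t) ⊕ ⊝ (a ⊗ a)) ⊗ (a ⊗ (a ⊗ t))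
      ≈⟨ Sℤ.solve 2 (λ a t → ((a :* t) :* (a :* t) :- (a :* a)) :* (a :* (a :* t)) :=
           a :* (a :* ((a :* a) :* (t :* t :- con (+ 1)) :* t))) S.refl a t ⟩
    a ⊗ (a ⊗ ((a ⊗ a) ⊗ (s ⊕ ⊝ 𝟙) ⊗ t)) ∎))

  Θs : Θ s ≋ (a ⊗ a) ⊗ (s ⊗ s ⊕ ⊝ s)
  Θs = begin
    Θ (t ⊗ t)                             ≈⟨ Θ-⊗ t t ⟩
    Θ t ⊗ t ⊕ t ⊗ Θ t                     ≈⟨ Sℤ.solve 2 (λ t t′ → t′ :* t :+ t :* t′ := (con (+ 2) :* t′) :* t) S.refl t (Θ t) ⟩
    (fromℕ 2 ⊗ Θ t) ⊗ t                   ≈⟨ S.*-congʳ Θt ⟩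
    (a ⊗ a) ⊗ (s ⊕ ⊝ 𝟙) ⊗ t ⊗ t           ≈⟨ Sℤ.solve 2 (λ a t → (a :* a) :* (t :* t :- con (+ 1)) :* t :* t :=
                                               (a :* a) :* ((t :* t) :* (t :* t) :- t :* t)) S.refl a t ⟩
    (a ⊗ a) ⊗ (s ⊗ s ⊕ ⊝ s)               ∎

  Θ-ev : ∀ cs f → Θ (ev cs f) ≋ Θ f ⊗ ev (derivative cs) f
  Θ-ev []       f = S.trans (pointwise λ _ → zeroʳ _) (S.sym (S.zeroʳ (Θ f)))
  Θ-ev (c ∷ cs) f = begin
    Θ (fromℕ c ⊕ f ⊗ ev cs f)
      ≈⟨ S.trans (Θ-⊕ _ _) (S.+-cong (Θ-fromℕ c) (S.trans (Θ-⊗ f (ev cs f)) (S.+-congˡ (S.*-congˡ (Θ-ev cs f))))) ⟩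
    𝟘 ⊕ (Θ f ⊗ ev cs f ⊕ f ⊗ (Θ f ⊗ ev (derivative cs) f))
      ≈⟨ Sℤ.solve 4 (λ f f′ v d → con (+ 0) :+ (f′ :* v :+ f :* (f′ :* d)) := f′ :* (v :+ f :* d)) S.refl f (Θ f) _ _ ⟩
    Θ f ⊗ (ev cs f ⊕ f ⊗ ev (derivative cs) f)
      ≈⟨ S.*-congˡ (S.sym (ev-derivative c cs f)) ⟩
    Θ f ⊗ ev (derivative (c ∷ cs)) f ∎

  Θ-^ : ∀ f g m → Θ f ≋ f ⊗ g → Θ (f ⊗^ m) ≋ fromℕ m ⊗ (f ⊗^ m ⊗ g)
  Θ-^ f g zero    e = S.trans (Θ-fromℕ 1) (S.sym (S.zeroˡ _))
  Θ-^ f g (suc m) e = begin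
    Θ (f ⊗ f ⊗^ m)                              ≈⟨ Θ-⊗ f (f ⊗^ m) ⟩
    Θ f ⊗ f ⊗^ m ⊕ f ⊗ Θ (f ⊗^ m)               ≈⟨ S.+-cong (S.*-congʳ e) (S.*-congˡ (Θ-^ f g m e)) ⟩
    f ⊗ g ⊗ f ⊗^ m ⊕ f ⊗ (fromℕ m ⊗ (f ⊗^ m ⊗ g))
      ≈⟨ Sℤ.solve 4 (λ f g q m → f :* g :* q :+ f :* (m :* (q :* g)) := (con (+ 1) :+ m) :* (f :* q :* g)) S.refl f g (f ⊗^ m) (fromℕ m) ⟩
    (𝟙 ⊕ fromℕ m) ⊗ (f ⊗ f ⊗^ m ⊗ g)            ≈⟨ S.*-congʳ (1+× m 𝟙) ⟨
    fromℕ (suc m) ⊗ (f ⊗ f ⊗^ m ⊗ g)            ∎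

  -- Odd coefficients vanish, and an even one equals the coefficient at half its exponent; the
  -- descent ends at the constant term or at an odd exponent.
  V-fixed : ∀ f → f 0 ≈ 1# → V 2 f ≋ f → f ≋ 𝟙
  V-fixed f f₀ e = pointwise λ n → go (suc n) n (ℕₚ.n<1+n n)
    where
    go : ∀ n i → i < n → f i ≈ 𝟙 i
    go (suc n) zero          _   = f₀
    go (suc n) (suc zero)    _   = sym (at e 1)
    go (suc n) (suc (suc i)) i<n = trans (sym (at e (suc (suc i)))) (V-low i (tl f) λ k 2k≤i →
      go n (suc k) (ℕₚ.<-≤-trans (ℕ.s≤s (ℕ.s≤s (ℕₚ.≤-trans (ℕₚ.m≤m+n k k) 2k≤i))) (ℕ.s≤s⁻¹ i<n)))

  ev-head : ∀ cs f → f 0 ≈ 1# → ev cs f 0 ≈ fromℕ (sumℕ cs) 0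
  ev-head []       f f₀ = refl
  ev-head (c ∷ cs) f f₀ = trans (+-congˡ (trans (*-cong f₀ (ev-head cs f f₀)) (*-identityˡ _))) (sym (at (×-homo-+ 𝟙 c (sumℕ cs)) 0))

  ^-head : ∀ f m → f 0 ≈ 1# → (f ⊗^ m) 0 ≈ 1#
  ^-head f zero    f₀ = refl
  ^-head f (suc m) f₀ = trans (*-cong f₀ (^-head f m f₀)) (*-identityˡ _)

  w : Pow → Pow
  w t = ((𝟙 ⊕ t) ⊗ ½) ⊗ ((𝟙 ⊕ t) ⊗ ½)

  -- The Hasse invariant is unchanged by a step of the mean iteration, hence constant.
  module Invariant (h₀ : ℕ) (hs : List ℕ) (deg : length hs ≡ n) (normalised : fromℕ (sumℕ (h₀ ∷ hs)) ≋ 𝟙)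
    (isogeny : ∀ t → hom (h₀ ∷ hs) t (w t) ≋ hom (h₀ ∷ hs) 𝟙 (t ⊗ t)) where
    private
      h = h₀ ∷ hs
      k = a ⊗ a
      H = hom h (a ⊗ a) (b ⊗ b)

    H-scaled : H ≋ k ⊗^ length hs ⊗ hom h 𝟙 s
    H-scaled = S.trans (hom-cong h (S.sym (S.*-identityʳ k))
        (S.trans (S.*-cong (S.sym at≋b) (S.sym at≋b)) (Sℤ.solve 2 (λ a t → (a :* t) :* (a :* t) := (a :* a) :* (t :* t)) S.refl a t)))
      (hom-scale k h₀ hs 𝟙 s)

    -- The mean step takes (a², b²) to (ab, ((a + b)/2)²) = (a² t, a² w(t)). Homogeneity then
    -- reduces the invariance of H to the one-variable identity `isogeny`.
    V-H : V 2 H ≋ k ⊗^ length hs ⊗ hom h t (w t)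
    V-H = S.trans (V-hom 2 h (a ⊗ a) (b ⊗ b)) (S.trans (hom-cong h Va² Vb²) (hom-scale k h₀ hs t (w t)))
      where
      Va² : V 2 (a ⊗ a) ≋ k ⊗ t
      Va² = begin
        V 2 (a ⊗ a)     ≈⟨ V-⊗ 2 a a ⟩
        V 2 a ⊗ V 2 a   ≈⟨ geometric ⟩
        a ⊗ b           ≈⟨ S.*-congˡ at≋b ⟨
        a ⊗ (a ⊗ t)     ≈⟨ S.*-assoc a a t ⟨
        (a ⊗ a) ⊗ t     ∎

      Vb : V 2 b ≋ a ⊗ ((𝟙 ⊕ t) ⊗ ½)
      Vb = begin
        V 2 b                         ≈⟨ S.*-identityˡ _ ⟨
        𝟙 ⊗ V 2 b                     ≈⟨ S.*-congʳ 2½ ⟨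
        (fromℕ 2 ⊗ ½) ⊗ V 2 b         ≈⟨ Sℤ.solve 2 (λ h v → (con (+ 2) :* h) :* v := (con (+ 2) :* v) :* h) S.refl ½ (V 2 b) ⟩
        (fromℕ 2 ⊗ V 2 b) ⊗ ½         ≈⟨ S.*-congʳ (S.trans mean (S.+-congˡ (S.sym at≋b))) ⟩
        (a ⊕ a ⊗ t) ⊗ ½               ≈⟨ Sℤ.solve 3 (λ a t h → (a :+ a :* t) :* h := a :* ((con (+ 1) :+ t) :* h)) S.refl a t ½ ⟩
        a ⊗ ((𝟙 ⊕ t) ⊗ ½)             ∎

      Vb² : V 2 (b ⊗ b) ≋ k ⊗ w t
      Vb² = S.trans (V-⊗ 2 b b) (S.trans (S.*-cong Vb Vb)
        (Sℤ.solve 2 (λ a v → (a :* v) :* (a :* v) := (a :* a) :* (v :* v)) S.refl a ((𝟙 ⊕ t) ⊗ ½)))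

    k^n-ev : k ⊗^ n ⊗ ev h s ≋ 𝟙
    k^n-ev = S.trans (S.*-cong (S.reflexive (≡.cong (k ⊗^_) (≡.sym deg))) (S.sym (hom-1 h s)))
      (S.trans (S.sym H-scaled) (V-fixed H H₀ (S.trans V-H (S.trans (S.*-congˡ (isogeny t)) (S.sym H-scaled)))))
      where
      k₀ : k 0 ≈ 1#
      k₀ = trans (*-cong a₀ a₀) (*-identityˡ _)

      t₀ : t 0 ≈ 1#
      t₀ = trans (*-cong b₀ (*-cong (refl {1#}) (refl {1#}))) (trans (*-identityˡ _) (*-identityˡ _))

      H₀ : H 0 ≈ 1#
      H₀ = trans (at H-scaled 0) (trans (*-cong (^-head k (length hs) k₀)
        (trans (at (hom-1 h s) 0) (trans (ev-head h s (trans (*-cong t₀ t₀) (*-identityˡ _))) (at normalised 0)))) (*-identityˡ _))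

    a^2n : a ⊗^ (n ℕ.+ n) ⊗ ev h s ≋ 𝟙
    a^2n = S.trans (S.*-congʳ (S.trans (^-homo-* a n n) (S.sym (^-distrib-* a a n)))) k^n-ev

    -- This is the logarithmic derivative of a^(2n) h(s) = 1: in characteristic p one has 2n = -1,
    -- and 1/h(s) is a^(2n), so no inverse remains.
    Θa : Θ a ≋ a ⊗ (a ⊗^ (n ℕ.+ n) ⊗ (Θ s ⊗ ev (derivative h) s))
    Θa = begin
      Θ a                       ≈⟨ S.*-identityʳ (Θ a) ⟨
      Θ a ⊗ 𝟙                   ≈⟨ S.*-congˡ aα ⟨
      Θ a ⊗ (a ⊗ α)             ≈⟨ Sℤ.solve 3 (λ a α d → d :* (a :* α) := a :* (d :* α)) S.refl a α (Θ a) ⟩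
      a ⊗ (Θ a ⊗ α)             ≈⟨ S.*-congˡ (S.sym log) ⟩
      a ⊗ (A ⊗ (Θ s ⊗ ev (derivative h) s)) ∎
      where
      A = a ⊗^ (n ℕ.+ n)
      l = Θ a ⊗ α

      Θa≋ : Θ a ≋ a ⊗ l
      Θa≋ = S.sym (S.trans (Sℤ.solve 3 (λ a α d → a :* (d :* α) := d :* (a :* α)) S.refl a α (Θ a))
        (S.trans (S.*-congˡ aα) (S.*-identityʳ _)))

      differentiated : fromℕ (n ℕ.+ n) ⊗ l ⊕ A ⊗ (Θ s ⊗ ev (derivative h) s) ≋ 𝟘
      differentiated = begin
        fromℕ (n ℕ.+ n) ⊗ l ⊕ A ⊗ (Θ s ⊗ ev (derivative h) s)
          ≈⟨ S.+-congʳ (S.trans (S.sym (S.*-identityʳ _)) (S.*-congˡ (S.sym a^2n))) ⟩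
        fromℕ (n ℕ.+ n) ⊗ l ⊗ (A ⊗ ev h s) ⊕ A ⊗ (Θ s ⊗ ev (derivative h) s)
          ≈⟨ S.+-cong (Sℤ.solve 4 (λ m l A v → m :* l :* (A :* v) := (m :* (A :* l)) :* v) S.refl (fromℕ (n ℕ.+ n)) l A (ev h s))
               (S.*-congˡ (S.sym (Θ-ev h s))) ⟩
        (fromℕ (n ℕ.+ n) ⊗ (A ⊗ l)) ⊗ ev h s ⊕ A ⊗ Θ (ev h s)
          ≈⟨ S.+-congʳ (S.*-congʳ (Θ-^ a l (n ℕ.+ n) Θa≋)) ⟨
        Θ A ⊗ ev h s ⊕ A ⊗ Θ (ev h s)
          ≈⟨ Θ-⊗ A (ev h s) ⟨
        Θ (A ⊗ ev h s)
          ≈⟨ Θ-cong a^2n ⟩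
        Θ 𝟙
          ≈⟨ Θ-fromℕ 1 ⟩
        𝟘 ∎

      log : A ⊗ (Θ s ⊗ ev (derivative h) s) ≋ l
      log = begin
        -- The second bracket equals l because 1 + 2n = p is 0.
        r                                     ≈⟨ Sℤ.solve 3 (λ m l r → r := (m :* l :+ r) :+ (l :- (con (+ 1) :+ m) :* l)) S.refl (fromℕ (n ℕ.+ n)) l r ⟩
        (fromℕ (n ℕ.+ n) ⊗ l ⊕ r) ⊕ (l ⊕ ⊝ ((𝟙 ⊕ fromℕ (n ℕ.+ n)) ⊗ l))
          ≈⟨ S.+-cong differentiated (S.+-congˡ (S.-‿cong (S.*-congʳ (S.trans (S.sym (1+× (n ℕ.+ n) 𝟙)) series-char)))) ⟩
        𝟘 ⊕ (l ⊕ ⊝ (𝟘 ⊗ l))                   ≈⟨ Sℤ.solve 1 (λ l → con (+ 0) :+ (l :- con (+ 0) :* l) := l) S.refl l ⟩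
        l                                     ∎
        where r = A ⊗ (Θ s ⊗ ev (derivative h) s)

    -- A primitive u of the difference between a^n and a p-th power shows that the two have the same image under U p.
    module Primitive (u : List ℕ) (e : ℕ) (exponent : e ℕ.+ (2 ℕ.+ (n ℕ.+ n)) ≡ n ℕ.* p) (c₀ c₁ c₂ : ℕ)
      (certificate : ∀ s → ev h s ⊗^ n ≋ (fromℕ c₀ ⊕ fromℕ c₁ ⊗ s ⊗^ p ⊕ fromℕ c₂ ⊗ (s ⊗^ p ⊗ s ⊗^ p)) ⊕
        (s ⊗ s ⊕ ⊝ s) ⊗ (fromℕ e ⊗ (ev (derivative h) s ⊗ ev u s) ⊕ ev (derivative u) s ⊗ ev h s)) where

      private
        A = a ⊗^ (n ℕ.+ n)
        h′ = ev (derivative h) s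
        u′ = ev (derivative u) s
        C = (s ⊗ s ⊕ ⊝ s) ⊗ (fromℕ e ⊗ (h′ ⊗ ev u s) ⊕ u′ ⊗ ev h s)

      -- Its dilation by p is a^(np) (c₀ + c₁ s^p + c₂ s^(2p)), the part of the certificate not
      -- written as a derivative.
      form : Pow
      form = a ⊗^ n ⊗ (fromℕ c₀ ⊕ fromℕ c₁ ⊗ s ⊕ fromℕ c₂ ⊗ (s ⊗ s))

      private
        Θ-primitive : Θ (a ⊗^ e ⊗ ev u s) ≋ a ⊗^ (n ℕ.* p) ⊗ C
        Θ-primitive = begin
          Θ (a ⊗^ e ⊗ ev u s)
            ≈⟨ S.trans (Θ-⊗ _ _) (S.+-cong (S.*-congʳ (Θ-^ a _ e Θa)) (S.*-congˡ (Θ-ev u s))) ⟩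
          fromℕ e ⊗ (a ⊗^ e ⊗ (A ⊗ (Θ s ⊗ h′))) ⊗ ev u s ⊕ a ⊗^ e ⊗ (Θ s ⊗ u′)
            -- The second summand lacks the power a^(2n) present in the first; multiplying it by
            -- a^(2n) h(s) = 1 makes the sum homogeneous.
            ≈⟨ S.+-congˡ (S.trans (S.sym (S.*-identityʳ _)) (S.*-congˡ (S.sym a^2n))) ⟩
          fromℕ e ⊗ (a ⊗^ e ⊗ (A ⊗ (Θ s ⊗ h′))) ⊗ ev u s ⊕ a ⊗^ e ⊗ (Θ s ⊗ u′) ⊗ (A ⊗ ev h s)
            ≈⟨ Sℤ.solve 8 (λ e q A d h′ v u′ g → e :* (q :* (A :* (d :* h′))) :* v :+ q :* (d :* u′) :* (A :* g) :=
                 q :* A :* d :* (e :* (h′ :* v) :+ u′ :* g)) S.refl (fromℕ e) (a ⊗^ e) A (Θ s) h′ (ev u s) u′ (ev h s) ⟩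
          a ⊗^ e ⊗ A ⊗ Θ s ⊗ (fromℕ e ⊗ (h′ ⊗ ev u s) ⊕ u′ ⊗ ev h s)
            ≈⟨ S.*-congʳ (S.*-congˡ Θs) ⟩
          a ⊗^ e ⊗ A ⊗ ((a ⊗ a) ⊗ (s ⊗ s ⊕ ⊝ s)) ⊗ (fromℕ e ⊗ (h′ ⊗ ev u s) ⊕ u′ ⊗ ev h s)
            ≈⟨ Sℤ.solve 5 (λ q A a d z → q :* A :* ((a :* a) :* d) :* z := (q :* (a :* (a :* A))) :* (d :* z)) S.refl (a ⊗^ e) A a (s ⊗ s ⊕ ⊝ s) _ ⟩
          (a ⊗^ e ⊗ a ⊗^ (2 ℕ.+ (n ℕ.+ n))) ⊗ C
            ≈⟨ S.*-congʳ (S.trans (S.sym (^-homo-* a e (2 ℕ.+ (n ℕ.+ n)))) (S.reflexive (≡.cong (a ⊗^_) exponent))) ⟩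
          a ⊗^ (n ℕ.* p) ⊗ C ∎

        -- The n-th power of a^(2n) h(s) = 1 is inserted, and n + 2n · n = np.
        a^n-expanded : a ⊗^ n ≋ a ⊗^ (n ℕ.* p) ⊗ ev h s ⊗^ n
        a^n-expanded = begin
          a ⊗^ n                                ≈⟨ S.*-identityʳ _ ⟨
          a ⊗^ n ⊗ 𝟙                            ≈⟨ S.*-congˡ (1^ n) ⟨
          a ⊗^ n ⊗ 𝟙 ⊗^ n                       ≈⟨ S.*-congˡ (^-congˡ n a^2n) ⟨
          a ⊗^ n ⊗ (A ⊗ ev h s) ⊗^ n            ≈⟨ S.*-congˡ (^-distrib-* A (ev h s) n) ⟩
          a ⊗^ n ⊗ (A ⊗^ n ⊗ ev h s ⊗^ n)       ≈⟨ S.*-assoc _ _ _ ⟨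
          a ⊗^ n ⊗ A ⊗^ n ⊗ ev h s ⊗^ n         ≈⟨ S.*-congʳ (S.*-congˡ (^-assocʳ a (n ℕ.+ n) n)) ⟩
          a ⊗^ n ⊗ a ⊗^ ((n ℕ.+ n) ℕ.* n) ⊗ ev h s ⊗^ n ≈⟨ S.*-congʳ (^-homo-* a n _) ⟨
          a ⊗^ (n ℕ.+ (n ℕ.+ n) ℕ.* n) ⊗ ev h s ⊗^ n
            ≡⟨ ≡.cong (λ m → a ⊗^ m ⊗ ev h s ⊗^ n) (ℕₚ.*-comm p n) ⟩
          a ⊗^ (n ℕ.* p) ⊗ ev h s ⊗^ n          ∎

        Frob : Pow → Set ℓ
        Frob f = f ⊗^ p ≋ V p f

        frob-⊗ : ∀ f g → Frob f → Frob g → Frob (f ⊗ g)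
        frob-⊗ f g e e′ = S.trans (^-distrib-* f g p) (S.trans (S.*-cong e e′) (S.sym (V-⊗ p f g)))

        frob-P : Frob P
        frob-P = frobenius P (λ i → Characteristic.fermat R char prime (overpartition i))

        -- The coefficients of y carry signs, so the property is transferred from P through P y = 1.
        frob-y : Frob y
        frob-y = begin
          y ⊗^ p                        ≈⟨ S.*-identityʳ _ ⟨
          y ⊗^ p ⊗ 𝟙                    ≈⟨ S.*-congˡ (S.trans (S.sym (V-⊗ p P y)) (S.trans (V-cong p P⊗y) (V-𝟙 p))) ⟨
          y ⊗^ p ⊗ (V p P ⊗ V p y)      ≈⟨ S.*-congˡ (S.*-congʳ frob-P) ⟨
          y ⊗^ p ⊗ (P ⊗^ p ⊗ V p y)     ≈⟨ Sℤ.solve 3 (λ u v w → u :* (v :* w) := (v :* u) :* w) S.refl (y ⊗^ p) (P ⊗^ p) (V p y) ⟩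
          (P ⊗^ p ⊗ y ⊗^ p) ⊗ V p y     ≈⟨ S.*-congʳ (S.trans (S.sym (^-distrib-* P y p)) (S.trans (^-congˡ p P⊗y) (1^ p))) ⟩
          𝟙 ⊗ V p y                     ≈⟨ S.*-identityˡ _ ⟩
          V p y                         ∎

        frob-x : Frob x
        frob-x = frobenius x (λ i → sum-fixed (suc i ℕ.+ suc (suc i)) (λ k → mono (sq (+ k ℤ.- + suc i))) i (λ k → mono-fixed (sq (+ k ℤ.- + suc i)) i))
          where
          open import Algebra.Properties.Semiring.Exp semiring using (_^_)
          fixed-0 : 0# ^ p ≈ 0#
          fixed-0 = zeroˡ _

          mono-fixed : ∀ m i → mono m i ^ p ≈ mono m i
          mono-fixed zero    zero    = Characteristic.1^ R p
          mono-fixed zero    (suc i) = fixed-0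
          mono-fixed (suc m) zero    = fixed-0
          mono-fixed (suc m) (suc i) = mono-fixed m i

          sum-fixed : ∀ m f i → (∀ k → f k i ^ p ≈ f k i) → IntegerSums.sum R m f i ^ p ≈ IntegerSums.sum R m f i
          sum-fixed zero    f i fixed = fixed-0
          sum-fixed (suc m) f i fixed = trans (Characteristic.frobenius-+ R char prime _ _)
            (+-cong (fixed 0) (sum-fixed m (λ k → f (suc k)) i (λ k → fixed (suc k))))

        frob-s : Frob s
        frob-s = frob-⊗ t t frob-t frob-t
          where
          frob-t : Frob t
          frob-t = frob-⊗ b α (frob-⊗ x x frob-x frob-x) (frob-⊗ P P frob-P frob-P)

        form-power : a ⊗^ (n ℕ.* p) ⊗ (fromℕ c₀ ⊕ fromℕ c₁ ⊗ s ⊗^ p ⊕ fromℕ c₂ ⊗ (s ⊗^ p ⊗ s ⊗^ p)) ≋ V p form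
        form-power = S.sym (begin
          V p form
            ≈⟨ S.trans (V-⊗ p _ _) (S.*-cong (V-^ p a n) (S.trans (V-⊕ p _ _) (S.+-cong (S.trans (V-⊕ p _ _) (S.+-cong (V-fromℕ p c₀)
                 (S.trans (V-⊗ p _ _) (S.*-congʳ (V-fromℕ p c₁)))))
                 (S.trans (V-⊗ p _ _) (S.*-cong (V-fromℕ p c₂) (V-⊗ p s s)))))) ⟩
          V p a ⊗^ n ⊗ (fromℕ c₀ ⊕ fromℕ c₁ ⊗ V p s ⊕ fromℕ c₂ ⊗ (V p s ⊗ V p s))
            ≈⟨ S.*-cong (^-congˡ n (frob-⊗ y y frob-y frob-y)) (S.+-cong (S.+-congˡ (S.*-congˡ frob-s)) (S.*-congˡ (S.*-cong frob-s frob-s))) ⟨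
          (a ⊗^ p) ⊗^ n ⊗ (fromℕ c₀ ⊕ fromℕ c₁ ⊗ s ⊗^ p ⊕ fromℕ c₂ ⊗ (s ⊗^ p ⊗ s ⊗^ p))
            ≈⟨ S.*-congʳ (S.trans (^-assocʳ a p n) (S.reflexive (≡.cong (a ⊗^_) (ℕₚ.*-comm p n)))) ⟩
          a ⊗^ (n ℕ.* p) ⊗ (fromℕ c₀ ⊕ fromℕ c₁ ⊗ s ⊗^ p ⊕ fromℕ c₂ ⊗ (s ⊗^ p ⊗ s ⊗^ p)) ∎)

        a^n-decomposed : a ⊗^ n ≋ V p form ⊕ Θ (a ⊗^ e ⊗ ev u s)
        a^n-decomposed = begin
          a ⊗^ n                            ≈⟨ a^n-expanded ⟩
          a ⊗^ (n ℕ.* p) ⊗ ev h s ⊗^ n      ≈⟨ S.*-congˡ (certificate s) ⟩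
          a ⊗^ (n ℕ.* p) ⊗ (_ ⊕ C)          ≈⟨ S.distribˡ _ _ _ ⟩
          a ⊗^ (n ℕ.* p) ⊗ _ ⊕ a ⊗^ (n ℕ.* p) ⊗ C ≈⟨ S.+-cong form-power (S.sym Θ-primitive) ⟩
          V p form ⊕ Θ (a ⊗^ e ⊗ ev u s)    ∎

        U-𝟙 : U p 0 𝟙 ≋ 𝟙
        U-𝟙 = pointwise λ where
          zero    → refl
          (suc i) → refl

        U-a^n : U p 0 (a ⊗^ n) ≋ form
        U-a^n = begin
          U p 0 (a ⊗^ n)
            ≈⟨ U-cong p 0 a^n-decomposed ⟩
          U p 0 (V p form ⊕ Θ (a ⊗^ e ⊗ ev u s))
            -- At an exponent ip the derivation multiplies by ip, which is 0, so only the dilated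
            -- part survives.
            ≈⟨ S.+-cong (U-cong p 0 (S.sym (S.*-identityʳ (V p form)))) (pointwise λ i → trans (*-congʳ
                 (Characteristic.fromℕ-∣ R char (divides i (ℕₚ.+-identityʳ (i ℕ.* p))))) (zeroˡ _)) ⟩
          U p 0 (V p form ⊗ 𝟙) ⊕ 𝟘
            ≈⟨ S.trans (S.+-identityʳ _) (U-V⊗ p 0 form 𝟙 (ℕ.s≤s ℕ.z≤n)) ⟩
          form ⊗ U p 0 𝟙
            ≈⟨ S.trans (S.*-congˡ U-𝟙) (S.*-identityʳ form) ⟩
          form ∎

      U-P : U p 0 P ≋ P ⊗ form
      U-P = begin
        U p 0 P                     ≈⟨ U-cong p 0 P≋ ⟩
        U p 0 (V p P ⊗ a ⊗^ n)      ≈⟨ U-V⊗ p 0 P (a ⊗^ n) (ℕ.s≤s ℕ.z≤n) ⟩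
        P ⊗ U p 0 (a ⊗^ n)          ≈⟨ S.*-congˡ U-a^n ⟩
        P ⊗ form                    ∎
        where
        P≋ : P ≋ V p P ⊗ a ⊗^ n
        P≋ = begin
          P                                             ≈⟨ S.*-identityʳ P ⟨
          P ⊗ 𝟙                                         ≈⟨ S.*-congˡ (S.trans (^-congˡ n aα) (1^ n)) ⟨
          P ⊗ (a ⊗ α) ⊗^ n                              ≈⟨ S.*-congˡ (^-distrib-* a α n) ⟩
          P ⊗ (a ⊗^ n ⊗ α ⊗^ n)                         ≈⟨ S.*-congˡ (S.*-congˡ (S.trans (^-distrib-* P P n) (S.sym (^-homo-* P n n)))) ⟩
          P ⊗ (a ⊗^ n ⊗ P ⊗^ (n ℕ.+ n))                 ≈⟨ Sℤ.solve 3 (λ P a q → P :* (a :* q) := (P :* q) :* a) S.refl P (a ⊗^ n) (P ⊗^ (n ℕ.+ n)) ⟩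
          P ⊗^ p ⊗ a ⊗^ n                               ≈⟨ S.*-congʳ frob-P ⟩
          V p P ⊗ a ⊗^ n                                ∎

-- The primes 11 and 13

module Forms {c ℓ} (R : CommutativeRing c ℓ) where
  open CommutativeRing R
  open IntegerCoefficients R using (fromℕ)
  open Evaluation R
  open import Algebra.Properties.Semiring.Exp semiring using (_^_)

  -- The subscript is the degree p - 2, not the prime: 9 belongs to p = 11 and 11 to p = 13. The
  -- factor P = 1/y lowers the degree 2n = p - 1 by one, and the exponents of v are multiples of 4
  -- because s = x⁴/y⁴.
  form₉ : ℕ → ℕ → ℕ → Carrier → Carrier → Carrier
  form₉ c₀ c₁ c₂ u v = fromℕ c₀ * u ^ 9 + fromℕ c₁ * (u ^ 5 * v ^ 4) + fromℕ c₂ * (u * v ^ 8)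

  form₁₁ : ℕ → ℕ → ℕ → Carrier → Carrier → Carrier
  form₁₁ c₀ c₁ c₂ u v = fromℕ c₀ * u ^ 11 + fromℕ c₁ * (u ^ 7 * v ^ 4) + fromℕ c₂ * (u ^ 3 * v ^ 8)

  cell₄ : ℕ → List ℕ → Carrier → Carrier → Carrier
  cell₄ r cs e o = e ^ r * hom cs ((e * e) * (e * e)) ((o * o) * (o * o))

module Identities₁₁ {c ℓ} (R : CommutativeRing c ℓ)
  (char : CommutativeRing._≈_ R (IntegerCoefficients.fromℕ R 11) (CommutativeRing.0# R)) where
  open CommutativeRing R
  open IntegerCoefficients R using (fromℕ)
  open PolynomialEvaluation R 10 char
  open Evaluation R
  open Forms R
  open import Algebra.Properties.Semiring.Exp semiring using (_^_)

  -- h(s) = (−1)⁵ ∑ₖ C(5,k)² sᵏ; the list u was found by linear algebra over 𝔽₁₁.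
  h u : List ℕ
  h = 10 ∷ 8 ∷ 10 ∷ 10 ∷ 8 ∷ 10 ∷ []
  u = 0 ∷ 7 ∷ 0 ∷ 8 ∷ 1 ∷ 9 ∷ 6 ∷ 5 ∷ 6 ∷ 8 ∷ 0 ∷ 0 ∷ 7 ∷ 5 ∷ 6 ∷ 5 ∷ 6 ∷ 4 ∷ 6 ∷ 4 ∷ []

  -- The constant 6 is 1/2 modulo 11, so the second argument is the square of the mean of 1 and t.
  isogeny : ∀ t → hom h t (((1# + t) * fromℕ 6) * ((1# + t) * fromℕ 6)) ≈ hom h 1# (t * t)
  isogeny = solve 1 (λ t → let w = (con 1 :+ t) :* con 6 in homₚ h t (w :* w) := homₚ h (con 1) (t :* t)) refl

  -- The derivative term vanishes at s = 0 and s = 1, which forces c₀ = h(0)⁵ = -1 and c₀ + c₁ + c₂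
  -- = h(1)⁵ = 1. The weight 43 is 55 - 12.
  certificate : ∀ s → ev h s ^ 5 ≈ (fromℕ 10 + fromℕ 2 * s ^ 11 + fromℕ 0 * (s ^ 11 * s ^ 11)) +
    (s * s + - s) * (fromℕ 43 * (ev (derivative h) s * ev u s) + ev (derivative u) s * ev h s)
  certificate = solve 1 (λ s → evₚ h s :^ 5 := (con 10 :+ con 2 :* s :^ 11 :+ con 0 :* (s :^ 11 :* s :^ 11)) :+
    (s :* s :+ :- s) :* (con 43 :* (evₚ (derivative h) s :* evₚ u s) :+ evₚ (derivative u) s :* evₚ h s)) refl

  -- The squares of the C(5,k) add up to C(10,5), which is -1 modulo 11; the sign in h makes h(1) =
  -- 1.
  normalised : fromℕ 56 ≈ 1#
  -- The product with 1 triggers the reduction of 56 modulo 11.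
  normalised = trans (sym (*-identityʳ _)) (solve 0 (con 56 :* con 1 := con 1) refl)

  -- Monomials of degree 9 are sorted by the exponent of o modulo 4. This fixes the exponent of e
  -- modulo 4, whence the powers 1, 0, 3, 2 in front of the cells.
  expansion : ∀ e o → form₉ 10 2 0 (e + - o) (e + o) ≈
    cell₄ 1 (1 ∷ 7 ∷ 4 ∷ []) e o + cell₄ 0 (7 ∷ 4 ∷ 10 ∷ []) e o * o +
    cell₄ 3 (0 ∷ 7 ∷ []) e o * (o * o) + cell₄ 2 (4 ∷ 0 ∷ []) e o * (o * o * o)
  expansion = solve 2 (λ e o → let u = e :+ :- o; v = e :+ o; cell = λ r cs → e :^ r :* homₚ cs ((e :* e) :* (e :* e)) ((o :* o) :* (o :* o)) in
    con 10 :* u :^ 9 :+ con 2 :* (u :^ 5 :* v :^ 4) :+ con 0 :* (u :* v :^ 8) :=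
    cell 1 (1 ∷ 7 ∷ 4 ∷ []) :+ cell 0 (7 ∷ 4 ∷ 10 ∷ []) :* o :+ cell 3 (0 ∷ 7 ∷ []) :* (o :* o) :+ cell 2 (4 ∷ 0 ∷ []) :* (o :* o :* o)) refl

  -- A cell with coefficients c₀, c₁, c₂ and r = 0 is symmetric in X and Y precisely when c₀ + c₁ =
  -- 0, and here 7 + 4 = 11.
  symmetric : ∀ X Y → 1# * hom (7 ∷ 4 ∷ 10 ∷ []) X (X + - Y) ≈ fromℕ 10 * ((X + Y) * (X + Y))
  symmetric = solve 2 (λ X Y → con 1 :* homₚ (7 ∷ 4 ∷ 10 ∷ []) X (X :+ :- Y) := con 10 :* ((X :+ Y) :* (X :+ Y))) refl

module Identities₁₃ {c ℓ} (R : CommutativeRing c ℓ)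
  (char : CommutativeRing._≈_ R (IntegerCoefficients.fromℕ R 13) (CommutativeRing.0# R)) where
  open CommutativeRing R
  open IntegerCoefficients R using (fromℕ)
  open PolynomialEvaluation R 12 char
  open Evaluation R
  open Forms R
  open import Algebra.Properties.Semiring.Exp semiring using (_^_)

  -- h(s) = ∑ₖ C(6,k)² sᵏ; the list u was found by linear algebra over 𝔽₁₃.
  h u : List ℕ
  h = 1 ∷ 10 ∷ 4 ∷ 10 ∷ 4 ∷ 10 ∷ 1 ∷ []
  u = 0 ∷ 5 ∷ 1 ∷ 11 ∷ 6 ∷ 2 ∷ 6 ∷ 2 ∷ 8 ∷ 11 ∷ 3 ∷ 12 ∷ 0 ∷ 0 ∷ 3 ∷ 4 ∷ 11 ∷ 1 ∷ 4 ∷ 3 ∷ 9 ∷ 6 ∷ 1 ∷ 5 ∷ 0 ∷ 0 ∷ 4 ∷ 7 ∷ 7 ∷ 4 ∷ []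

  isogeny : ∀ t → hom h t (((1# + t) * fromℕ 7) * ((1# + t) * fromℕ 7)) ≈ hom h 1# (t * t)
  isogeny = solve 1 (λ t → let w = (con 1 :+ t) :* con 7 in homₚ h t (w :* w) := homₚ h (con 1) (t :* t)) refl

  -- Here h(0) = h(1) = 1, so c₀ = 1 and c₁ + c₂ = 0 are forced at s = 0 and s = 1. The weight 64 is
  -- 78 - 14.
  certificate : ∀ s → ev h s ^ 6 ≈ (fromℕ 1 + fromℕ 10 * s ^ 13 + fromℕ 3 * (s ^ 13 * s ^ 13)) +
    (s * s + - s) * (fromℕ 64 * (ev (derivative h) s * ev u s) + ev (derivative u) s * ev h s)
  certificate = solve 1 (λ s → evₚ h s :^ 6 := (con 1 :+ con 10 :* s :^ 13 :+ con 3 :* (s :^ 13 :* s :^ 13)) :+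
    (s :* s :+ :- s) :* (con 64 :* (evₚ (derivative h) s :* evₚ u s) :+ evₚ (derivative u) s :* evₚ h s)) refl

  normalised : fromℕ 40 ≈ 1#
  normalised = trans (sym (*-identityʳ _)) (solve 0 (con 40 :* con 1 := con 1) refl)

  private
    form₁₁ₚ : ∀ {m} → ℕ → ℕ → ℕ → Polynomial m → Polynomial m → Polynomial m
    form₁₁ₚ c₀ c₁ c₂ u v = con c₀ :* u :^ 11 :+ con c₁ :* (u :^ 7 :* v :^ 4) :+ con c₂ :* (u :^ 3 :* v :^ 8)

    cells : List ℕ → List ℕ → List ℕ → List ℕ → Carrier → Carrier → Carrier
    cells k₀ k₁ k₂ k₃ e o = cell₄ 3 k₀ e o + cell₄ 2 k₁ e o * o + cell₄ 1 k₂ e o * (o * o) + cell₄ 0 k₃ e o * (o * o * o)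

    cellsₚ : ∀ {m} → List ℕ → List ℕ → List ℕ → List ℕ → Polynomial m → Polynomial m → Polynomial m
    cellsₚ k₀ k₁ k₂ k₃ e o = cell 3 k₀ :+ cell 2 k₁ :* o :+ cell 1 k₂ :* (o :* o) :+ cell 0 k₃ :* (o :* o :* o)
      where cell = λ r cs → e :^ r :* homₚ cs ((e :* e) :* (e :* e)) ((o :* o) :* (o :* o))

  -- In degree 11 the powers of e in front of the cells are 3, 2, 1, 0. Each later expansion takes
  -- its coefficients from the contraction of the previous class 0; x and y change places once,
  -- because contracted forms are divisible by x³.
  expansion₀ : ∀ e o → form₁₁ 1 10 3 (e + - o) (e + o) ≈
    cells (1 ∷ 9 ∷ 5 ∷ []) (0 ∷ 6 ∷ 12 ∷ []) (1 ∷ 7 ∷ 0 ∷ []) (8 ∷ 4 ∷ 12 ∷ []) e o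
  expansion₀ = solve 2 (λ e o → form₁₁ₚ 1 10 3 (e :+ :- o) (e :+ o) :=
    cellsₚ (1 ∷ 9 ∷ 5 ∷ []) (0 ∷ 6 ∷ 12 ∷ []) (1 ∷ 7 ∷ 0 ∷ []) (8 ∷ 4 ∷ 12 ∷ []) e o) refl

  expansion₁ : ∀ e o → form₁₁ 2 7 5 (e + o) (e + - o) ≈
    cells (1 ∷ 1 ∷ 5 ∷ []) (5 ∷ 0 ∷ 8 ∷ []) (8 ∷ 0 ∷ 5 ∷ []) (5 ∷ 1 ∷ 1 ∷ []) e o
  expansion₁ = solve 2 (λ e o → form₁₁ₚ 2 7 5 (e :+ o) (e :+ :- o) :=
    cellsₚ (1 ∷ 1 ∷ 5 ∷ []) (5 ∷ 0 ∷ 8 ∷ []) (8 ∷ 0 ∷ 5 ∷ []) (5 ∷ 1 ∷ 1 ∷ []) e o) refl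

  expansion₂ : ∀ e o → form₁₁ 7 2 5 (e + o) (e + - o) ≈
    cells (1 ∷ 4 ∷ 1 ∷ []) (6 ∷ 4 ∷ 2 ∷ []) (2 ∷ 4 ∷ 6 ∷ []) (1 ∷ 4 ∷ 1 ∷ []) e o
  expansion₂ = solve 2 (λ e o → form₁₁ₚ 7 2 5 (e :+ o) (e :+ :- o) :=
    cellsₚ (1 ∷ 4 ∷ 1 ∷ []) (6 ∷ 4 ∷ 2 ∷ []) (2 ∷ 4 ∷ 6 ∷ []) (1 ∷ 4 ∷ 1 ∷ []) e o) refl

  expansion₃ : ∀ e o → form₁₁ 6 7 1 (e + o) (e + - o) ≈
    cells (1 ∷ 5 ∷ 8 ∷ []) (4 ∷ 11 ∷ 5 ∷ []) (5 ∷ 11 ∷ 4 ∷ []) (8 ∷ 5 ∷ 1 ∷ []) e o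
  expansion₃ = solve 2 (λ e o → form₁₁ₚ 6 7 1 (e :+ o) (e :+ :- o) :=
    cellsₚ (1 ∷ 5 ∷ 8 ∷ []) (4 ∷ 11 ∷ 5 ∷ []) (5 ∷ 11 ∷ 4 ∷ []) (8 ∷ 5 ∷ 1 ∷ []) e o) refl

  private
    section : ∀ {m} → List ℕ → Polynomial m → Polynomial m → Polynomial m
    section cs x y = x :^ 3 :* homₚ cs ((x :* x) :* (x :* x)) ((x :* x) :* (x :* x) :+ :- ((y :* y) :* (y :* y)))

  -- The class 0 modulo 4 is again x³ times a quadratic form in x⁴ and y⁴, so the passage can be
  -- iterated on three coefficients.
  contraction₀ : ∀ x y → x ^ 3 * hom (1 ∷ 9 ∷ 5 ∷ []) ((x * x) * (x * x)) ((x * x) * (x * x) + - ((y * y) * (y * y))) ≈ form₁₁ 2 7 5 x y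
  contraction₀ = solve 2 (λ x y → section (1 ∷ 9 ∷ 5 ∷ []) x y := form₁₁ₚ 2 7 5 x y) refl

  contraction₁ : ∀ x y → x ^ 3 * hom (1 ∷ 1 ∷ 5 ∷ []) ((x * x) * (x * x)) ((x * x) * (x * x) + - ((y * y) * (y * y))) ≈ form₁₁ 7 2 5 x y
  contraction₁ = solve 2 (λ x y → section (1 ∷ 1 ∷ 5 ∷ []) x y := form₁₁ₚ 7 2 5 x y) refl

  contraction₂ : ∀ x y → x ^ 3 * hom (1 ∷ 4 ∷ 1 ∷ []) ((x * x) * (x * x)) ((x * x) * (x * x) + - ((y * y) * (y * y))) ≈ form₁₁ 6 7 1 x y
  contraction₂ = solve 2 (λ x y → section (1 ∷ 4 ∷ 1 ∷ []) x y := form₁₁ₚ 6 7 1 x y) refl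

  -- Here 8 + 5 = 13. The class 3 cells of the earlier expansions have 8 + 4, 5 + 1 and 1 + 4 in
  -- place of this sum and are not symmetric.
  symmetric : ∀ X Y → 1# * hom (8 ∷ 5 ∷ 1 ∷ []) X (X + - Y) ≈ (X + Y) * (X + Y) + fromℕ 4 * (X * Y)
  symmetric = solve 2 (λ X Y → con 1 :* homₚ (8 ∷ 5 ∷ 1 ∷ []) X (X :+ :- Y) := (X :+ Y) :* (X :+ Y) :+ con 4 :* (X :* Y)) refl

-- Vanishing classes of coefficients for 11 and 13

module Characteristic₁₁ {c ℓ} (R : CommutativeRing c ℓ)
  (char : CommutativeRing._≈_ R (IntegerCoefficients.fromℕ R 11) (CommutativeRing.0# R)) where
  open CommutativeRing R using (_≈_; 0#; trans; reflexive)
  open ThetaSeries R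
  open GaussIdentity R using (y; y-split; P; P⊗y)
  open MeanIteration R
  open Dissection R
  open Forms series
  open SeriesFrobenius R (from-yes (prime? 11)) char using (series-char)
  open Identities₁₁ series series-char
  open Hasse R 5 (from-yes (prime? 11)) char using (module Invariant)
  open Invariant 10 (8 ∷ 10 ∷ 10 ∷ 8 ∷ 10 ∷ []) ≡.refl normalised isogeny using (module Primitive)
  open Primitive u 43 ≡.refl 10 2 0 certificate using (form; U-P)
  open import Algebra.Properties.Semiring.Exp S.semiring using (^-congˡ)
  open Sℤ using (con; _:+_; _:*_; _:^_; _:=_; fromℕ)
  open import Relation.Binary.Reasoning.Setoid S.setoid

  U-P-form : U 11 0 P ≋ form₉ 10 2 0 y x
  U-P-form = begin
    U 11 0 P                              ≈⟨ U-P ⟩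
    P ⊗ form
      -- Every power of P is matched with an equal power of y, so that Gauss's identity removes it.
      ≈⟨ Sℤ.solve 3 (λ P y x → let t = (x :* x) :* (P :* P); s = t :* t; v = P :* y in
           P :* ((y :* y) :^ 5 :* (con (+ 10) :+ con (+ 2) :* s :+ con (+ 0) :* (s :* s))) :=
           con (+ 10) :* (v :* y :^ 9) :+ con (+ 2) :* (v :^ 5 :* (y :^ 5 :* x :^ 4)) :+ con (+ 0) :* (v :^ 9 :* (y :* x :^ 8)))
           S.refl P y x ⟩
    fromℕ 10 ⊗ (v ⊗ y ⊗^ 9) ⊕ fromℕ 2 ⊗ (v ⊗^ 5 ⊗ (y ⊗^ 5 ⊗ x ⊗^ 4)) ⊕ fromℕ 0 ⊗ (v ⊗^ 9 ⊗ (y ⊗ x ⊗^ 8))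
      ≈⟨ S.+-cong (S.+-cong (S.*-congˡ (S.*-congʳ P⊗y)) (S.*-congˡ (S.*-congʳ (^-congˡ 5 P⊗y)))) (S.*-congˡ (S.*-congʳ (^-congˡ 9 P⊗y))) ⟩
    fromℕ 10 ⊗ (𝟙 ⊗ y ⊗^ 9) ⊕ fromℕ 2 ⊗ (𝟙 ⊗^ 5 ⊗ (y ⊗^ 5 ⊗ x ⊗^ 4)) ⊕ fromℕ 0 ⊗ (𝟙 ⊗^ 9 ⊗ (y ⊗ x ⊗^ 8))
      ≈⟨ S.+-cong (S.+-cong (S.*-congˡ (S.*-identityˡ _)) (S.*-congˡ (S.trans (S.*-congʳ (1^ 5)) (S.*-identityˡ _))))
           (S.*-congˡ (S.trans (S.*-congʳ (1^ 9)) (S.*-identityˡ _))) ⟩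
    form₉ 10 2 0 y x ∎
    where
    open Characteristic series using (1^)
    v = P ⊗ y

  form₉-cong : ∀ c₀ c₁ c₂ {u u′ v v′} → u ≋ u′ → v ≋ v′ → form₉ c₀ c₁ c₂ u v ≋ form₉ c₀ c₁ c₂ u′ v′
  form₉-cong c₀ c₁ c₂ e e′ = S.+-cong (S.+-cong (S.*-congˡ (^-congˡ 9 e)) (S.*-congˡ (S.*-cong (^-congˡ 5 e) (^-congˡ 4 e′))))
      (S.*-congˡ (S.*-cong e (^-congˡ 8 e′)))

  -- 8n + 5 = 4(2n + 1) + 1 asks for an odd coefficient of the class 1 modulo 4, which is a
  -- symmetric cell times `g`, hence a series in q².
  vanishing : U 2 1 (U 2 0 (U 2 1 (U 11 0 P))) ≋ 𝟘
  vanishing = S.trans (U-cong 2 1 (section₁ dissected)) (U-odd-dilation {h′ = ψ} odd-part S.refl)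
    where
    dissected : U 11 0 P ≋ V 2 (V 2 (cell 1 (1 ∷ 7 ∷ 4 ∷ []))) ⊕ V 2 (V 2 (cell 0 (7 ∷ 4 ∷ 10 ∷ []))) ⊗ O ⊕
      V 2 (V 2 (cell 3 (0 ∷ 7 ∷ []))) ⊗ (O ⊗ O) ⊕ V 2 (V 2 (cell 2 (4 ∷ 0 ∷ []))) ⊗ (O ⊗ O ⊗ O)
    dissected = begin
      U 11 0 P                            ≈⟨ U-P-form ⟩
      form₉ 10 2 0 y x                    ≈⟨ form₉-cong 10 2 0 y-split x-split ⟩
      form₉ 10 2 0 (E ⊕ ⊝ O) (E ⊕ O)      ≈⟨ expansion E O ⟩
      _                                   ≈⟨ S.+-cong (S.+-cong (S.+-cong (VV-cell 1 (1 ∷ 7 ∷ 4 ∷ [])) (S.*-congʳ (VV-cell 0 (7 ∷ 4 ∷ 10 ∷ []))))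
                                               (S.*-congʳ (VV-cell 3 (0 ∷ 7 ∷ [])))) (S.*-congʳ (VV-cell 2 (4 ∷ 0 ∷ []))) ⟨
      _                                   ∎

    q = fromℕ 4 ⊗ (b ⊗ b) ⊕ ⊝ (fromℕ 2 ⊗ (a ⊗ a))

    odd-part : cell 0 (7 ∷ 4 ∷ 10 ∷ []) ≋ V 2 (fromℕ 10 ⊗ (q ⊗ q))
    odd-part = begin
      cell 0 (7 ∷ 4 ∷ 10 ∷ [])                          ≈⟨ symmetric (b ⊗ b) (a ⊗ a) ⟩
      fromℕ 10 ⊗ ((b ⊗ b ⊕ a ⊗ a) ⊗ (b ⊗ b ⊕ a ⊗ a))    ≈⟨ S.*-congˡ (S.*-cong fourthPowers fourthPowers) ⟩
      fromℕ 10 ⊗ (V 2 q ⊗ V 2 q)                        ≈⟨ S.*-cong (V-fromℕ 2 10) (V-⊗ 2 q q) ⟨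
      V 2 (fromℕ 10) ⊗ V 2 (q ⊗ q)                      ≈⟨ V-⊗ 2 _ _ ⟨
      V 2 (fromℕ 10 ⊗ (q ⊗ q))                          ∎

  congruence : ∀ n → IntegerCoefficients.fromℕ R (overpartition (11 ℕ.* (8 ℕ.* n ℕ.+ 5))) ≈ 0#
  congruence n = trans (reflexive (≡.cong P index)) (at vanishing n)
    where
    index : 11 ℕ.* (8 ℕ.* n ℕ.+ 5) ≡ (((n ℕ.* 2 ℕ.+ 1) ℕ.* 2 ℕ.+ 0) ℕ.* 2 ℕ.+ 1) ℕ.* 11 ℕ.+ 0
    index = ℕS.solve 1 (λ n → ℕS.con 11 ℕS.:* (ℕS.con 8 ℕS.:* n ℕS.:+ ℕS.con 5) ℕS.:=
      (((n ℕS.:* ℕS.con 2 ℕS.:+ ℕS.con 1) ℕS.:* ℕS.con 2 ℕS.:+ ℕS.con 0) ℕS.:* ℕS.con 2 ℕS.:+ ℕS.con 1) ℕS.:* ℕS.con 11 ℕS.:+ ℕS.con 0) ≡.refl n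

module Characteristic₁₃ {c ℓ} (R : CommutativeRing c ℓ)
  (char : CommutativeRing._≈_ R (IntegerCoefficients.fromℕ R 13) (CommutativeRing.0# R)) where
  open CommutativeRing R using (_≈_; 0#; trans; reflexive)
  open ThetaSeries R
  open GaussIdentity R using (y; y-split; P; P⊗y)
  open MeanIteration R
  open Dissection R
  open Forms series
  open SeriesFrobenius R (from-yes (prime? 13)) char using (series-char)
  open Identities₁₃ series series-char
  open Hasse R 6 (from-yes (prime? 13)) char using (module Invariant)
  open Invariant 1 (10 ∷ 4 ∷ 10 ∷ 4 ∷ 10 ∷ 1 ∷ []) ≡.refl normalised isogeny using (module Primitive)
  open Primitive u 64 ≡.refl 1 10 3 certificate using (form; U-P)
  open Sℤ using (con; _:+_; _:*_; _:^_; _:=_; fromℕ)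
  open import Algebra.Properties.Semiring.Exp S.semiring using (^-congˡ)
  open import Relation.Binary.Reasoning.Setoid S.setoid

  U-P-form : U 13 0 P ≋ form₁₁ 1 10 3 y x
  U-P-form = begin
    U 13 0 P                              ≈⟨ U-P ⟩
    P ⊗ form
      ≈⟨ Sℤ.solve 3 (λ P y x → let t = (x :* x) :* (P :* P); s = t :* t; v = P :* y in
           P :* ((y :* y) :^ 6 :* (con (+ 1) :+ con (+ 10) :* s :+ con (+ 3) :* (s :* s))) :=
           con (+ 1) :* (v :* y :^ 11) :+ con (+ 10) :* (v :^ 5 :* (y :^ 7 :* x :^ 4)) :+ con (+ 3) :* (v :^ 9 :* (y :^ 3 :* x :^ 8)))
           S.refl P y x ⟩
    fromℕ 1 ⊗ (v ⊗ y ⊗^ 11) ⊕ fromℕ 10 ⊗ (v ⊗^ 5 ⊗ (y ⊗^ 7 ⊗ x ⊗^ 4)) ⊕ fromℕ 3 ⊗ (v ⊗^ 9 ⊗ (y ⊗^ 3 ⊗ x ⊗^ 8))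
      ≈⟨ S.+-cong (S.+-cong (S.*-congˡ (S.*-congʳ P⊗y)) (S.*-congˡ (S.*-congʳ (^-congˡ 5 P⊗y)))) (S.*-congˡ (S.*-congʳ (^-congˡ 9 P⊗y))) ⟩
    fromℕ 1 ⊗ (𝟙 ⊗ y ⊗^ 11) ⊕ fromℕ 10 ⊗ (𝟙 ⊗^ 5 ⊗ (y ⊗^ 7 ⊗ x ⊗^ 4)) ⊕ fromℕ 3 ⊗ (𝟙 ⊗^ 9 ⊗ (y ⊗^ 3 ⊗ x ⊗^ 8))
      ≈⟨ S.+-cong (S.+-cong (S.*-congˡ (S.*-identityˡ _)) (S.*-congˡ (S.trans (S.*-congʳ (1^ 5)) (S.*-identityˡ _))))
           (S.*-congˡ (S.trans (S.*-congʳ (1^ 9)) (S.*-identityˡ _))) ⟩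
    form₁₁ 1 10 3 y x ∎
    where
    open Characteristic series using (1^)
    v = P ⊗ y

  form₁₁-cong : ∀ c₀ c₁ c₂ {u u′ v v′} → u ≋ u′ → v ≋ v′ → form₁₁ c₀ c₁ c₂ u v ≋ form₁₁ c₀ c₁ c₂ u′ v′
  form₁₁-cong c₀ c₁ c₂ e e′ = S.+-cong (S.+-cong (S.*-congˡ (^-congˡ 11 e)) (S.*-congˡ (S.*-cong (^-congˡ 7 e) (^-congˡ 4 e′))))
    (S.*-congˡ (S.*-cong (^-congˡ 3 e) (^-congˡ 8 e′)))

  dilatedCells : ∀ k₀ k₁ k₂ k₃ → dilatedCell 3 k₀ ⊕ dilatedCell 2 k₁ ⊗ O ⊕ dilatedCell 1 k₂ ⊗ (O ⊗ O) ⊕ dilatedCell 0 k₃ ⊗ (O ⊗ O ⊗ O) ≋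
    V 2 (V 2 (cell 3 k₀)) ⊕ V 2 (V 2 (cell 2 k₁)) ⊗ O ⊕ V 2 (V 2 (cell 1 k₂)) ⊗ (O ⊗ O) ⊕ V 2 (V 2 (cell 0 k₃)) ⊗ (O ⊗ O ⊗ O)
  dilatedCells k₀ k₁ k₂ k₃ = S.sym (S.+-cong (S.+-cong (S.+-cong (VV-cell 3 k₀) (S.*-congʳ (VV-cell 2 k₁)))
    (S.*-congʳ (VV-cell 1 k₂))) (S.*-congʳ (VV-cell 0 k₃)))

  U₄ : Pow → Pow
  U₄ f = U 2 0 (U 2 0 f)

  U₄-cong : ∀ {f g} → f ≋ g → U₄ f ≋ U₄ g
  U₄-cong e = U-cong 2 0 (U-cong 2 0 e)

  step₀ : U₄ (form₁₁ 1 10 3 y x) ≋ form₁₁ 2 7 5 x y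
  step₀ = S.trans (section₀ (S.trans (form₁₁-cong 1 10 3 y-split x-split) (S.trans (expansion₀ E O)
    (dilatedCells (1 ∷ 9 ∷ 5 ∷ []) (0 ∷ 6 ∷ 12 ∷ []) (1 ∷ 7 ∷ 0 ∷ []) (8 ∷ 4 ∷ 12 ∷ []))))) (contraction₀ x y)

  step₁ : U₄ (form₁₁ 2 7 5 x y) ≋ form₁₁ 7 2 5 x y
  step₁ = S.trans (section₀ (S.trans (form₁₁-cong 2 7 5 x-split y-split) (S.trans (expansion₁ E O)
    (dilatedCells (1 ∷ 1 ∷ 5 ∷ []) (5 ∷ 0 ∷ 8 ∷ []) (8 ∷ 0 ∷ 5 ∷ []) (5 ∷ 1 ∷ 1 ∷ []))))) (contraction₁ x y)

  step₂ : U₄ (form₁₁ 7 2 5 x y) ≋ form₁₁ 6 7 1 x y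
  step₂ = S.trans (section₀ (S.trans (form₁₁-cong 7 2 5 x-split y-split) (S.trans (expansion₂ E O)
    (dilatedCells (1 ∷ 4 ∷ 1 ∷ []) (6 ∷ 4 ∷ 2 ∷ []) (2 ∷ 4 ∷ 6 ∷ []) (1 ∷ 4 ∷ 1 ∷ []))))) (contraction₂ x y)

  U₆₄-P : U₄ (U₄ (U₄ (U 13 0 P))) ≋ form₁₁ 6 7 1 x y
  U₆₄-P = S.trans (U₄-cong (U₄-cong (S.trans (U₄-cong U-P-form) step₀))) (S.trans (U₄-cong step₁) step₂)

  -- Three applications of `U₄` divide the exponent by 64, and 8n + 7 = 4(2n + 1) + 3 asks for an
  -- odd coefficient of the class 3, a symmetric cell times the cube of `g`.
  vanishing : U 2 1 (U 2 1 (U 2 1 (U₄ (U₄ (U₄ (U 13 0 P)))))) ≋ 𝟘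
  vanishing = S.trans (U-cong 2 1 (section₃ dissected)) (U-odd-dilation {h′ = ψ ⊗ ψ ⊗ ψ} odd-part
      (S.sym (S.trans (V-⊗ 2 _ _) (S.*-congʳ (V-⊗ 2 _ _)))))
    where
    dissected : U₄ (U₄ (U₄ (U 13 0 P))) ≋ _
    dissected = S.trans U₆₄-P (S.trans (form₁₁-cong 6 7 1 x-split y-split) (S.trans (expansion₃ E O)
      (dilatedCells (1 ∷ 5 ∷ 8 ∷ []) (4 ∷ 11 ∷ 5 ∷ []) (5 ∷ 11 ∷ 4 ∷ []) (8 ∷ 5 ∷ 1 ∷ []))))

    q = fromℕ 4 ⊗ (b ⊗ b) ⊕ ⊝ (fromℕ 2 ⊗ (a ⊗ a))

    product : (b ⊗ b) ⊗ (a ⊗ a) ≋ V 2 ((a ⊗ a) ⊗ (a ⊗ a))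
    product = begin
      (b ⊗ b) ⊗ (a ⊗ a)                         ≈⟨ Sℤ.solve 2 (λ a b → (b :* b) :* (a :* a) := (a :* b) :* (a :* b)) S.refl a b ⟩
      (a ⊗ b) ⊗ (a ⊗ b)                         ≈⟨ S.*-cong geometric geometric ⟨
      (V 2 a ⊗ V 2 a) ⊗ (V 2 a ⊗ V 2 a)         ≈⟨ S.*-cong (V-⊗ 2 a a) (V-⊗ 2 a a) ⟨
      V 2 (a ⊗ a) ⊗ V 2 (a ⊗ a)                 ≈⟨ V-⊗ 2 (a ⊗ a) (a ⊗ a) ⟨
      V 2 ((a ⊗ a) ⊗ (a ⊗ a))                   ∎

    odd-part : cell 0 (8 ∷ 5 ∷ 1 ∷ []) ≋ V 2 (q ⊗ q ⊕ fromℕ 4 ⊗ ((a ⊗ a) ⊗ (a ⊗ a)))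
    odd-part = begin
      cell 0 (8 ∷ 5 ∷ 1 ∷ [])
        ≈⟨ symmetric (b ⊗ b) (a ⊗ a) ⟩
      (b ⊗ b ⊕ a ⊗ a) ⊗ (b ⊗ b ⊕ a ⊗ a) ⊕ fromℕ 4 ⊗ ((b ⊗ b) ⊗ (a ⊗ a))
        ≈⟨ S.+-cong (S.*-cong fourthPowers fourthPowers) (S.*-congˡ product) ⟩
      V 2 q ⊗ V 2 q ⊕ fromℕ 4 ⊗ V 2 ((a ⊗ a) ⊗ (a ⊗ a))
        ≈⟨ S.+-cong (V-⊗ 2 q q) (S.trans (V-⊗ 2 _ _) (S.*-congʳ (V-fromℕ 2 4))) ⟨
      V 2 (q ⊗ q) ⊕ V 2 (fromℕ 4 ⊗ ((a ⊗ a) ⊗ (a ⊗ a)))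
        ≈⟨ V-⊕ 2 _ _ ⟨
      V 2 (q ⊗ q ⊕ fromℕ 4 ⊗ ((a ⊗ a) ⊗ (a ⊗ a))) ∎

  congruence : ∀ n → IntegerCoefficients.fromℕ R (overpartition (13 ℕ.* 2 ℕ.^ 6 ℕ.* (8 ℕ.* n ℕ.+ 7))) ≈ 0#
  congruence n = trans (reflexive (≡.cong P index)) (at vanishing n)
    where
    index : 13 ℕ.* 2 ℕ.^ 6 ℕ.* (8 ℕ.* n ℕ.+ 7) ≡
      ((((((((((n ℕ.* 2 ℕ.+ 1) ℕ.* 2 ℕ.+ 1) ℕ.* 2 ℕ.+ 1) ℕ.* 2 ℕ.+ 0) ℕ.* 2 ℕ.+ 0) ℕ.* 2 ℕ.+ 0) ℕ.* 2 ℕ.+ 0) ℕ.* 2 ℕ.+ 0) ℕ.* 2 ℕ.+ 0)) ℕ.* 13 ℕ.+ 0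
    index = ℕS.solve 1 (λ n → let even = λ k → k ℕS.:* ℕS.con 2 ℕS.:+ ℕS.con 0; odd = λ k → k ℕS.:* ℕS.con 2 ℕS.:+ ℕS.con 1 in
      ℕS.con 13 ℕS.:* ℕS.con 64 ℕS.:* (ℕS.con 8 ℕS.:* n ℕS.:+ ℕS.con 7) ℕS.:=
      even (even (even (even (even (even (odd (odd (odd n)))))))) ℕS.:* ℕS.con 13 ℕS.:+ ℕS.con 0) ≡.refl n

-- The integers modulo m

module IntegersModulo (m : ℕ) where
  infix 4 _≈_
  -- Residues are integers under a coarser equality, so divisibility by m can be read off directly
  -- from an equation with `+ 0`.
  record _≈_ (i j : ℤ) : Set where
    constructor congruent
    field difference : + m ℤ∣.∣ i ℤ.- j
  open _≈_ public

  private
    ≡⇒≈ : ∀ {i j} → i ≡ j → i ≈ j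
    ≡⇒≈ {i} ≡.refl = congruent (≡.subst (+ m ℤ∣.∣_) (≡.sym (ℤₚ.+-inverseʳ i)) (ℤ∣.divides (+ 0) ≡.refl))

    from-difference : ∀ {i j k} → i ℤ.- j ≡ k → + m ℤ∣.∣ k → i ≈ j
    from-difference e d = congruent (≡.subst (+ m ℤ∣.∣_) (≡.sym e) d)

  open ℤS using (_:+_; _:*_; _:-_; :-_; _:=_)

  ring : CommutativeRing _ _
  ring = record
    { Carrier = ℤ ; _≈_ = _≈_ ; _+_ = ℤ._+_ ; _*_ = ℤ._*_ ; -_ = ℤ.-_ ; 0# = + 0 ; 1# = + 1
    ; isCommutativeRing = record
      { isRing = record
        { +-isAbelianGroup = record
          { isGroup = record
            { isMonoid = record
              { isSemigroup = record
                { isMagma = record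
                  { isEquivalence = record
                    { refl  = ≡⇒≈ ≡.refl
                    ; sym   = λ {i} {j} e → from-difference
                        (ℤS.solve 2 (λ i j → j :- i := :- (i :- j)) ≡.refl i j) (ℤ∣.∣m⇒∣-m (difference e))
                    ; trans = λ {i} {j} {k} e e′ → from-difference
                        (ℤS.solve 3 (λ i j k → i :- k := (i :- j) :+ (j :- k)) ≡.refl i j k)
                        (ℤ∣.∣m∣n⇒∣m+n (difference e) (difference e′)) }
                  ; ∙-cong = λ {i} {i′} {j} {j′} e e′ → from-difference
                      (ℤS.solve 4 (λ i i′ j j′ → (i :+ j) :- (i′ :+ j′) := (i :- i′) :+ (j :- j′)) ≡.refl i i′ j j′)
                      (ℤ∣.∣m∣n⇒∣m+n (difference e) (difference e′)) }
                ; assoc = λ i j k → ≡⇒≈ (ℤₚ.+-assoc i j k) }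
              ; identity = (λ i → ≡⇒≈ (ℤₚ.+-identityˡ i)) , (λ i → ≡⇒≈ (ℤₚ.+-identityʳ i)) }
            ; inverse = (λ i → ≡⇒≈ (ℤₚ.+-inverseˡ i)) , (λ i → ≡⇒≈ (ℤₚ.+-inverseʳ i))
            ; ⁻¹-cong = λ {i} {j} e → from-difference
                (ℤS.solve 2 (λ i j → (:- i) :- (:- j) := :- (i :- j)) ≡.refl i j) (ℤ∣.∣m⇒∣-m (difference e)) }
          ; comm = λ i j → ≡⇒≈ (ℤₚ.+-comm i j) }
        ; *-cong = λ {i} {i′} {j} {j′} e e′ → from-difference
            (ℤS.solve 4 (λ i i′ j j′ → (i :* j) :- (i′ :* j′) := (i :- i′) :* j :+ i′ :* (j :- j′)) ≡.refl i i′ j j′)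
            (ℤ∣.∣m∣n⇒∣m+n (ℤ∣.∣m⇒∣m*n j (difference e)) (ℤ∣.∣n⇒∣m*n i′ (difference e′)))
        ; *-assoc = λ i j k → ≡⇒≈ (ℤₚ.*-assoc i j k)
        ; *-identity = (λ i → ≡⇒≈ (ℤₚ.*-identityˡ i)) , (λ i → ≡⇒≈ (ℤₚ.*-identityʳ i))
        ; distrib = (λ i j k → ≡⇒≈ (ℤₚ.*-distribˡ-+ i j k)) , (λ i j k → ≡⇒≈ (ℤₚ.*-distribʳ-+ i j k)) }
      ; *-comm = λ i j → ≡⇒≈ (ℤₚ.*-comm i j) } }

  open IntegerCoefficients ring using (fromℕ)

  private
    fromℕ-≡ : ∀ n → fromℕ n ≡ + n
    fromℕ-≡ zero          = ≡.refl
    fromℕ-≡ (suc zero)    = ≡.refl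
    fromℕ-≡ (suc (suc n)) = ≡.trans (≡.cong (ℤ._+ + 1) (fromℕ-≡ (suc n)))
      (≡.trans (≡.sym (ℤₚ.pos-+ (suc n) 1)) (≡.cong +_ (ℕₚ.+-comm (suc n) 1)))

  fromℕ-m : fromℕ m ≈ + 0
  fromℕ-m = from-difference (≡.trans (ℤₚ.+-identityʳ _) (fromℕ-≡ m)) ℤ∣.∣-refl

  fromℕ-zero : ∀ {n} → fromℕ n ≈ + 0 → m ∣ n
  fromℕ-zero {n} e = ℤ∣.∣⇒∣ᵤ (≡.subst (+ m ℤ∣.∣_) (≡.trans (ℤₚ.+-identityʳ _) (fromℕ-≡ n)) (difference e))

open import Data.Nat using (_+_; _*_; _^_)
open import Data.Product using (_×_)

mainTheorem1 : (n : ℕ) →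
    (11 ∣ overpartition (11 * (8 * n + 5))) ×
    (13 ∣ overpartition (13 * 2 ^ 6 * (8 * n + 7)))
mainTheorem1 n =
  fromℕ-zero 11 (Characteristic₁₁.congruence (ring 11) (fromℕ-m 11) n) ,
  fromℕ-zero 13 (Characteristic₁₃.congruence (ring 13) (fromℕ-m 13) n)
  where open IntegersModulo
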